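{- Let $\lambda,\mu,\nu$ be partitions with at most $3$ parts (written as triples $(\xi_1,\xi_2,\xi_3)$, $\xi_1\ge\xi_2\ge\xi_3\ge0$). Then the Littlewood–Richardson coefficient $c^{\lambda}_{\mu,\nu}$ (the coefficient of $s_\lambda$ in $s_\mu s_\nu$, Schur functions) equals $1$ if and only if $(\lambda,\mu,\nu)$ lies on a facet of the Horn cone $\mathcal{H}_3$, i.e. $|\lambda|=|\mu|+|\nu|$, all eighteen inequalities listed below hold, and at least one of them holds with equality.
   Context: The eighteen inequalities defining $\mathcal{H}_3$ (together with $|\lambda|=|\mu|+|\nu|$, where $|\xi|=\xi_1+\xi_2+\xi_3$) are: (1) $\mu_3\le\mu_2$; (2) $\mu_2\le\mu_1$; (3) $\nu_3\le\nu_2$; (4) $\nu_2\le\nu_1$; (5) $\lambda_3\le\lambda_2$; (6) $\lambda_2\le\lambda_1$; (7) $\lambda_1\le\mu_1+\nu_1$; (8) $\lambda_2\le\mu_1+\nu_2$; (9) $\lambda_2\le\mu_2+\nu_1$; (10) $\lambda_3\le\mu_1+\nu_3$; (11) $\lambda_3\le\mu_2+\nu_2$; (12) $\lambda_3\le\mu_3+\nu_1$; (13) $\lambda_3\ge\mu_3+\nu_3$; (14) $\lambda_2\ge\mu_3+\nu_2$; (15) $\lambda_2\ge\mu_2+\nu_3$; (16) $\lambda_1\ge\mu_3+\nu_1$; (17) $\lambda_1\ge\mu_2+\nu_2$; (18) $\lambda_1\ge\mu_1+\nu_3$. A facet is the set of points of $\mathcal{H}_3$ at which one of these inequalities is an equality.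 -}

module Defs where

open import Data.Fin as Fin using (Fin)
open import Data.Fin.Properties as Fin using ()
open import Data.Integer as ℤ using (ℤ; +_)
open import Data.List using (List; []; _∷_; length; map; filter; foldr; concat; zip; allFin; cartesianProductWith)
open import Data.List.Properties as List using ()
open import Data.List.Relation.Unary.All as All using (All)
open import Data.List.Relation.Unary.Any using (Any)
open import Data.List.Relation.Unary.Linked as Linked using (Linked)
open import Data.Nat using (ℕ; zero; suc; _+_; _≤_; _<_; _≥_; _≟_)
open import Data.Product using (_×_; _,_; proj₁; proj₂; ∃-syntax; uncurry)
open import Data.Vec as Vec using (Vec)
open import Data.Vec.Properties as Vec using ()
open import Relation.Binary.PropositionalEquality using (_≡_)
open import Relation.Nullary.Decidable using (Dec; _×-dec_)

-- Zero parts are not stored, so distinct partitions have distinct lists of parts.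
record Partition : Set where
  constructor mkPartition
  field
    parts      : List ℕ
    decreasing : Linked _≥_ parts
    positive   : All (0 <_) parts

open Partition public

ℓ : Partition → ℕ
ℓ κ = length (parts κ)

nth : List ℕ → ℕ → ℕ
nth []       _       = 0
nth (p ∷ _)  zero    = p
nth (_ ∷ ps) (suc i) = nth ps i

-- The parts κ₁, κ₂, κ₃, padded with zeros.
_₁ _₂ _₃ : Partition → ℕ
κ ₁ = nth (parts κ) 0
κ ₂ = nth (parts κ) 1
κ ₃ = nth (parts κ) 2

-- A filling of a Young diagram (English notation), as its list of rows.
-- The entry i : Fin n stands for the variable x_{i+1}.
Filling : ℕ → Set
Filling n = List (List (Fin n))

words : ∀ n → ℕ → List (List (Fin n))
words n zero    = [] ∷ []
words n (suc k) = cartesianProductWith _∷_ (allFin n) (words n k)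

fillings : ∀ n → List ℕ → List (Filling n)
fillings n []       = [] ∷ []
fillings n (p ∷ ps) = cartesianProductWith _∷_ (words n p) (fillings n ps)

-- zip stops at the end of the shorter row, i.e. it pairs vertically adjacent boxes.
_Above_ : ∀ {n} → List (Fin n) → List (Fin n) → Set
r Above r′ = All (uncurry Fin._<_) (zip r r′)

SemiStandard : ∀ {n} → Filling n → Set
SemiStandard T = All (Linked Fin._≤_) T × Linked _Above_ T

semiStandard? : ∀ {n} (T : Filling n) → Dec (SemiStandard T)
semiStandard? T =
  All.all? (Linked.linked? Fin._≤?_) T
    ×-dec Linked.linked? (λ r r′ → All.all? (uncurry Fin._<?_) (zip r r′)) T

ssyt : ∀ n → Partition → List (Filling n)
ssyt n κ = filter semiStandard? (fillings n (parts κ))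

weight : ∀ {n} → Filling n → Vec ℕ n
weight T = Vec.tabulate (λ i → length (filter (i Fin.≟_) (concat T)))

-- Polynomials in n variables with coefficients in ℕ, as formal sums of monomials;
-- a monomial is its exponent vector, and a repeated monomial has that multiplicity
-- as its coefficient.
Poly : ℕ → Set
Poly n = List (Vec ℕ n)

coeff : ∀ {n} → Vec ℕ n → Poly n → ℕ
coeff α p = length (filter (Vec.≡-dec _≟_ α) p)

_⊗_ : ∀ {n} → Poly n → Poly n → Poly n
_⊗_ = cartesianProductWith (Vec.zipWith _+_)

-- s_κ(x₁,…,xₙ) = Σ x^T over semistandard tableaux T of shape κ with entries in {1,…,n}.
schur : ∀ n → Partition → Poly n
schur n κ = map weight (ssyt n κ)

sumℤ : List ℤ → ℤ
sumℤ = foldr ℤ._+_ (+ 0)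

-- Formal finite ℤ-linear combinations Σ a s_κ; terms with equal κ add up.
SchurComb : Set
SchurComb = List (ℤ × Partition)

coeffAt : Partition → SchurComb → ℤ
coeffAt κ L =
  sumℤ (map proj₁ (filter (λ t → List.≡-dec _≟_ (parts κ) (parts (proj₂ t))) L))

-- The coefficient of x^α in Σ a s_κ(x₁,…,xₙ).
evalCoeff : ∀ {n} → Vec ℕ n → SchurComb → ℤ
evalCoeff {n} α L = sumℤ (map (λ t → proj₁ t ℤ.* (+ coeff α (schur n (proj₂ t)))) L)

-- s_μ s_ν = Σ a s_κ as symmetric functions in x₁, x₂, …. A monomial involves only finitely
-- many variables, so this says that all coefficients agree in every number n of variables.
IsSchurExpansion : Partition → Partition → SchurComb → Set
IsSchurExpansion μ ν L =
  ∀ n (α : Vec ℕ n) → + coeff α (schur n μ ⊗ schur n ν) ≡ evalCoeff α L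

-- c is the coefficient of s_lam in s_μ s_ν.
IsLRCoefficient : (lam μ ν : Partition) → ℤ → Set
IsLRCoefficient lam μ ν c = ∃[ L ] (IsSchurExpansion μ ν L × coeffAt lam L ≡ c)

-- The pair (a , b) stands for the inequality a ≤ b.
hornInequalities : (lam μ ν : Partition) → List (ℕ × ℕ)
hornInequalities lam μ ν =
    (μ ₃ , μ ₂)
  ∷ (μ ₂ , μ ₁)
  ∷ (ν ₃ , ν ₂)
  ∷ (ν ₂ , ν ₁)
  ∷ (lam ₃ , lam ₂)
  ∷ (lam ₂ , lam ₁)
  ∷ (lam ₁ , μ ₁ + ν ₁)
  ∷ (lam ₂ , μ ₁ + ν ₂)
  ∷ (lam ₂ , μ ₂ + ν ₁)
  ∷ (lam ₃ , μ ₁ + ν ₃)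
  ∷ (lam ₃ , μ ₂ + ν ₂)
  ∷ (lam ₃ , μ ₃ + ν ₁)
  ∷ (μ ₃ + ν ₃ , lam ₃)
  ∷ (μ ₃ + ν ₂ , lam ₂)
  ∷ (μ ₂ + ν ₃ , lam ₂)
  ∷ (μ ₃ + ν ₁ , lam ₁)
  ∷ (μ ₂ + ν ₂ , lam ₁)
  ∷ (μ ₁ + ν ₃ , lam ₁)
  ∷ []

∣_∣₃ : Partition → ℕ
∣ κ ∣₃ = κ ₁ + κ ₂ + κ ₃

InHornCone : (lam μ ν : Partition) → Set
InHornCone lam μ ν =
  ∣ lam ∣₃ ≡ ∣ μ ∣₃ + ∣ ν ∣₃ × All (uncurry _≤_) (hornInequalities lam μ ν)

OnFacet : (lam μ ν : Partition) → Set
OnFacet lam μ ν = InHornCone lam μ ν × Any (uncurry _≡_) (hornInequalities lam μ ν)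

{-# OPTIONS --safe #-}
module Submission where

-- Pairing polynomials in x₁, x₂, x₃ with test functions φ : ℕ³ → ℤ, the bialternant formula
-- a_ρ s_κ = a_{κ+ρ} follows by telescoping over Gelfand–Tsetlin patterns, so c is the coefficient
-- of x^{λ+ρ} in a_{ν+ρ} s_μ. Since s_μ = (x₁x₂x₃)^{μ₃} (h_p h_q − h_{p+1} h_{q−1}) with p = μ₁ − μ₃ and
-- q = μ₂ − μ₃, two Pieri steps and the Lindström–Gessel–Viennot cancellation give c = N(t) − N(t+1),
-- where N(t) counts the points with coordinate sum t of a box in ℤ³ (those interlacing with ν + μ₃
-- and λ). This difference is the number of integers in an interval whose lower end is a maximum
-- of three and whose upper end is a minimum of six linear forms (the hives with boundary λ, μ, ν), and
-- the 18 differences of these forms are the slacks of the Horn inequalities. Hence c = 1 + the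
-- least slack inside the cone, and c = 0 outside.

open import Defs
open import Data.Empty using (⊥)
open import Data.Fin as Fin using (Fin)
open import Data.Fin.Patterns using (0F; 1F; 2F)
import Data.Fin.Properties as Finₚ
open import Data.Integer using (ℤ; +_; 0ℤ; 1ℤ; _+_; _*_; _-_; -_)
open import Data.Integer.Properties as ℤₚ using (+-identityʳ; +-identityˡ)
open import Data.Integer.Tactic.RingSolver using (solve-∀)
open import Data.List using (List; []; _∷_; _++_; map; filter; upTo; applyUpTo; cartesianProductWith; replicate; zip; length; allFin; concat)
import Data.List.Properties as Listₚ
open import Data.List.Relation.Binary.Pointwise using (Pointwise; []; _∷_)
open import Data.List.Relation.Unary.All as All using (All; []; _∷_)
open import Data.List.Relation.Unary.All.Properties using (¬All⇒Any¬)
open import Data.List.Relation.Unary.Any using (Any; here; there)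
open import Data.List.Relation.Unary.Linked using (Linked; linked?; []; [-]; _∷_)
open import Data.Nat as ℕ using (ℕ; zero; suc; z≤n; s≤s; _≤_; _<_)
import Data.Nat.Properties as ℕₚ
import Data.Nat.Tactic.RingSolver as ℕ-Ring
open import Data.Product using (_×_; _,_; proj₁; proj₂; uncurry; map₁; ∃-syntax)
open import Data.Sum using (_⊎_; inj₁; inj₂)
open import Data.Vec as Vec using (Vec; []; _∷_)
import Data.Vec.Properties as Vecₚ
open import Function using (_∘_; id)
open import Function.Bundles using (_⇔_; mk⇔)
open import Relation.Binary.PropositionalEquality
open import Relation.Nullary using (Dec; yes; no; ¬_; contradiction)
open import Relation.Nullary.Decidable using (_×-dec_)
open ≡-Reasoning

-- Finite sums and indicators

-- `Poly` has coefficients and exponents in ℕ, so alternants cannot be written in it. The dual side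
-- has no such limit: a test function is any map to ℤ, multiplication by a monomial becomes a
-- translation of its argument, and multiplication by a_ρ an alternating sum of six translations.
-- The complete homogeneous polynomials are never formed either. One of them is a slice of fixed
-- coordinate sum; the other is the indicator of a box, whose degree is fixed by homogeneity. Hence
-- q is never named, and q = 0, where h_(q-1) vanishes, is not a special case. The counting half
-- meets another obstacle: minima and maxima of many linear forms, in ℕ with truncated subtraction.
-- No minimum is computed there. A count g is described by the statements k ≤ g for k ≥ 1, each of
-- which unfolds to a list of linear inequalities k + q ≤ p. Positivity of k makes a truncated
-- difference as good as a true one. In the end only k = 1 and k = 2 matter: the cone is where k = 1
-- holds, and its facets are where k = 2 fails in addition.

private variable
  A B C : Set
  P Q : Set

∑ : List A → (A → ℤ) → ℤ
∑ []       f = 0ℤ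
∑ (x ∷ xs) f = f x + ∑ xs f

∑-cong : ∀ (xs : List A) {f g : A → ℤ} → (∀ x → f x ≡ g x) → ∑ xs f ≡ ∑ xs g
∑-cong []       eq = refl
∑-cong (x ∷ xs) eq = cong₂ _+_ (eq x) (∑-cong xs eq)

∑-zero : ∀ (xs : List A) {f : A → ℤ} → (∀ x → f x ≡ 0ℤ) → ∑ xs f ≡ 0ℤ
∑-zero []       eq = refl
∑-zero (x ∷ xs) eq = cong₂ _+_ (eq x) (∑-zero xs eq)

∑-+ : ∀ (xs : List A) (f g : A → ℤ) → ∑ xs (λ x → f x + g x) ≡ ∑ xs f + ∑ xs g
∑-+ []       f g = refl
∑-+ (x ∷ xs) f g =
  trans (cong (_+_ (f x + g x)) (∑-+ xs f g)) (interchange (f x) (g x) (∑ xs f) (∑ xs g))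
  where
  interchange : ∀ a b c d → a + b + (c + d) ≡ a + c + (b + d)
  interchange = solve-∀

∑-neg : ∀ (xs : List A) (f : A → ℤ) → ∑ xs (λ x → - f x) ≡ - ∑ xs f
∑-neg []       f = refl
∑-neg (x ∷ xs) f =
  trans (cong (_+_ (- f x)) (∑-neg xs f)) (sym (ℤₚ.neg-distrib-+ (f x) (∑ xs f)))

∑-- : ∀ (xs : List A) (f g : A → ℤ) → ∑ xs (λ x → f x - g x) ≡ ∑ xs f - ∑ xs g
∑-- xs f g = trans (∑-+ xs f (λ x → - g x)) (cong (_+_ (∑ xs f)) (∑-neg xs g))

∑-* : ∀ (xs : List A) (k : ℤ) (f : A → ℤ) → ∑ xs (λ x → k * f x) ≡ k * ∑ xs f
∑-* []       k f = sym (ℤₚ.*-zeroʳ k)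
∑-* (x ∷ xs) k f =
  trans (cong (_+_ (k * f x)) (∑-* xs k f)) (sym (ℤₚ.*-distribˡ-+ k (f x) (∑ xs f)))

∑-swap : ∀ (xs : List A) (ys : List B) (f : A → B → ℤ) →
         ∑ xs (λ x → ∑ ys (f x)) ≡ ∑ ys (λ y → ∑ xs (λ x → f x y))
∑-swap []       ys f = sym (∑-zero ys (λ _ → refl))
∑-swap (x ∷ xs) ys f =
  trans (cong (_+_ (∑ ys (f x))) (∑-swap xs ys f)) (sym (∑-+ ys (f x) _))

∑-map : ∀ (g : A → B) (xs : List A) (f : B → ℤ) → ∑ (map g xs) f ≡ ∑ xs (f ∘ g)
∑-map g []       f = refl
∑-map g (x ∷ xs) f = cong (_+_ (f (g x))) (∑-map g xs f)

∑-++ : ∀ (xs ys : List A) (f : A → ℤ) → ∑ (xs ++ ys) f ≡ ∑ xs f + ∑ ys f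
∑-++ []       ys f = sym (+-identityˡ _)
∑-++ (x ∷ xs) ys f = trans (cong (_+_ (f x)) (∑-++ xs ys f)) (sym (ℤₚ.+-assoc (f x) _ _))

∑-cartesian : ∀ (_∙_ : A → B → C) xs ys (f : C → ℤ) →
              ∑ (cartesianProductWith _∙_ xs ys) f ≡ ∑ xs (λ x → ∑ ys (λ y → f (x ∙ y)))
∑-cartesian _∙_ []       ys f = refl
∑-cartesian _∙_ (x ∷ xs) ys f =
  trans (∑-++ (map (x ∙_) ys) _ f) (cong₂ _+_ (∑-map (x ∙_) ys f) (∑-cartesian _∙_ xs ys f))

𝟙 : Dec P → ℤ
𝟙 (yes _) = 1ℤ
𝟙 (no  _) = 0ℤ

𝟙-yes : (d : Dec P) → P → 𝟙 d ≡ 1ℤ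
𝟙-yes (yes _) p = refl
𝟙-yes (no ¬p) p = contradiction p ¬p

𝟙-no : (d : Dec P) → ¬ P → 𝟙 d ≡ 0ℤ
𝟙-no (yes p) ¬p = contradiction p ¬p
𝟙-no (no _)  ¬p = refl

𝟙-cong : (d : Dec P) (e : Dec Q) → (P → Q) → (Q → P) → 𝟙 d ≡ 𝟙 e
𝟙-cong (yes p) e f g = sym (𝟙-yes e (f p))
𝟙-cong (no ¬p) e f g = sym (𝟙-no e (¬p ∘ g))

∑-filter : ∀ {P : A → Set} (P? : ∀ x → Dec (P x)) xs (f : A → ℤ) →
           ∑ (filter P? xs) f ≡ ∑ xs (λ x → 𝟙 (P? x) * f x)
∑-filter P? []       f = refl
∑-filter P? (x ∷ xs) f with P? x
... | yes _ = cong₂ _+_ (sym (ℤₚ.*-identityˡ (f x))) (∑-filter P? xs f)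
... | no  _ = trans (∑-filter P? xs f) (sym (trans (cong (_+ rest) (ℤₚ.*-zeroˡ (f x))) (+-identityˡ rest)))
  where rest = ∑ xs (λ y → 𝟙 (P? y) * f y)

-- Sums over pairs of fixed sum

antidiagonal : ℕ → List (ℕ × ℕ)
antidiagonal zero    = (0 , 0) ∷ []
antidiagonal (suc n) = (0 , suc n) ∷ map (map₁ suc) (antidiagonal n)

anti : ℕ → (ℕ → ℕ → ℤ) → ℤ
anti n f = ∑ (antidiagonal n) (uncurry f)

anti-zero : ∀ f → anti 0 f ≡ f 0 0
anti-zero f = +-identityʳ _

anti-suc : ∀ n f → anti (suc n) f ≡ f 0 (suc n) + anti n (λ i j → f (suc i) j)
anti-suc n f = cong (_+_ (f 0 (suc n))) (∑-map (map₁ suc) (antidiagonal n) (uncurry f))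

anti-cong : ∀ n {f g} → (∀ i j → i ℕ.+ j ≡ n → f i j ≡ g i j) → anti n f ≡ anti n g
anti-cong zero    eq = cong (_+ 0ℤ) (eq 0 0 refl)
anti-cong (suc n) {f} {g} eq = begin
  anti (suc n) f                              ≡⟨ anti-suc n f ⟩
  f 0 (suc n) + anti n (λ i j → f (suc i) j)  ≡⟨ cong₂ _+_ (eq 0 (suc n) refl)
                                                   (anti-cong n λ i j i+j → eq (suc i) j (cong suc i+j)) ⟩
  g 0 (suc n) + anti n (λ i j → g (suc i) j)  ≡⟨ sym (anti-suc n g) ⟩
  anti (suc n) g                              ∎

-- Moving one unit from the second index to the first is a step along the antidiagonal. This is how
-- a factor x_i - x_j of a_ρ cancels a summation over patterns.
anti-telescope : ∀ n (f : ℕ → ℕ → ℤ) → anti n (λ i j → f (suc i) j - f i (suc j)) ≡ f (suc n) 0 - f 0 (suc n)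
anti-telescope zero    f = +-identityʳ (f 1 0 - f 0 1)
anti-telescope (suc n) f = begin
  anti (suc n) (λ i j → f (suc i) j - f i (suc j))
    ≡⟨ anti-suc n (λ i j → f (suc i) j - f i (suc j)) ⟩
  f 1 (suc n) - f 0 (suc (suc n)) + anti n (λ i j → f (suc (suc i)) j - f (suc i) (suc j))
    ≡⟨ cong (_+_ (f 1 (suc n) - f 0 (suc (suc n)))) (anti-telescope n (f ∘ suc)) ⟩
  f 1 (suc n) - f 0 (suc (suc n)) + (f (suc (suc n)) 0 - f 1 (suc n))
    ≡⟨ cancel (f 1 (suc n)) _ (f (suc (suc n)) 0) ⟩
  f (suc (suc n)) 0 - f 0 (suc (suc n)) ∎
  where
  cancel : ∀ a b c → a - b + (c - a) ≡ c - b
  cancel = solve-∀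

-- Both sides run over the triples of sum `n`, bracketed differently.
anti-assoc : ∀ n (f : ℕ → ℕ → ℕ → ℤ) →
             anti n (λ i j → anti j (λ k l → f i k l)) ≡ anti n (λ i j → anti i (λ k l → f k l j))
anti-assoc zero    f = refl
anti-assoc (suc n) f = begin
  anti (suc n) (λ i j → anti j (f i))
    ≡⟨ anti-suc n (λ i j → anti j (f i)) ⟩
  anti (suc n) (f 0) + anti n (λ i j → anti j (f (suc i)))
    ≡⟨ cong₂ _+_ (anti-suc n (f 0)) (anti-assoc n (f ∘ suc)) ⟩
  f 0 0 (suc n) + anti n (λ i j → f 0 (suc i) j) + anti n (λ i j → anti i (λ k l → f (suc k) l j))
    ≡⟨ ℤₚ.+-assoc (f 0 0 (suc n)) _ _ ⟩
  f 0 0 (suc n) + (anti n (λ i j → f 0 (suc i) j) + anti n (λ i j → anti i (λ k l → f (suc k) l j)))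
    ≡⟨ cong₂ _+_ (sym (anti-zero (λ k l → f k l (suc n))))
         (trans (sym (∑-+ (antidiagonal n) _ _))
                (anti-cong n λ i j _ → sym (anti-suc i (λ k l → f k l j)))) ⟩
  anti 0 (λ k l → f k l (suc n)) + anti n (λ i j → anti (suc i) (λ k l → f k l j))
    ≡⟨ sym (anti-suc n (λ i j → anti i (λ k l → f k l j))) ⟩
  anti (suc n) (λ i j → anti i (λ k l → f k l j)) ∎

-- The substitution i ↦ m + i absorbs the constraint; interlacing conditions disappear from the
-- tableau sums in this way.
anti-≤ : ∀ m n (f : ℕ → ℕ → ℤ) → anti (m ℕ.+ n) (λ i j → 𝟙 (m ℕ.≤? i) * f i j) ≡ anti n (λ i j → f (m ℕ.+ i) j)
anti-≤ zero    n f = anti-cong n λ i j _ → ℤₚ.*-identityˡ (f i j)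
anti-≤ (suc m) n f = begin
  anti (suc (m ℕ.+ n)) (λ i j → 𝟙 (suc m ℕ.≤? i) * f i j)
    ≡⟨ anti-suc (m ℕ.+ n) (λ i j → 𝟙 (suc m ℕ.≤? i) * f i j) ⟩
  0ℤ * f 0 (suc (m ℕ.+ n)) + anti (m ℕ.+ n) (λ i j → 𝟙 (suc m ℕ.≤? suc i) * f (suc i) j)
    ≡⟨ cong₂ _+_ (ℤₚ.*-zeroˡ (f 0 (suc (m ℕ.+ n))))
         (anti-cong (m ℕ.+ n) λ i j _ →
            cong (_* f (suc i) j) (𝟙-cong (suc m ℕ.≤? suc i) (m ℕ.≤? i) ℕ.s≤s⁻¹ ℕ.s≤s)) ⟩
  0ℤ + anti (m ℕ.+ n) (λ i j → 𝟙 (m ℕ.≤? i) * f (suc i) j)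
    ≡⟨ trans (+-identityˡ _) (anti-≤ m n (f ∘ suc)) ⟩
  anti n (λ i j → f (suc m ℕ.+ i) j) ∎

-- Alternants and Gelfand-Tsetlin patterns

Test : Set
Test = ℕ → ℕ → ℕ → ℤ

alternate : (a b c d e f : ℤ) → ℤ
alternate a b c d e f = a - b - c + d + e - f

alternate-cong : ∀ {a b c d e f a′ b′ c′ d′ e′ f′} → a ≡ a′ → b ≡ b′ → c ≡ c′ → d ≡ d′ → e ≡ e′ → f ≡ f′ →
  alternate a b c d e f ≡ alternate a′ b′ c′ d′ e′ f′
alternate-cong refl refl refl refl refl refl = refl

-- Σ over w ∈ S₃ of sgn(w) φ(w(k₁,k₂,k₃)).
Alt : ℕ → ℕ → ℕ → Test → ℤ
Alt k₁ k₂ k₃ φ =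
  alternate (φ k₁ k₂ k₃) (φ k₁ k₃ k₂) (φ k₂ k₁ k₃) (φ k₂ k₃ k₁) (φ k₃ k₁ k₂) (φ k₃ k₂ k₁)

Alt-cong : ∀ k₁ k₂ k₃ {φ ψ : Test} → (∀ x y z → φ x y z ≡ ψ x y z) → Alt k₁ k₂ k₃ φ ≡ Alt k₁ k₂ k₃ ψ
Alt-cong a b c eq
  rewrite eq a b c | eq a c b | eq b a c | eq b c a | eq c a b | eq c b a = refl

∑-alternate : ∀ (xs : List A) (a b c d e f : A → ℤ) →
  ∑ xs (λ x → alternate (a x) (b x) (c x) (d x) (e x) (f x)) ≡
  alternate (∑ xs a) (∑ xs b) (∑ xs c) (∑ xs d) (∑ xs e) (∑ xs f)
∑-alternate xs a b c d e f =
  trans (∑-- xs _ f) (cong (_- ∑ xs f)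
  (trans (∑-+ xs _ e) (cong (_+ ∑ xs e)
  (trans (∑-+ xs _ d) (cong (_+ ∑ xs d)
  (trans (∑-- xs _ c) (cong (_- ∑ xs c) (∑-- xs a b))))))))

-- Dual to multiplication by the monomial with exponent (x, y, z).
translate : ℕ → ℕ → ℕ → Test → Test
translate x y z φ a b c = φ (x ℕ.+ a) (y ℕ.+ b) (z ℕ.+ c)

-- The sum of φ over the weights of the Gelfand–Tsetlin patterns with top row (r+E+D, r+E, r).
GT : (D E r : ℕ) → Test → ℤ
GT D E r φ =
  -- The summation variables are slacks of interlacing inequalities: the middle row is (r+E+a, r+b)
  -- and the bottom row is r+b+i. The arguments of `φ` are the differences of consecutive row sums.
  anti D λ a e → anti E λ b b̄ → anti (b̄ ℕ.+ a) λ i d →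
    φ (r ℕ.+ b ℕ.+ i) (r ℕ.+ b ℕ.+ d) (r ℕ.+ e ℕ.+ b̄)

GT-cong : ∀ D E r {φ ψ : Test} →
          (∀ x y z → x ℕ.+ y ℕ.+ z ≡ (r ℕ.+ E ℕ.+ D) ℕ.+ (r ℕ.+ E) ℕ.+ r → φ x y z ≡ ψ x y z) →
          GT D E r φ ≡ GT D E r ψ
GT-cong D E r eq =
  anti-cong D λ a e a+e → anti-cong E λ b b̄ b+b̄ → anti-cong (b̄ ℕ.+ a) λ i d i+d →
    eq _ _ _ (size a e b b̄ i d a+e b+b̄ i+d)
  where
  regroup : ∀ r b i d e b̄ → (r ℕ.+ b ℕ.+ i) ℕ.+ (r ℕ.+ b ℕ.+ d) ℕ.+ (r ℕ.+ e ℕ.+ b̄) ≡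
            (i ℕ.+ d) ℕ.+ (3 ℕ.* r ℕ.+ 2 ℕ.* b ℕ.+ e ℕ.+ b̄)
  regroup = ℕ-Ring.solve-∀
  regroup′ : ∀ r b a e b̄ → b̄ ℕ.+ a ℕ.+ (3 ℕ.* r ℕ.+ 2 ℕ.* b ℕ.+ e ℕ.+ b̄) ≡
             (r ℕ.+ (b ℕ.+ b̄) ℕ.+ (a ℕ.+ e)) ℕ.+ (r ℕ.+ (b ℕ.+ b̄)) ℕ.+ r
  regroup′ = ℕ-Ring.solve-∀
  size : ∀ a e b b̄ i d → a ℕ.+ e ≡ D → b ℕ.+ b̄ ≡ E → i ℕ.+ d ≡ b̄ ℕ.+ a →
         (r ℕ.+ b ℕ.+ i) ℕ.+ (r ℕ.+ b ℕ.+ d) ℕ.+ (r ℕ.+ e ℕ.+ b̄) ≡ (r ℕ.+ E ℕ.+ D) ℕ.+ (r ℕ.+ E) ℕ.+ r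
  size a e b b̄ i d refl refl i+d =
    trans (regroup r b i d e b̄) (trans (cong (ℕ._+ (3 ℕ.* r ℕ.+ 2 ℕ.* b ℕ.+ e ℕ.+ b̄)) i+d) (regroup′ r b a e b̄))

cong₃ : ∀ (φ : Test) {x x′ y y′ z z′} → x ≡ x′ → y ≡ y′ → z ≡ z′ → φ x y z ≡ φ x′ y′ z′
cong₃ φ refl refl refl = refl

module _ where
  open ℕₚ using (+-suc; +-comm)

  private
    -- φ(x₁,x₂,x₃) multiplied by (x₁ − x₃)(x₂ − x₃).
    ψ : Test → Test
    ψ φ x y z = φ (suc x) (suc y) z - φ (suc x) y (suc z) - φ x (suc y) (suc z) + φ x y (suc (suc z))

    -- a_ρ = (x₁ - x₂) · (x₁ - x₃)(x₂ - x₃), with the second factor carried by `ψ`. Two of the eight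
    -- products cancel.
    Alt-210 : ∀ φ x y z → Alt 2 1 0 (translate x y z φ) ≡ ψ φ (suc x) y z - ψ φ x (suc y) z
    Alt-210 φ x y z
      rewrite +-comm x 2 | +-comm x 1 | +-comm x 0 | +-comm y 2 | +-comm y 1 | +-comm y 0
            | +-comm z 2 | +-comm z 1 | +-comm z 0 =
      regroup (φ (2 ℕ.+ x) (1 ℕ.+ y) z) _ (φ (1 ℕ.+ x) (2 ℕ.+ y) z) _ _ _ (φ (1 ℕ.+ x) (1 ℕ.+ y) (1 ℕ.+ z))
      where
      regroup : ∀ a b c d e f g → a - b - c + d + e - f ≡ a - b - g + d - (c - g - e + f)
      regroup = solve-∀

    -- What is left when two factors of a_ρ have telescoped. In the third value the first two
    -- arguments agree, so it is unchanged when they are exchanged and drops out of the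
    -- antisymmetrization in `GT-bialternant`.
    corners : Test → ℕ → ℕ → ℕ → ℤ
    corners φ D E r =
      φ (suc (suc (r ℕ.+ E ℕ.+ D))) (suc (r ℕ.+ E)) r
      - φ (suc (suc (r ℕ.+ E ℕ.+ D))) r (suc (r ℕ.+ E))
      - (φ (suc (r ℕ.+ E)) (suc (r ℕ.+ E)) (suc (r ℕ.+ D))
        - φ (suc (r ℕ.+ E)) r (suc (suc (r ℕ.+ E ℕ.+ D))))

    -- The factor x₂ - x₃ telescopes along (b, b̄), and then x₁ - x₃ along (a, e).
    half : ∀ φ D E r →
      anti D (λ a e → anti E (λ b b̄ → ψ φ (suc (r ℕ.+ E ℕ.+ a)) (r ℕ.+ b) (r ℕ.+ e ℕ.+ b̄))) ≡
      corners φ D E r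
    half φ D E r = begin
      anti D (λ a e → anti E (λ b b̄ → ψ φ (suc (r ℕ.+ E ℕ.+ a)) (r ℕ.+ b) (r ℕ.+ e ℕ.+ b̄)))
        ≡⟨ anti-cong D (λ a e _ → inner a e) ⟩
      anti D (λ a e → g (suc a) e - g a (suc e))
        ≡⟨ anti-telescope D g ⟩
      g (suc D) 0 - g 0 (suc D)
        ≡⟨ cong₂ _-_
             (cong₂ _-_ (cong₃ φ (cong suc (+-suc (r ℕ.+ E) D)) refl (+-comm r 0))
                        (cong₃ φ (cong suc (+-suc (r ℕ.+ E) D)) refl (cong (λ x → suc (x ℕ.+ E)) (+-comm r 0))))
             (cong₂ _-_ (cong₃ φ (cong suc (+-comm (r ℕ.+ E) 0)) refl (+-suc r D))
                        (cong₃ φ (cong suc (+-comm (r ℕ.+ E) 0)) refl (top r D E))) ⟩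
      corners φ D E r ∎
      where
      g : ℕ → ℕ → ℤ
      g a e = φ (suc (r ℕ.+ E ℕ.+ a)) (suc (r ℕ.+ E)) (r ℕ.+ e)
            - φ (suc (r ℕ.+ E ℕ.+ a)) r (suc (r ℕ.+ e ℕ.+ E))
      top : ∀ r D E → suc (r ℕ.+ suc D ℕ.+ E) ≡ suc (suc (r ℕ.+ E ℕ.+ D))
      top = ℕ-Ring.solve-∀
      inner : ∀ a e → anti E (λ b b̄ → ψ φ (suc (r ℕ.+ E ℕ.+ a)) (r ℕ.+ b) (r ℕ.+ e ℕ.+ b̄)) ≡
                      g (suc a) e - g a (suc e)
      inner a e = begin
        anti E (λ b b̄ → ψ φ X (r ℕ.+ b) (Z ℕ.+ b̄))
          ≡⟨ anti-cong E (λ b b̄ _ → step b b̄) ⟩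
        anti E (λ b b̄ → f (suc b) b̄ - f b (suc b̄))
          ≡⟨ anti-telescope E f ⟩
        f (suc E) 0 - f 0 (suc E)
          ≡⟨ cong₂ _-_
               (cong₂ _-_ (cong₃ φ refl (+-suc r E) (+-comm Z 0))
                          (cong₃ φ refl (+-suc r E) (cong suc (+-comm Z 0))))
               (cong₂ _-_ (cong₃ φ refl (+-comm r 0) (+-suc Z E))
                          (cong₃ φ refl (+-comm r 0) (cong suc (+-suc Z E)))) ⟩
        φ (suc X) (suc (r ℕ.+ E)) Z - φ X (suc (r ℕ.+ E)) (suc Z)
          - (φ (suc X) r (suc (Z ℕ.+ E)) - φ X r (suc (suc (Z ℕ.+ E))))
          ≡⟨ exchange (φ (suc X) (suc (r ℕ.+ E)) Z) _ _ _ ⟩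
        φ (suc X) (suc (r ℕ.+ E)) Z - φ (suc X) r (suc (Z ℕ.+ E))
          - (φ X (suc (r ℕ.+ E)) (suc Z) - φ X r (suc (suc (Z ℕ.+ E))))
          ≡⟨ sym (cong₂ _-_
               (cong₂ _-_ (cong₃ φ (cong suc (+-suc (r ℕ.+ E) a)) refl refl)
                          (cong₃ φ (cong suc (+-suc (r ℕ.+ E) a)) refl refl))
               (cong₂ _-_ (cong₃ φ refl refl (+-suc r e))
                          (cong₃ φ refl refl (cong (λ x → suc (x ℕ.+ E)) (+-suc r e))))) ⟩
        g (suc a) e - g a (suc e) ∎
        where
        X = suc (r ℕ.+ E ℕ.+ a)
        Z = r ℕ.+ e
        f : ℕ → ℕ → ℤ
        f b b̄ = φ (suc X) (r ℕ.+ b) (Z ℕ.+ b̄) - φ X (r ℕ.+ b) (suc (Z ℕ.+ b̄))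
        exchange : ∀ a b c d → a - b - (c - d) ≡ a - c - (b - d)
        exchange = solve-∀
        regroup : ∀ a b c d → a - b - c + d ≡ a - c - (b - d)
        regroup = solve-∀
        step : ∀ b b̄ → ψ φ X (r ℕ.+ b) (Z ℕ.+ b̄) ≡ f (suc b) b̄ - f b (suc b̄)
        step b b̄ rewrite +-suc r b | +-suc Z b̄ =
          regroup (φ (suc X) (suc (r ℕ.+ b)) (Z ℕ.+ b̄)) _ _ _

  -- a_ρ s_κ = a_{κ+ρ}, paired with φ.
  GT-bialternant : ∀ D E r φ →
    GT D E r (λ x y z → Alt 2 1 0 (translate x y z φ)) ≡
    Alt (suc (suc (r ℕ.+ E ℕ.+ D))) (suc (r ℕ.+ E)) r φ
  GT-bialternant D E r φ = begin
    GT D E r (λ x y z → Alt 2 1 0 (translate x y z φ))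
      ≡⟨ anti-cong D (λ a e _ → anti-cong E (λ b b̄ b+b̄ → inner a e b b̄ b+b̄)) ⟩
    anti D (λ a e → anti E (λ b b̄ → Ψ a e b b̄ - Ψ′ a e b b̄))
      ≡⟨ anti-cong D (λ a e _ → ∑-- (antidiagonal E) (uncurry (Ψ a e)) (uncurry (Ψ′ a e))) ⟩
    anti D (λ a e → anti E (Ψ a e) - anti E (Ψ′ a e))
      ≡⟨ ∑-- (antidiagonal D) (uncurry λ a e → anti E (Ψ a e)) (uncurry λ a e → anti E (Ψ′ a e)) ⟩
    anti D (λ a e → anti E (Ψ a e)) - anti D (λ a e → anti E (Ψ′ a e))
      ≡⟨ cong₂ _-_ (half φ D E r) (half φ′ D E r) ⟩
    corners φ D E r - corners φ′ D E r
      ≡⟨ regroup (φ k₁ k₂ r) (φ k₁ r k₂) (φ k₂ k₂ (suc (r ℕ.+ D))) (φ k₂ r k₁) (φ k₂ k₁ r) (φ r k₁ k₂) (φ r k₂ k₁) ⟩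
    Alt k₁ k₂ r φ ∎
    where
    k₁ = suc (suc (r ℕ.+ E ℕ.+ D))
    k₂ = suc (r ℕ.+ E)
    φ′ : Test
    φ′ x y z = φ y x z
    Ψ Ψ′ : (a e b b̄ : ℕ) → ℤ
    Ψ  a e b b̄ = ψ φ  (suc (r ℕ.+ E ℕ.+ a)) (r ℕ.+ b) (r ℕ.+ e ℕ.+ b̄)
    Ψ′ a e b b̄ = ψ φ′ (suc (r ℕ.+ E ℕ.+ a)) (r ℕ.+ b) (r ℕ.+ e ℕ.+ b̄)
    regroup : ∀ a b c d e f g → a - b - (c - d) - (e - f - (c - g)) ≡ a - b - e + d + f - g
    regroup = solve-∀
    exchange : ∀ a b c d → a - b - c + d ≡ a - c - b + d
    exchange = solve-∀
    outer : ∀ r b b̄ a → r ℕ.+ b ℕ.+ suc (b̄ ℕ.+ a) ≡ suc (r ℕ.+ (b ℕ.+ b̄) ℕ.+ a)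
    outer = ℕ-Ring.solve-∀
    -- Here x₁ - x₂ telescopes along the bottom row. The two boundary values differ by exchanging x₁
    -- and x₂, which is why the second is `Ψ′`, built from `φ′`.
    inner : ∀ a e b b̄ → b ℕ.+ b̄ ≡ E →
      anti (b̄ ℕ.+ a) (λ i d →
        Alt 2 1 0 (translate (r ℕ.+ b ℕ.+ i) (r ℕ.+ b ℕ.+ d) (r ℕ.+ e ℕ.+ b̄) φ)) ≡
      Ψ a e b b̄ - Ψ′ a e b b̄
    inner a e b b̄ refl = begin
      anti (b̄ ℕ.+ a) (λ i d → Alt 2 1 0 (translate (Y ℕ.+ i) (Y ℕ.+ d) Z φ))
        ≡⟨ anti-cong (b̄ ℕ.+ a) (λ i d _ → trans (Alt-210 φ (Y ℕ.+ i) (Y ℕ.+ d) Z)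
             (sym (cong₂ _-_ (cong₃ (ψ φ) (+-suc Y i) refl refl) (cong₃ (ψ φ) refl (+-suc Y d) refl)))) ⟩
      anti (b̄ ℕ.+ a) (λ i d → f (suc i) d - f i (suc d))
        ≡⟨ anti-telescope (b̄ ℕ.+ a) f ⟩
      f (suc (b̄ ℕ.+ a)) 0 - f 0 (suc (b̄ ℕ.+ a))
        ≡⟨ cong₂ _-_ (cong₃ (ψ φ) (outer r b b̄ a) (+-comm Y 0) refl)
                     (trans (cong₃ (ψ φ) (+-comm Y 0) (outer r b b̄ a) refl)
                            (exchange (φ (suc Y) _ Z) (φ (suc Y) _ (suc Z)) _ _)) ⟩
      Ψ a e b b̄ - Ψ′ a e b b̄ ∎
      where
      Y = r ℕ.+ b
      Z = r ℕ.+ e ℕ.+ b̄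
      f : ℕ → ℕ → ℤ
      f i d = ψ φ (Y ℕ.+ i) (Y ℕ.+ d) Z

-- Semistandard tableaux with entries in {1,2,3}

𝟙-× : (d : Dec P) (e : Dec Q) → 𝟙 (d ×-dec e) ≡ 𝟙 d * 𝟙 e
𝟙-× (yes _) (yes _) = refl
𝟙-× (yes _) (no _)  = refl
𝟙-× (no _)  (yes _) = refl
𝟙-× (no _)  (no _)  = refl

𝟙-Linked : ∀ {R : A → A → Set} (R? : ∀ x y → Dec (R x y)) x y zs →
           𝟙 (linked? R? (x ∷ y ∷ zs)) ≡ 𝟙 (R? x y) * 𝟙 (linked? R? (y ∷ zs))
𝟙-Linked R? x y zs =
  trans (𝟙-cong (linked? R? (x ∷ y ∷ zs)) (R? x y ×-dec linked? R? (y ∷ zs))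
           (λ { (r ∷ l) → r , l }) (λ { (r , l) → r ∷ l }))
        (𝟙-× (R? x y) (linked? R? (y ∷ zs)))

𝟙-All : ∀ {P : A → Set} (P? : ∀ x → Dec (P x)) x xs →
        𝟙 (All.all? P? (x ∷ xs)) ≡ 𝟙 (P? x) * 𝟙 (All.all? P? xs)
𝟙-All P? x xs =
  trans (𝟙-cong (All.all? P? (x ∷ xs)) (P? x ×-dec All.all? P? xs)
           (λ { (p ∷ ps) → p , ps }) (λ { (p , ps) → p ∷ ps }))
        (𝟙-× (P? x) (All.all? P? xs))

sorted? : ∀ {n} (w : List (Fin n)) → Dec (Linked Fin._≤_ w)
sorted? = linked? Fin._≤?_

row : ℕ → ℕ → ℕ → List (Fin 3)
row c d e = replicate c 0F ++ replicate d 1F ++ replicate e 2F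

module _ where
  private
    -- The letter `i` in front encodes that all letters are at least `i`, so that the recursion on
    -- the first letter has the same shape at each stage.
    sortedFrom : Fin 3 → ℕ → (List (Fin 3) → ℤ) → ℤ
    sortedFrom i p g = ∑ (words 3 p) (λ w → 𝟙 (sorted? (i ∷ w)) * g w)

    sortedFrom-suc : ∀ i p g →
      sortedFrom i (suc p) g ≡ ∑ (allFin 3) (λ j → 𝟙 (i Fin.≤? j) * sortedFrom j p (g ∘ (j ∷_)))
    sortedFrom-suc i p g =
      trans (∑-cartesian _∷_ (allFin 3) (words 3 p) _)
            (∑-cong (allFin 3) λ j →
              trans (∑-cong (words 3 p) λ w →
                       trans (cong (_* g (j ∷ w)) (𝟙-Linked Fin._≤?_ i j w))
                             (ℤₚ.*-assoc (𝟙 (i Fin.≤? j)) _ _))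
                    (∑-* (words 3 p) (𝟙 (i Fin.≤? j)) _))

    sortedFrom-zero : ∀ i g → sortedFrom i 0 g ≡ g []
    sortedFrom-zero i g = unit (g [])
      where
      unit : ∀ x → 1ℤ * x + 0ℤ ≡ x
      unit = solve-∀

    sortedFrom-2 : ∀ p g → sortedFrom 2F p g ≡ g (replicate p 2F)
    sortedFrom-2 zero    g = sortedFrom-zero 2F g
    sortedFrom-2 (suc p) g =
      trans (sortedFrom-suc 2F p g)
            (trans (only-last (sortedFrom 0F p (g ∘ (0F ∷_))) (sortedFrom 1F p (g ∘ (1F ∷_))) _)
                   (sortedFrom-2 p (g ∘ (2F ∷_))))
      where
      only-last : ∀ x y z → 0ℤ * x + (0ℤ * y + (1ℤ * z + 0ℤ)) ≡ z
      only-last = solve-∀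

    sortedFrom-1 : ∀ p g → sortedFrom 1F p g ≡ anti p (λ d e → g (row 0 d e))
    sortedFrom-1 zero    g = trans (sortedFrom-zero 1F g) (sym (anti-zero (λ d e → g (row 0 d e))))
    sortedFrom-1 (suc p) g =
      trans (sortedFrom-suc 1F p g)
            (trans (last-two (sortedFrom 0F p (g ∘ (0F ∷_))) (sortedFrom 1F p (g ∘ (1F ∷_)))
                            (sortedFrom 2F p (g ∘ (2F ∷_))))
                   (trans (cong₂ _+_ (sortedFrom-2 p (g ∘ (2F ∷_))) (sortedFrom-1 p (g ∘ (1F ∷_))))
                          (sym (anti-suc p (λ d e → g (row 0 d e))))))
      where
      last-two : ∀ x y z → 0ℤ * x + (1ℤ * y + (1ℤ * z + 0ℤ)) ≡ z + y
      last-two = solve-∀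

    sortedFrom-0 : ∀ p g → sortedFrom 0F p g ≡ anti p (λ c r → anti r (λ d e → g (row c d e)))
    sortedFrom-0 zero    g =
      trans (sortedFrom-zero 0F g) (sym (trans (anti-zero (λ c r → anti r (λ d e → g (row c d e))))
                                               (anti-zero (λ d e → g (row 0 d e)))))
    sortedFrom-0 (suc p) g =
      trans (sortedFrom-suc 0F p g)
            (trans (all-three (sortedFrom 0F p (g ∘ (0F ∷_))) (sortedFrom 1F p (g ∘ (1F ∷_)))
                             (sortedFrom 2F p (g ∘ (2F ∷_))))
                   (trans (cong₂ _+_
                             (trans (cong₂ _+_ (sortedFrom-2 p (g ∘ (2F ∷_))) (sortedFrom-1 p (g ∘ (1F ∷_))))
                                    (sym (anti-suc p (λ d e → g (row 0 d e)))))
                             (sortedFrom-0 p (g ∘ (0F ∷_))))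
                          (sym (anti-suc p (λ c r → anti r (λ d e → g (row c d e)))))))
      where
      all-three : ∀ x y z → 1ℤ * x + (1ℤ * y + (1ℤ * z + 0ℤ)) ≡ (z + y) + x
      all-three = solve-∀

    sorted-0∷ : ∀ (w : List (Fin 3)) → 𝟙 (sorted? w) ≡ 𝟙 (sorted? (0F ∷ w))
    sorted-0∷ w = 𝟙-cong (sorted? w) (sorted? (0F ∷ w)) (to w) (from w)
      where
      to : ∀ w → Linked Fin._≤_ w → Linked Fin._≤_ (0F ∷ w)
      to []      _ = [-]
      to (_ ∷ _) l = z≤n ∷ l
      from : ∀ w → Linked Fin._≤_ (0F ∷ w) → Linked Fin._≤_ w
      from []      _       = []
      from (_ ∷ _) (_ ∷ l) = l

  ∑-sorted-words : ∀ p g →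
    ∑ (words 3 p) (λ w → 𝟙 (sorted? w) * g w) ≡ anti p (λ c r → anti r (λ d e → g (row c d e)))
  ∑-sorted-words p g =
    trans (∑-cong (words 3 p) λ w → cong (_* g w) (sorted-0∷ w)) (sortedFrom-0 p g)

above? : ∀ {n} (r r′ : List (Fin n)) → Dec (r Above r′)
above? r r′ = All.all? (uncurry Fin._<?_) (zip r r′)

-- The letters `1F` of the lower row need `0F` above them, its letters `2F` need `0F` or `1F`. The
-- bound on the length ensures that `zip` reaches every letter of the lower row.
row-Above⇒ : ∀ c d e b b̄ → b ℕ.+ b̄ ≤ c ℕ.+ (d ℕ.+ e) → row c d e Above row 0 b b̄ →
             b ≤ c × b ℕ.+ b̄ ≤ c ℕ.+ d
row-Above⇒ c       d       e       zero    zero    len a       = z≤n , z≤n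
row-Above⇒ (suc c) d       e       zero    (suc b̄) len (_ ∷ a) =
  z≤n , s≤s (proj₂ (row-Above⇒ c d e zero b̄ (ℕ.s≤s⁻¹ len) a))
row-Above⇒ zero    (suc d) e       zero    (suc b̄) len (_ ∷ a) =
  z≤n , s≤s (proj₂ (row-Above⇒ zero d e zero b̄ (ℕ.s≤s⁻¹ len) a))
row-Above⇒ zero    zero    (suc e) zero    (suc b̄) len (s≤s (s≤s ()) ∷ _)
row-Above⇒ (suc c) d       e       (suc b) b̄       len (_ ∷ a) =
  let b≤c , b+b̄≤c+d = row-Above⇒ c d e b b̄ (ℕ.s≤s⁻¹ len) a in s≤s b≤c , s≤s b+b̄≤c+d
row-Above⇒ zero    (suc d) e       (suc b) b̄       len (s≤s () ∷ _)
row-Above⇒ zero    zero    (suc e) (suc b) b̄       len (s≤s () ∷ _)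

row-Above⇐ : ∀ c d e b b̄ → b ≤ c → b ℕ.+ b̄ ≤ c ℕ.+ d → row c d e Above row 0 b b̄
row-Above⇐ zero    zero    zero    zero    zero    b≤c _ = []
row-Above⇐ zero    zero    (suc e) zero    zero    b≤c _ = []
row-Above⇐ zero    (suc d) e       zero    zero    b≤c _ = []
row-Above⇐ (suc c) d       e       zero    zero    b≤c _ = []
row-Above⇐ (suc c) d       e       zero    (suc b̄) b≤c (s≤s q) = s≤s z≤n ∷ row-Above⇐ c d e zero b̄ z≤n q
row-Above⇐ zero    (suc d) e       zero    (suc b̄) b≤c (s≤s q) = s≤s (s≤s z≤n) ∷ row-Above⇐ zero d e zero b̄ z≤n q
row-Above⇐ (suc c) d       e       (suc b) b̄       (s≤s b≤c) (s≤s q) = s≤s z≤n ∷ row-Above⇐ c d e b b̄ b≤c q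

row-¬Above-0 : ∀ c d e c′ w → 1 ≤ c ℕ.+ (d ℕ.+ e) → ¬ (row c d e Above (replicate (suc c′) 0F ++ w))
row-¬Above-0 (suc c) d       e       c′ w _ (() ∷ _)
row-¬Above-0 zero    (suc d) e       c′ w _ (() ∷ _)
row-¬Above-0 zero    zero    (suc e) c′ w _ (() ∷ _)

anti-head : ∀ n (f : ℕ → ℕ → ℤ) → (∀ i j → suc i ℕ.+ j ≡ n → f (suc i) j ≡ 0ℤ) → anti n f ≡ f 0 n
anti-head zero    f f≡0 = anti-zero f
anti-head (suc n) f f≡0 =
  trans (anti-suc n f) (trans (cong (_+_ (f 0 (suc n)))
    (trans (anti-cong n (λ i j i+j → f≡0 i j (cong suc i+j))) (∑-zero (antidiagonal n) (λ _ → refl))))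
    (+-identityʳ _))

-- No `0F` can lie under another letter, and the length bound puts a letter above each box; so only
-- rows without `0F` contribute.
∑-words-below : ∀ c d e p (h : List (Fin 3) → ℤ) → p ≤ c ℕ.+ (d ℕ.+ e) →
  ∑ (words 3 p) (λ w → 𝟙 (sorted? w) * (𝟙 (above? (row c d e) w) * h w)) ≡
  anti p (λ b b̄ → 𝟙 (b ℕ.≤? c) * 𝟙 (p ℕ.≤? c ℕ.+ d) * h (row 0 b b̄))
∑-words-below c d e p h p≤ = begin
  ∑ (words 3 p) (λ w → 𝟙 (sorted? w) * (𝟙 (above? (row c d e) w) * h w))
    ≡⟨ ∑-sorted-words p _ ⟩
  anti p (λ c′ r → anti r (λ b b̄ → 𝟙 (above? (row c d e) (row c′ b b̄)) * h (row c′ b b̄)))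
    ≡⟨ anti-head p _ (λ i r i+r → ∑-zero (antidiagonal r) λ (b , b̄) →
         trans (cong (_* h (row (suc i) b b̄))
                     (𝟙-no (above? (row c d e) (row (suc i) b b̄))
                        (row-¬Above-0 c d e i _ (ℕₚ.≤-trans (subst (1 ≤_) i+r (s≤s z≤n)) p≤))))
               (ℤₚ.*-zeroˡ (h (row (suc i) b b̄)))) ⟩
  anti p (λ b b̄ → 𝟙 (above? (row c d e) (row 0 b b̄)) * h (row 0 b b̄))
    ≡⟨ anti-cong p (λ { b b̄ refl → cong (_* h (row 0 b b̄))
         (trans (𝟙-cong (above? (row c d e) (row 0 b b̄)) (b ℕ.≤? c ×-dec b ℕ.+ b̄ ℕ.≤? c ℕ.+ d)
                   (row-Above⇒ c d e b b̄ p≤) (uncurry (row-Above⇐ c d e b b̄)))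
                (𝟙-× (b ℕ.≤? c) (b ℕ.+ b̄ ℕ.≤? c ℕ.+ d))) }) ⟩
  anti p (λ b b̄ → 𝟙 (b ℕ.≤? c) * 𝟙 (p ℕ.≤? c ℕ.+ d) * h (row 0 b b̄)) ∎

-- Pairing tableau weights with test functions

at : Test → Vec ℕ 3 → ℤ
at φ (x ∷ y ∷ z ∷ []) = φ x y z

count : Fin 3 → List (Fin 3) → ℕ
count i w = length (filter (i Fin.≟_) w)

count-++ : ∀ i v w → count i (v ++ w) ≡ count i v ℕ.+ count i w
count-++ i v w = trans (cong length (Listₚ.filter-++ (i Fin.≟_) v w)) (Listₚ.length-++ (filter (i Fin.≟_) v))

count-replicate : ∀ i n → count i (replicate n i) ≡ n
count-replicate i n =
  trans (cong length (Listₚ.filter-all (i Fin.≟_) (All-replicate n))) (Listₚ.length-replicate n)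
  where
  All-replicate : ∀ n → All (i ≡_) (replicate n i)
  All-replicate zero    = []
  All-replicate (suc n) = refl ∷ All-replicate n

count-replicate-≢ : ∀ {i j} n → i ≢ j → count i (replicate n j) ≡ 0
count-replicate-≢ {i} {j} n i≢j = cong length (Listₚ.filter-none (i Fin.≟_) (All-replicate n))
  where
  All-replicate : ∀ n → All (λ x → ¬ (i ≡ x)) (replicate n j)
  All-replicate zero    = []
  All-replicate (suc n) = i≢j ∷ All-replicate n

count-row : ∀ i c d e →
  count i (row c d e) ≡ count i (replicate c 0F) ℕ.+ (count i (replicate d 1F) ℕ.+ count i (replicate e 2F))
count-row i c d e =
  trans (count-++ i (replicate c 0F) _) (cong (count i (replicate c 0F) ℕ.+_) (count-++ i (replicate d 1F) _))

count-0 : ∀ c d e → count 0F (row c d e) ≡ c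
count-0 c d e
  rewrite count-row 0F c d e | count-replicate 0F c
        | count-replicate-≢ {0F} {1F} d (λ ()) | count-replicate-≢ {0F} {2F} e (λ ()) = ℕₚ.+-identityʳ c

count-1 : ∀ c d e → count 1F (row c d e) ≡ d
count-1 c d e
  rewrite count-row 1F c d e | count-replicate 1F d
        | count-replicate-≢ {1F} {0F} c (λ ()) | count-replicate-≢ {1F} {2F} e (λ ()) = ℕₚ.+-identityʳ d

count-2 : ∀ c d e → count 2F (row c d e) ≡ e
count-2 c d e
  rewrite count-row 2F c d e | count-replicate 2F e
        | count-replicate-≢ {2F} {0F} c (λ ()) | count-replicate-≢ {2F} {1F} d (λ ()) = refl

at-weight-rows : ∀ φ c d e b b̄ z →
  at φ (weight (row c d e ∷ row 0 b b̄ ∷ row 0 0 z ∷ [])) ≡ φ c (d ℕ.+ b) (e ℕ.+ b̄ ℕ.+ z)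
at-weight-rows φ c d e b b̄ z =
  cong₃ φ
    (trans (counts 0F) (trans (cong₂ (λ x y → x ℕ.+ (y ℕ.+ _)) (count-0 c d e) (count-0 0 b b̄))
                        (trans (cong (c ℕ.+_) (count-0 0 0 z)) (ℕₚ.+-identityʳ c))))
    (trans (counts 1F) (trans (cong₂ (λ x y → x ℕ.+ (y ℕ.+ _)) (count-1 c d e) (count-1 0 b b̄))
                        (cong (d ℕ.+_) (trans (cong (b ℕ.+_) (count-1 0 0 z)) (ℕₚ.+-identityʳ b)))))
    (trans (counts 2F) (trans (cong₂ (λ x y → x ℕ.+ (y ℕ.+ _)) (count-2 c d e) (count-2 0 b b̄))
                        (trans (cong (λ x → e ℕ.+ (b̄ ℕ.+ x)) (count-2 0 0 z)) (sym (ℕₚ.+-assoc e b̄ z)))))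
  where
  r₁ = row c d e
  r₂ = row 0 b b̄
  r₃ = row 0 0 z
  counts : ∀ i → count i (concat (r₁ ∷ r₂ ∷ r₃ ∷ [])) ≡ count i r₁ ℕ.+ (count i r₂ ℕ.+ count i r₃)
  counts i = trans (count-++ i r₁ _) (cong (count i r₁ ℕ.+_)
               (trans (count-++ i r₂ _) (cong (λ w → count i r₂ ℕ.+ count i w) (Listₚ.++-identityʳ r₃))))

tableauSum : List ℕ → Test → ℤ
tableauSum ps φ = ∑ (fillings 3 ps) (λ T → 𝟙 (semiStandard? T) * at φ (weight T))

∑-schur : ∀ κ φ → ∑ (schur 3 κ) (at φ) ≡ tableauSum (parts κ) φ
∑-schur κ φ = trans (∑-map weight (ssyt 3 κ) (at φ)) (∑-filter semiStandard? (fillings 3 (parts κ)) _)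

𝟙-SemiStandard : ∀ {n} (T : Filling n) →
  𝟙 (semiStandard? T) ≡ 𝟙 (All.all? sorted? T) * 𝟙 (linked? above? T)
𝟙-SemiStandard T = 𝟙-× (All.all? sorted? T) (linked? above? T)

𝟙-SemiStandard₃ : ∀ {n} (u v w : List (Fin n)) →
  𝟙 (semiStandard? (u ∷ v ∷ w ∷ [])) ≡
  𝟙 (sorted? u) * (𝟙 (sorted? v) * (𝟙 (above? u v) * (𝟙 (sorted? w) * 𝟙 (above? v w))))
𝟙-SemiStandard₃ u v w
  rewrite 𝟙-SemiStandard (u ∷ v ∷ w ∷ [])
        | 𝟙-All sorted? u (v ∷ w ∷ []) | 𝟙-All sorted? v (w ∷ []) | 𝟙-All sorted? w []
        | 𝟙-Linked above? u v (w ∷ []) | 𝟙-Linked above? v w [] =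
  regroup (𝟙 (sorted? u)) (𝟙 (sorted? v)) (𝟙 (sorted? w)) (𝟙 (above? u v)) (𝟙 (above? v w))
  where
  regroup : ∀ a b c d e → a * (b * (c * 1ℤ)) * (d * (e * 1ℤ)) ≡ a * (b * (d * (c * e)))
  regroup = solve-∀

-- The three indicators are those interlacing inequalities for the rows (p₁, p₂, p₃), (c+d, b), (c)
-- that the antidiagonal sums do not already contain.
tableauSum-rows : ∀ p₁ p₂ p₃ φ → p₂ ≤ p₁ → p₃ ≤ p₂ →
  tableauSum (p₁ ∷ p₂ ∷ p₃ ∷ []) φ ≡
  anti p₁ (λ c r → anti r (λ d e → anti p₂ (λ b b̄ →
    𝟙 (b ℕ.≤? c) * 𝟙 (p₂ ℕ.≤? c ℕ.+ d) * (𝟙 (p₃ ℕ.≤? b) * φ c (d ℕ.+ b) (e ℕ.+ b̄ ℕ.+ p₃)))))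
tableauSum-rows p₁ p₂ p₃ φ p₂≤p₁ p₃≤p₂ = begin
  tableauSum (p₁ ∷ p₂ ∷ p₃ ∷ []) φ
    ≡⟨ ∑-cartesian _∷_ (words 3 p₁) (fillings 3 (p₂ ∷ p₃ ∷ [])) _ ⟩
  ∑ (words 3 p₁) (λ u → ∑ (fillings 3 (p₂ ∷ p₃ ∷ [])) (λ T → F (u ∷ T)))
    ≡⟨ ∑-cong (words 3 p₁) (λ u → trans (∑-cartesian _∷_ (words 3 p₂) (fillings 3 (p₃ ∷ [])) _)
         (∑-cong (words 3 p₂) λ v → trans (∑-cartesian _∷_ (words 3 p₃) ([] ∷ []) _)
           (∑-cong (words 3 p₃) λ w → trans (+-identityʳ _) (split u v w)))) ⟩
  ∑ (words 3 p₁) (λ u → ∑ (words 3 p₂) (λ v → ∑ (words 3 p₃) (λ w →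
    𝟙 (sorted? u) * (𝟙 (sorted? v) * (𝟙 (above? u v) * (𝟙 (sorted? w) * (𝟙 (above? v w) * G u v w)))))))
    ≡⟨ ∑-cong (words 3 p₁) (λ u → trans
         (∑-cong (words 3 p₂) (λ v →
           trans (∑-* (words 3 p₃) (𝟙 (sorted? u)) _) (cong (𝟙 (sorted? u) *_)
           (trans (∑-* (words 3 p₃) (𝟙 (sorted? v)) _) (cong (𝟙 (sorted? v) *_)
           (∑-* (words 3 p₃) (𝟙 (above? u v)) _))))))
         (∑-* (words 3 p₂) (𝟙 (sorted? u)) _)) ⟩
  ∑ (words 3 p₁) (λ u → 𝟙 (sorted? u) * H u)
    ≡⟨ ∑-sorted-words p₁ H ⟩
  anti p₁ (λ c r → anti r (λ d e → H (row c d e)))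
    ≡⟨ anti-cong p₁ (λ c r c+r → anti-cong r (λ d e d+e →
         below c d e (trans (cong (c ℕ.+_) d+e) c+r))) ⟩
  _ ∎
  where
  F : Filling 3 → ℤ
  F T = 𝟙 (semiStandard? T) * at φ (weight T)
  G : (u v w : List (Fin 3)) → ℤ
  G u v w = at φ (weight (u ∷ v ∷ w ∷ []))
  I : (u v : List (Fin 3)) → ℤ
  I u v = ∑ (words 3 p₃) (λ w → 𝟙 (sorted? w) * (𝟙 (above? v w) * G u v w))
  H : List (Fin 3) → ℤ
  H u = ∑ (words 3 p₂) (λ v → 𝟙 (sorted? v) * (𝟙 (above? u v) * I u v))
  split : ∀ u v w → F (u ∷ v ∷ w ∷ []) ≡
    𝟙 (sorted? u) * (𝟙 (sorted? v) * (𝟙 (above? u v) * (𝟙 (sorted? w) * (𝟙 (above? v w) * G u v w))))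
  split u v w = trans (cong (_* G u v w) (𝟙-SemiStandard₃ u v w))
                      (assoc (𝟙 (sorted? u)) (𝟙 (sorted? v)) (𝟙 (above? u v)) (𝟙 (sorted? w)) _ _)
    where
    assoc : ∀ a b c d e g → a * (b * (c * (d * e))) * g ≡ a * (b * (c * (d * (e * g))))
    assoc = solve-∀
  -- The second row has no `0F`, so the third has neither `0F` nor `1F` and consists of `2F` alone.
  bottom : ∀ c d e b b̄ → b ℕ.+ b̄ ≡ p₂ →
    I (row c d e) (row 0 b b̄) ≡ 𝟙 (p₃ ℕ.≤? b) * φ c (d ℕ.+ b) (e ℕ.+ b̄ ℕ.+ p₃)
  bottom c d e b b̄ b+b̄ = begin
    I (row c d e) (row 0 b b̄)
      ≡⟨ ∑-words-below 0 b b̄ p₃ _ (subst (p₃ ≤_) (sym b+b̄) p₃≤p₂) ⟩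
    anti p₃ (λ y z → 𝟙 (y ℕ.≤? 0) * 𝟙 (p₃ ℕ.≤? b) * G (row c d e) (row 0 b b̄) (row 0 y z))
      ≡⟨ anti-head p₃ _ (λ i j _ → zeros (𝟙 (p₃ ℕ.≤? b)) (G (row c d e) (row 0 b b̄) (row 0 (suc i) j))) ⟩
    1ℤ * 𝟙 (p₃ ℕ.≤? b) * G (row c d e) (row 0 b b̄) (row 0 0 p₃)
      ≡⟨ cong₂ _*_ (ℤₚ.*-identityˡ (𝟙 (p₃ ℕ.≤? b))) (at-weight-rows φ c d e b b̄ p₃) ⟩
    𝟙 (p₃ ℕ.≤? b) * φ c (d ℕ.+ b) (e ℕ.+ b̄ ℕ.+ p₃) ∎
    where
    zeros : ∀ x y → 0ℤ * x * y ≡ 0ℤ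
    zeros = solve-∀
  below : ∀ c d e → c ℕ.+ (d ℕ.+ e) ≡ p₁ → H (row c d e) ≡ anti p₂ (λ b b̄ →
    𝟙 (b ℕ.≤? c) * 𝟙 (p₂ ℕ.≤? c ℕ.+ d) * (𝟙 (p₃ ℕ.≤? b) * φ c (d ℕ.+ b) (e ℕ.+ b̄ ℕ.+ p₃)))
  below c d e len =
    trans (∑-words-below c d e p₂ (I (row c d e)) (subst (p₂ ≤_) (sym len) p₂≤p₁))
          (anti-cong p₂ λ b b̄ b+b̄ →
             cong (𝟙 (b ℕ.≤? c) * 𝟙 (p₂ ℕ.≤? c ℕ.+ d) *_) (bottom c d e b b̄ b+b̄))

tableauSum-GT : ∀ D E r φ → tableauSum (r ℕ.+ E ℕ.+ D ∷ r ℕ.+ E ∷ r ∷ []) φ ≡ GT D E r φ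
tableauSum-GT D E r φ = begin
  tableauSum (p₁ ∷ p₂ ∷ r ∷ []) φ
    ≡⟨ tableauSum-rows p₁ p₂ r φ (ℕₚ.m≤m+n p₂ D) (ℕₚ.m≤m+n r E) ⟩
  anti p₁ (λ c s → anti s (λ d e → X c d e))
    -- Regrouping makes c + d, the first entry of the middle row, a summation variable.
    ≡⟨ anti-assoc p₁ X ⟩
  anti p₁ (λ a e → anti a (λ c d → X c d e))
    ≡⟨ anti-cong p₁ (λ a e _ → pull a e) ⟩
  anti p₁ (λ a e → 𝟙 (p₂ ℕ.≤? a) * anti p₂ (λ b b̄ → 𝟙 (r ℕ.≤? b) * Y a e b b̄))
    ≡⟨ anti-≤ p₂ D _ ⟩
  anti D (λ a e → anti p₂ (λ b b̄ → 𝟙 (r ℕ.≤? b) * Y (p₂ ℕ.+ a) e b b̄))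
    ≡⟨ anti-cong D (λ a e _ → anti-≤ r E (Y (p₂ ℕ.+ a) e)) ⟩
  anti D (λ a e → anti E (λ b b̄ → Y (p₂ ℕ.+ a) e (r ℕ.+ b) b̄))
    ≡⟨ anti-cong D (λ a e _ → anti-cong E (λ b b̄ b+b̄ → inner a e b b̄ b+b̄)) ⟩
  GT D E r φ ∎
  where
  p₁ = r ℕ.+ E ℕ.+ D
  p₂ = r ℕ.+ E
  f : (c d e b b̄ : ℕ) → ℤ
  f c d e b b̄ = φ c (d ℕ.+ b) (e ℕ.+ b̄ ℕ.+ r)
  X : ℕ → ℕ → ℕ → ℤ
  X c d e = anti p₂ λ b b̄ → 𝟙 (b ℕ.≤? c) * 𝟙 (p₂ ℕ.≤? c ℕ.+ d) * (𝟙 (r ℕ.≤? b) * f c d e b b̄)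
  Y : (a e b b̄ : ℕ) → ℤ
  Y a e b b̄ = anti a λ c d → 𝟙 (b ℕ.≤? c) * f c d e b b̄
  pull : ∀ a e → anti a (λ c d → X c d e) ≡
                 𝟙 (p₂ ℕ.≤? a) * anti p₂ (λ b b̄ → 𝟙 (r ℕ.≤? b) * Y a e b b̄)
  pull a e = begin
    anti a (λ c d → X c d e)
      ≡⟨ ∑-swap (antidiagonal a) (antidiagonal p₂) _ ⟩
    anti p₂ (λ b b̄ → anti a (λ c d → 𝟙 (b ℕ.≤? c) * 𝟙 (p₂ ℕ.≤? c ℕ.+ d) * (𝟙 (r ℕ.≤? b) * f c d e b b̄)))
      ≡⟨ anti-cong p₂ (λ b b̄ _ → anti-cong a λ { c d refl →
           exchange (𝟙 (b ℕ.≤? c)) (𝟙 (p₂ ℕ.≤? c ℕ.+ d)) (𝟙 (r ℕ.≤? b)) (f c d e b b̄) }) ⟩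
    anti p₂ (λ b b̄ → anti a (λ c d → 𝟙 (p₂ ℕ.≤? a) * (𝟙 (r ℕ.≤? b) * (𝟙 (b ℕ.≤? c) * f c d e b b̄))))
      ≡⟨ anti-cong p₂ (λ b b̄ _ → trans (∑-* (antidiagonal a) (𝟙 (p₂ ℕ.≤? a)) _)
           (cong (𝟙 (p₂ ℕ.≤? a) *_) (∑-* (antidiagonal a) (𝟙 (r ℕ.≤? b)) _))) ⟩
    anti p₂ (λ b b̄ → 𝟙 (p₂ ℕ.≤? a) * (𝟙 (r ℕ.≤? b) * Y a e b b̄))
      ≡⟨ ∑-* (antidiagonal p₂) (𝟙 (p₂ ℕ.≤? a)) _ ⟩
    𝟙 (p₂ ℕ.≤? a) * anti p₂ (λ b b̄ → 𝟙 (r ℕ.≤? b) * Y a e b b̄) ∎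
    where
    exchange : ∀ x y z t → x * y * (z * t) ≡ y * (z * (x * t))
    exchange = solve-∀
  regroup : ∀ r b b̄ a → r ℕ.+ (b ℕ.+ b̄) ℕ.+ a ≡ r ℕ.+ b ℕ.+ (b̄ ℕ.+ a)
  regroup = ℕ-Ring.solve-∀
  third : ∀ e b̄ r → e ℕ.+ b̄ ℕ.+ r ≡ r ℕ.+ e ℕ.+ b̄
  third = ℕ-Ring.solve-∀
  inner : ∀ a e b b̄ → b ℕ.+ b̄ ≡ E →
    Y (p₂ ℕ.+ a) e (r ℕ.+ b) b̄ ≡
    anti (b̄ ℕ.+ a) (λ i d → φ (r ℕ.+ b ℕ.+ i) (r ℕ.+ b ℕ.+ d) (r ℕ.+ e ℕ.+ b̄))
  inner a e b b̄ refl = begin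
    Y (r ℕ.+ (b ℕ.+ b̄) ℕ.+ a) e (r ℕ.+ b) b̄
      ≡⟨ cong (λ n → Y n e (r ℕ.+ b) b̄) (regroup r b b̄ a) ⟩
    Y (r ℕ.+ b ℕ.+ (b̄ ℕ.+ a)) e (r ℕ.+ b) b̄
      ≡⟨ anti-≤ (r ℕ.+ b) (b̄ ℕ.+ a) _ ⟩
    anti (b̄ ℕ.+ a) (λ i d → f (r ℕ.+ b ℕ.+ i) d e (r ℕ.+ b) b̄)
      ≡⟨ anti-cong (b̄ ℕ.+ a) (λ i d _ → cong₃ φ refl (ℕₚ.+-comm d (r ℕ.+ b)) (third e b̄ r)) ⟩
    anti (b̄ ℕ.+ a) (λ i d → φ (r ℕ.+ b ℕ.+ i) (r ℕ.+ b ℕ.+ d) (r ℕ.+ e ℕ.+ b̄)) ∎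

private
  above-[] : ∀ (v : List (Fin 3)) → v Above []
  above-[] []      = []
  above-[] (_ ∷ _) = []

  sum-pair : ∀ p q φ → tableauSum (p ∷ q ∷ []) φ ≡ tableauSum (p ∷ q ∷ 0 ∷ []) φ
  sum-pair p q φ =
    trans (∑-cartesian _∷_ (words 3 p) (fillings 3 (q ∷ [])) _)
      (trans (∑-cong (words 3 p) λ u →
               trans (∑-cartesian _∷_ (words 3 q) ([] ∷ []) _)
               (trans (∑-cong (words 3 q) λ v → cong (_+ 0ℤ) (cong (_* at φ (weight (u ∷ v ∷ []))) (pad u v)))
                      (sym (∑-cartesian _∷_ (words 3 q) (([] ∷ []) ∷ []) _))))
             (sym (∑-cartesian _∷_ (words 3 p) (fillings 3 (q ∷ 0 ∷ [])) _)))
    where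
    pad : ∀ u v → 𝟙 (semiStandard? (u ∷ v ∷ [])) ≡ 𝟙 (semiStandard? (u ∷ v ∷ [] ∷ []))
    pad u v = 𝟙-cong (semiStandard? (u ∷ v ∷ [])) (semiStandard? (u ∷ v ∷ [] ∷ []))
      (λ { (s ∷ t ∷ [] , a ∷ [-]) → s ∷ t ∷ [] ∷ [] , a ∷ above-[] v ∷ [-] })
      (λ { (s ∷ t ∷ [] ∷ [] , a ∷ _ ∷ [-]) → s ∷ t ∷ [] , a ∷ [-] })

  sum-single : ∀ p φ → tableauSum (p ∷ []) φ ≡ tableauSum (p ∷ 0 ∷ []) φ
  sum-single p φ =
    trans (∑-cartesian _∷_ (words 3 p) ([] ∷ []) _)
      (trans (∑-cong (words 3 p) λ u → cong (_+ 0ℤ) (cong (_* at φ (weight (u ∷ []))) (pad u)))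
             (sym (∑-cartesian _∷_ (words 3 p) (([] ∷ []) ∷ []) _)))
    where
    pad : ∀ u → 𝟙 (semiStandard? (u ∷ [])) ≡ 𝟙 (semiStandard? (u ∷ [] ∷ []))
    pad u = 𝟙-cong (semiStandard? (u ∷ [])) (semiStandard? (u ∷ [] ∷ []))
      (λ { (s ∷ [] , [-]) → s ∷ [] ∷ [] , above-[] u ∷ [-] })
      (λ { (s ∷ [] ∷ [] , _ ∷ [-]) → s ∷ [] , [-] })

tableauSum-padded : ∀ κ φ → ℓ κ ≤ 3 → tableauSum (parts κ) φ ≡ tableauSum (κ ₁ ∷ κ ₂ ∷ κ ₃ ∷ []) φ
tableauSum-padded (mkPartition []                  _ _) φ _ = refl
tableauSum-padded (mkPartition (p ∷ [])            _ _) φ _ = trans (sum-single p φ) (sum-pair p 0 φ)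
tableauSum-padded (mkPartition (p ∷ q ∷ [])        _ _) φ _ = sum-pair p q φ
tableauSum-padded (mkPartition (_ ∷ _ ∷ _ ∷ [])    _ _) φ _ = refl
tableauSum-padded (mkPartition (_ ∷ _ ∷ _ ∷ _ ∷ _) _ _) φ (s≤s (s≤s (s≤s ())))

κ₂≤κ₁ : ∀ κ → κ ₂ ≤ κ ₁
κ₂≤κ₁ (mkPartition []          _       _) = z≤n
κ₂≤κ₁ (mkPartition (_ ∷ [])    _       _) = z≤n
κ₂≤κ₁ (mkPartition (_ ∷ _ ∷ _) (q ∷ _) _) = q

κ₃≤κ₂ : ∀ κ → κ ₃ ≤ κ ₂
κ₃≤κ₂ (mkPartition []              _           _) = z≤n
κ₃≤κ₂ (mkPartition (_ ∷ [])        _           _) = z≤n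
κ₃≤κ₂ (mkPartition (_ ∷ _ ∷ [])    _           _) = z≤n
κ₃≤κ₂ (mkPartition (_ ∷ _ ∷ _ ∷ _) (_ ∷ q ∷ _) _) = q

module _ (κ : Partition) (ℓ≤3 : ℓ κ ≤ 3) where
  private
    D = κ ₁ ℕ.∸ κ ₂
    E = κ ₂ ℕ.∸ κ ₃
    r = κ ₃
    κ₂≡ : r ℕ.+ E ≡ κ ₂
    κ₂≡ = ℕₚ.m+[n∸m]≡n (κ₃≤κ₂ κ)
    κ₁≡ : r ℕ.+ E ℕ.+ D ≡ κ ₁
    κ₁≡ = trans (cong (ℕ._+ D) κ₂≡) (ℕₚ.m+[n∸m]≡n (κ₂≤κ₁ κ))

    schur-GT : ∀ φ → ∑ (schur 3 κ) (at φ) ≡ GT D E r φ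
    schur-GT φ = begin
      ∑ (schur 3 κ) (at φ)                                     ≡⟨ ∑-schur κ φ ⟩
      tableauSum (parts κ) φ                                   ≡⟨ tableauSum-padded κ φ ℓ≤3 ⟩
      tableauSum (κ ₁ ∷ κ ₂ ∷ κ ₃ ∷ []) φ                      ≡⟨ cong₂ (λ p q → tableauSum (p ∷ q ∷ r ∷ []) φ)
                                                                    (sym κ₁≡) (sym κ₂≡) ⟩
      tableauSum (r ℕ.+ E ℕ.+ D ∷ r ℕ.+ E ∷ r ∷ []) φ          ≡⟨ tableauSum-GT D E r φ ⟩
      GT D E r φ                                               ∎

  -- Homogeneity: every tableau of shape κ has a weight of size |κ|. This supplies the size
  -- condition of `jacobi-trudi` for the monomials of s_ν.
  schur-cong : ∀ {φ ψ : Test} → (∀ x y z → x ℕ.+ y ℕ.+ z ≡ ∣ κ ∣₃ → φ x y z ≡ ψ x y z) →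
               ∑ (schur 3 κ) (at φ) ≡ ∑ (schur 3 κ) (at ψ)
  schur-cong {φ} {ψ} eq = begin
    ∑ (schur 3 κ) (at φ) ≡⟨ schur-GT φ ⟩
    GT D E r φ           ≡⟨ GT-cong D E r (λ x y z size → eq x y z
                              (trans size (cong₂ (λ p q → p ℕ.+ q ℕ.+ r) κ₁≡ κ₂≡))) ⟩
    GT D E r ψ           ≡⟨ sym (schur-GT ψ) ⟩
    ∑ (schur 3 κ) (at ψ) ∎

  schur-bialternant : ∀ φ →
    ∑ (schur 3 κ) (at (λ x y z → Alt 2 1 0 (translate x y z φ))) ≡ Alt (2 ℕ.+ κ ₁) (1 ℕ.+ κ ₂) (κ ₃) φ
  schur-bialternant φ = begin
    ∑ (schur 3 κ) (at (λ x y z → Alt 2 1 0 (translate x y z φ)))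
      ≡⟨ schur-GT _ ⟩
    GT D E r (λ x y z → Alt 2 1 0 (translate x y z φ))
      ≡⟨ GT-bialternant D E r φ ⟩
    Alt (2 ℕ.+ (r ℕ.+ E ℕ.+ D)) (1 ℕ.+ (r ℕ.+ E)) r φ
      ≡⟨ cong₂ (λ p q → Alt (2 ℕ.+ p) (1 ℕ.+ q) r φ) κ₁≡ κ₂≡ ⟩
    Alt (2 ℕ.+ κ ₁) (1 ℕ.+ κ ₂) (κ ₃) φ ∎

-- The first column of a tableau with more than three rows would need four distinct entries.
schur-zero : ∀ κ φ → ¬ (ℓ κ ≤ 3) → ∑ (schur 3 κ) (at φ) ≡ 0ℤ
schur-zero (mkPartition [] _ _)              φ ℓ≰3 = contradiction z≤n ℓ≰3
schur-zero (mkPartition (_ ∷ []) _ _)        φ ℓ≰3 = contradiction (s≤s z≤n) ℓ≰3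
schur-zero (mkPartition (_ ∷ _ ∷ []) _ _)    φ ℓ≰3 = contradiction (s≤s (s≤s z≤n)) ℓ≰3
schur-zero (mkPartition (_ ∷ _ ∷ _ ∷ []) _ _) φ ℓ≰3 = contradiction (s≤s (s≤s (s≤s z≤n))) ℓ≰3
schur-zero κ@(mkPartition (suc p ∷ suc q ∷ suc s ∷ suc t ∷ ps) _ (_ ∷ _ ∷ _ ∷ _ ∷ _)) φ ℓ≰3 =
  trans (∑-schur κ φ)
    (first-row p (suc q ∷ suc s ∷ suc t ∷ ps) λ i u → first-row q (suc s ∷ suc t ∷ ps) λ j v →
     first-row s (suc t ∷ ps) λ k w → first-row t ps λ l x →
      ∑-zero (fillings 3 ps) λ T →
        trans (cong (_* at φ (weight ((i ∷ u) ∷ (j ∷ v) ∷ (k ∷ w) ∷ (l ∷ x) ∷ T)))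
                 (𝟙-no (semiStandard? ((i ∷ u) ∷ (j ∷ v) ∷ (k ∷ w) ∷ (l ∷ x) ∷ T))
                    λ { (_ , (i<j ∷ _) ∷ (j<k ∷ _) ∷ (k<l ∷ _) ∷ _) → too-tall i<j j<k k<l }))
              (ℤₚ.*-zeroˡ (at φ (weight ((i ∷ u) ∷ (j ∷ v) ∷ (k ∷ w) ∷ (l ∷ x) ∷ T)))))
  where
  first-row : ∀ p ps {f : Filling 3 → ℤ} →
    (∀ i u → ∑ (fillings 3 ps) (λ T → f ((i ∷ u) ∷ T)) ≡ 0ℤ) → ∑ (fillings 3 (suc p ∷ ps)) f ≡ 0ℤ
  first-row p ps eq =
    trans (∑-cartesian _∷_ (words 3 (suc p)) (fillings 3 ps) _)
      (trans (∑-cartesian _∷_ (allFin 3) (words 3 p) _)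
        (∑-zero (allFin 3) λ i → ∑-zero (words 3 p) λ u → eq i u))
  too-tall : ∀ {i j k l : Fin 3} → i Fin.< j → j Fin.< k → ¬ (k Fin.< l)
  too-tall {l = l} i<j j<k k<l =
    ℕₚ.<⇒≱ (Finₚ.toℕ<n l) (ℕₚ.≤-trans (s≤s (ℕₚ.≤-trans (s≤s (ℕₚ.≤-trans (s≤s z≤n) i<j)) j<k)) k<l)

-- Extracting a Littlewood–Richardson coefficient

point : ℕ → ℕ → ℕ → Test
point l₁ l₂ l₃ x y z = 𝟙 (x ℕ.≟ l₁) * 𝟙 (y ℕ.≟ l₂) * 𝟙 (z ℕ.≟ l₃)

point-× : ∀ l₁ l₂ l₃ x y z →
  point l₁ l₂ l₃ x y z ≡ 𝟙 ((x ℕ.≟ l₁ ×-dec y ℕ.≟ l₂) ×-dec z ℕ.≟ l₃)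
point-× l₁ l₂ l₃ x y z =
  sym (trans (𝟙-× (x ℕ.≟ l₁ ×-dec y ℕ.≟ l₂) (z ℕ.≟ l₃)) (cong (_* 𝟙 (z ℕ.≟ l₃)) (𝟙-× (x ℕ.≟ l₁) (y ℕ.≟ l₂))))

point-zero : ∀ {l₁ l₂ l₃ x y z} → (x ≡ l₁ → y ≡ l₂ → z ≡ l₃ → ⊥) → point l₁ l₂ l₃ x y z ≡ 0ℤ
point-zero {l₁} {l₂} {l₃} {x} {y} {z} h =
  trans (point-× l₁ l₂ l₃ x y z) (𝟙-no ((x ℕ.≟ l₁ ×-dec y ℕ.≟ l₂) ×-dec z ℕ.≟ l₃) λ ((p , q) , r) → h p q r)

∑-point : ∀ (α : Vec ℕ 3) p → + coeff α p ≡ ∑ p (λ m → 𝟙 (Vecₚ.≡-dec ℕ._≟_ α m))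
∑-point α []      = refl
∑-point α (m ∷ p) with Vecₚ.≡-dec ℕ._≟_ α m
... | yes _ = cong (_+_ 1ℤ) (∑-point α p)
... | no  _ = trans (∑-point α p) (sym (+-identityˡ _))

-- Subtracting (a,b,c) from the exponent may leave ℕ³; then the coefficient is 0.
∑-translate-point : ∀ l₁ l₂ l₃ a b c →
  (∀ p → ∑ p (at (λ x y z → translate x y z (point l₁ l₂ l₃) a b c)) ≡ 0ℤ) ⊎
  (∃[ α ] ∀ p → ∑ p (at (λ x y z → translate x y z (point l₁ l₂ l₃) a b c)) ≡ + coeff α p)
∑-translate-point l₁ l₂ l₃ a b c with (a ℕ.≤? l₁ ×-dec b ℕ.≤? l₂) ×-dec c ℕ.≤? l₃
... | no ≰ = inj₁ λ p → ∑-zero p λ { (x ∷ y ∷ z ∷ []) → point-zero {l₁} {l₂} {l₃} {x ℕ.+ a} {y ℕ.+ b} {z ℕ.+ c} λ { refl refl refl →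
        ≰ ((ℕₚ.m≤n+m a x , ℕₚ.m≤n+m b y) , ℕₚ.m≤n+m c z) } }
... | yes ((a≤ , b≤) , c≤) = inj₂ (α , λ p → trans (∑-cong p agree) (sym (∑-point α p)))
  where
  α : Vec ℕ 3
  α = l₁ ℕ.∸ a ∷ l₂ ℕ.∸ b ∷ l₃ ℕ.∸ c ∷ []
  to : ∀ {x y z} → (x ℕ.+ a ≡ l₁ × y ℕ.+ b ≡ l₂) × z ℕ.+ c ≡ l₃ → α ≡ x ∷ y ∷ z ∷ []
  to {x} {y} {z} ((refl , refl) , refl)
    rewrite ℕₚ.m+n∸n≡m x a | ℕₚ.m+n∸n≡m y b | ℕₚ.m+n∸n≡m z c = refl
  from : ∀ {x y z} → α ≡ x ∷ y ∷ z ∷ [] → (x ℕ.+ a ≡ l₁ × y ℕ.+ b ≡ l₂) × z ℕ.+ c ≡ l₃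
  from refl = (ℕₚ.m∸n+n≡m a≤ , ℕₚ.m∸n+n≡m b≤) , ℕₚ.m∸n+n≡m c≤
  agree : ∀ m → at (λ x y z → translate x y z (point l₁ l₂ l₃) a b c) m ≡ 𝟙 (Vecₚ.≡-dec ℕ._≟_ α m)
  agree (x ∷ y ∷ z ∷ []) =
    trans (point-× l₁ l₂ l₃ (x ℕ.+ a) (y ℕ.+ b) (z ℕ.+ c))
          (𝟙-cong ((x ℕ.+ a ℕ.≟ l₁ ×-dec y ℕ.+ b ℕ.≟ l₂) ×-dec z ℕ.+ c ℕ.≟ l₃) (Vecₚ.≡-dec ℕ._≟_ α (x ∷ y ∷ z ∷ [])) to from)

sumℤ-map : ∀ {A : Set} (f : A → ℤ) xs → sumℤ (map f xs) ≡ ∑ xs f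
sumℤ-map f []       = refl
sumℤ-map f (x ∷ xs) = cong (_+_ (f x)) (sumℤ-map f xs)

-- φ ↦ Alt ρ (φ translated by a monomial) multiplies by the Vandermonde product a_ρ.
vandermonde : Test → Test
vandermonde φ x y z = Alt 2 1 0 (translate x y z φ)

∑-at-vandermonde : ∀ p φ →
  ∑ p (at (vandermonde φ)) ≡ Alt 2 1 0 (λ a b c → ∑ p (at (λ x y z → translate x y z φ a b c)))
∑-at-vandermonde p φ =
  trans (∑-cong p (λ { (x ∷ y ∷ z ∷ []) → refl }))
        (∑-alternate p (f 2 1 0) (f 2 0 1) (f 1 2 0) (f 1 0 2) (f 0 2 1) (f 0 1 2))
  where
  f : ℕ → ℕ → ℕ → Vec ℕ 3 → ℤ
  f a b c = at (λ x y z → translate x y z φ a b c)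

-- `IsSchurExpansion` compares coefficients. The pairing is an alternating sum of six of them, where
-- a shifted exponent outside ℕ³ contributes zero to both sides.
expansion-vandermonde : ∀ {μ ν L} l₁ l₂ l₃ → IsSchurExpansion μ ν L →
  ∑ (schur 3 μ ⊗ schur 3 ν) (at (vandermonde (point l₁ l₂ l₃))) ≡
  ∑ L (λ t → proj₁ t * ∑ (schur 3 (proj₂ t)) (at (vandermonde (point l₁ l₂ l₃))))
expansion-vandermonde {μ} {ν} {L} l₁ l₂ l₃ isExp = begin
  ∑ (schur 3 μ ⊗ schur 3 ν) (at (vandermonde (point l₁ l₂ l₃)))
    ≡⟨ ∑-at-vandermonde (schur 3 μ ⊗ schur 3 ν) (point l₁ l₂ l₃) ⟩
  Alt 2 1 0 (λ a b c → S (schur 3 μ ⊗ schur 3 ν) a b c)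
    ≡⟨ Alt-cong 2 1 0 each ⟩
  Alt 2 1 0 (λ a b c → ∑ L (λ t → proj₁ t * S (schur 3 (proj₂ t)) a b c))
    ≡⟨ sym (∑-alternate L (g 2 1 0) (g 2 0 1) (g 1 2 0) (g 1 0 2) (g 0 2 1) (g 0 1 2)) ⟩
  ∑ L (λ t → Alt 2 1 0 (λ a b c → g a b c t))
    ≡⟨ ∑-cong L (λ t → trans (factor (proj₁ t) (S (schur 3 (proj₂ t)) 2 1 0) (S (schur 3 (proj₂ t)) 2 0 1)
           (S (schur 3 (proj₂ t)) 1 2 0) (S (schur 3 (proj₂ t)) 1 0 2)
           (S (schur 3 (proj₂ t)) 0 2 1) (S (schur 3 (proj₂ t)) 0 1 2))
         (cong (proj₁ t *_) (sym (∑-at-vandermonde (schur 3 (proj₂ t)) (point l₁ l₂ l₃))))) ⟩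
  ∑ L (λ t → proj₁ t * ∑ (schur 3 (proj₂ t)) (at (vandermonde (point l₁ l₂ l₃)))) ∎
  where
  S : Poly 3 → Test
  S p a b c = ∑ p (at (λ x y z → translate x y z (point l₁ l₂ l₃) a b c))
  g : ℕ → ℕ → ℕ → ℤ × Partition → ℤ
  g a b c t = proj₁ t * S (schur 3 (proj₂ t)) a b c
  factor : ∀ k a b c d e f →
    k * a - k * b - k * c + k * d + k * e - k * f ≡ k * (a - b - c + d + e - f)
  factor = solve-∀
  each : ∀ a b c → S (schur 3 μ ⊗ schur 3 ν) a b c ≡ ∑ L (g a b c)
  each a b c with ∑-translate-point l₁ l₂ l₃ a b c
  ... | inj₁ zero′ = trans (zero′ (schur 3 μ ⊗ schur 3 ν))
          (sym (∑-zero L λ t → trans (cong (proj₁ t *_) (zero′ (schur 3 (proj₂ t)))) (ℤₚ.*-zeroʳ (proj₁ t))))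
  ... | inj₂ (α , is) = begin
    S (schur 3 μ ⊗ schur 3 ν) a b c                          ≡⟨ is (schur 3 μ ⊗ schur 3 ν) ⟩
    + coeff α (schur 3 μ ⊗ schur 3 ν)                        ≡⟨ isExp 3 α ⟩
    evalCoeff α L                                            ≡⟨ sumℤ-map _ L ⟩
    ∑ L (λ t → proj₁ t * (+ coeff α (schur 3 (proj₂ t))))    ≡⟨ ∑-cong L (λ t → cong (proj₁ t *_) (sym (is (schur 3 (proj₂ t))))) ⟩
    ∑ L (g a b c)                                            ∎

-- Both triples are strictly decreasing, so only the identity permutation can carry one to the
-- other.
Alt-point : ∀ {k₁ k₂ k₃ l₁ l₂ l₃} → k₂ < k₁ → k₃ < k₂ → l₂ < l₁ → l₃ < l₂ →
  Alt k₁ k₂ k₃ (point l₁ l₂ l₃) ≡ point l₁ l₂ l₃ k₁ k₂ k₃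
Alt-point {k₁} {k₂} {k₃} {l₁} {l₂} {l₃} k₂<k₁ k₃<k₂ l₂<l₁ l₃<l₂
  rewrite point-zero {l₁} {l₂} {l₃} {k₁} {k₃} {k₂} (λ { refl refl refl → ℕₚ.<-asym k₃<k₂ l₃<l₂ })
        | point-zero {l₁} {l₂} {l₃} {k₂} {k₁} {k₃} (λ { refl refl refl → ℕₚ.<-asym k₂<k₁ l₂<l₁ })
        | point-zero {l₁} {l₂} {l₃} {k₂} {k₃} {k₁} (λ { refl refl refl → ℕₚ.<-asym (ℕₚ.<-trans k₃<k₂ k₂<k₁) l₃<l₂ })
        | point-zero {l₁} {l₂} {l₃} {k₃} {k₁} {k₂} (λ { refl refl refl → ℕₚ.<-asym (ℕₚ.<-trans k₃<k₂ k₂<k₁) l₂<l₁ })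
        | point-zero {l₁} {l₂} {l₃} {k₃} {k₂} {k₁} (λ { refl refl refl → ℕₚ.<-asym k₂<k₁ l₃<l₂ }) =
  unit (point l₁ l₂ l₃ k₁ k₂ k₃)
  where
  unit : ∀ x → x - 0ℤ - 0ℤ + 0ℤ + 0ℤ - 0ℤ ≡ x
  unit = solve-∀

parts-determined : ∀ κ λ′ → ℓ κ ≤ 3 → ℓ λ′ ≤ 3 → κ ₁ ≡ λ′ ₁ → κ ₂ ≡ λ′ ₂ → κ ₃ ≡ λ′ ₃ → parts λ′ ≡ parts κ
parts-determined (mkPartition ps _ pos) (mkPartition qs _ pos′) p≤ q≤ = go ps qs pos pos′ p≤ q≤
  where
  go : ∀ ps qs → All (0 <_) ps → All (0 <_) qs → length ps ≤ 3 → length qs ≤ 3 →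
       nth ps 0 ≡ nth qs 0 → nth ps 1 ≡ nth qs 1 → nth ps 2 ≡ nth qs 2 → qs ≡ ps
  go (_ ∷ _ ∷ _ ∷ _ ∷ _) _ _ _ (s≤s (s≤s (s≤s ()))) _ _ _ _
  go _ (_ ∷ _ ∷ _ ∷ _ ∷ _) _ _ _ (s≤s (s≤s (s≤s ()))) _ _ _
  go [] [] _ _ _ _ _ _ _ = refl
  go [] (_ ∷ _) _ (() ∷ _) _ _ refl _ _
  go (_ ∷ _) [] (() ∷ _) _ _ _ refl _ _
  go (_ ∷ []) (_ ∷ []) _ _ _ _ refl _ _ = refl
  go (_ ∷ []) (_ ∷ _ ∷ _) _ (_ ∷ () ∷ _) _ _ _ refl _
  go (_ ∷ _ ∷ _) (_ ∷ []) (_ ∷ () ∷ _) _ _ _ _ refl _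
  go (_ ∷ _ ∷ []) (_ ∷ _ ∷ []) _ _ _ _ refl refl _ = refl
  go (_ ∷ _ ∷ []) (_ ∷ _ ∷ _ ∷ _) _ (_ ∷ _ ∷ () ∷ _) _ _ _ _ refl
  go (_ ∷ _ ∷ _ ∷ _) (_ ∷ _ ∷ []) (_ ∷ _ ∷ () ∷ _) _ _ _ _ _ refl
  go (_ ∷ _ ∷ _ ∷ []) (_ ∷ _ ∷ _ ∷ []) _ _ _ _ refl refl refl = refl

-- Taking the coefficient of x^(λ+ρ) after multiplication by a_ρ is the functional dual to s_λ,
-- since a_ρ s_κ = a_(κ+ρ). An expansion may contain terms with more than three parts; they vanish
-- in three variables.
schur-orthonormal : ∀ lam κ → ℓ lam ≤ 3 →
  ∑ (schur 3 κ) (at (vandermonde (point (2 ℕ.+ lam ₁) (1 ℕ.+ lam ₂) (lam ₃)))) ≡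
  𝟙 (Listₚ.≡-dec ℕ._≟_ (parts lam) (parts κ))
schur-orthonormal lam κ lam≤3 with ℓ κ ℕ.≤? 3
... | no κ≰3 = trans (schur-zero κ _ κ≰3)
                 (sym (𝟙-no (Listₚ.≡-dec ℕ._≟_ (parts lam) (parts κ))
                    λ eq → κ≰3 (subst (λ ps → length ps ≤ 3) eq lam≤3)))
... | yes κ≤3 = begin
  ∑ (schur 3 κ) (at (vandermonde (point l₁ l₂ l₃)))
    ≡⟨ schur-bialternant κ κ≤3 (point l₁ l₂ l₃) ⟩
  Alt (2 ℕ.+ κ ₁) (1 ℕ.+ κ ₂) (κ ₃) (point l₁ l₂ l₃)
    ≡⟨ Alt-point (s≤s (s≤s (κ₂≤κ₁ κ))) (s≤s (κ₃≤κ₂ κ)) (s≤s (s≤s (κ₂≤κ₁ lam))) (s≤s (κ₃≤κ₂ lam)) ⟩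
  point l₁ l₂ l₃ (2 ℕ.+ κ ₁) (1 ℕ.+ κ ₂) (κ ₃)
    ≡⟨ point-× l₁ l₂ l₃ (2 ℕ.+ κ ₁) (1 ℕ.+ κ ₂) (κ ₃) ⟩
  𝟙 ((2 ℕ.+ κ ₁ ℕ.≟ l₁ ×-dec 1 ℕ.+ κ ₂ ℕ.≟ l₂) ×-dec κ ₃ ℕ.≟ l₃)
    ≡⟨ 𝟙-cong ((2 ℕ.+ κ ₁ ℕ.≟ l₁ ×-dec 1 ℕ.+ κ ₂ ℕ.≟ l₂) ×-dec κ ₃ ℕ.≟ l₃)
         (Listₚ.≡-dec ℕ._≟_ (parts lam) (parts κ))
         (λ ((e₁ , e₂) , e₃) → parts-determined κ lam κ≤3 lam≤3
            (ℕₚ.+-cancelˡ-≡ 2 _ _ e₁) (ℕₚ.+-cancelˡ-≡ 1 _ _ e₂) e₃)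
         (λ eq → (cong (λ ps → 2 ℕ.+ nth ps 0) (sym eq) , cong (λ ps → 1 ℕ.+ nth ps 1) (sym eq))
               , cong (λ ps → nth ps 2) (sym eq)) ⟩
  𝟙 (Listₚ.≡-dec ℕ._≟_ (parts lam) (parts κ)) ∎
  where
  l₁ = 2 ℕ.+ lam ₁
  l₂ = 1 ℕ.+ lam ₂
  l₃ = lam ₃

-- The dual functional is applied to both sides of the expansion. On s_μ s_ν the factor a_ρ is
-- absorbed by s_μ, which leaves a_(μ+ρ) times the monomials of s_ν.
LR-alternating : ∀ lam μ ν {c} → ℓ lam ≤ 3 → ℓ μ ≤ 3 → IsLRCoefficient lam μ ν c →
  c ≡ ∑ (schur 3 ν) (at λ x y z →
        Alt (2 ℕ.+ μ ₁) (1 ℕ.+ μ ₂) (μ ₃) (translate x y z (point (2 ℕ.+ lam ₁) (1 ℕ.+ lam ₂) (lam ₃))))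
LR-alternating lam μ ν {c} lam≤3 μ≤3 (L , isExp , refl) = begin
  coeffAt lam L
    ≡⟨ sumℤ-map proj₁ (filter eq? L) ⟩
  ∑ (filter eq? L) proj₁
    ≡⟨ ∑-filter eq? L proj₁ ⟩
  ∑ L (λ t → 𝟙 (eq? t) * proj₁ t)
    ≡⟨ ∑-cong L (λ t → trans (ℤₚ.*-comm (𝟙 (eq? t)) (proj₁ t))
         (cong (proj₁ t *_) (sym (schur-orthonormal lam (proj₂ t) lam≤3)))) ⟩
  ∑ L (λ t → proj₁ t * ∑ (schur 3 (proj₂ t)) (at (vandermonde pt)))
    ≡⟨ sym (expansion-vandermonde {μ} {ν} {L} (2 ℕ.+ lam ₁) (1 ℕ.+ lam ₂) (lam ₃) isExp) ⟩
  ∑ (schur 3 μ ⊗ schur 3 ν) (at (vandermonde pt))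
    ≡⟨ ∑-cartesian (Vec.zipWith ℕ._+_) (schur 3 μ) (schur 3 ν) _ ⟩
  ∑ (schur 3 μ) (λ m → ∑ (schur 3 ν) (λ m′ → at (vandermonde pt) (Vec.zipWith ℕ._+_ m m′)))
    ≡⟨ ∑-swap (schur 3 μ) (schur 3 ν) _ ⟩
  ∑ (schur 3 ν) (λ m′ → ∑ (schur 3 μ) (λ m → at (vandermonde pt) (Vec.zipWith ℕ._+_ m m′)))
    ≡⟨ ∑-cong (schur 3 ν) (λ { (x ∷ y ∷ z ∷ []) → trans
         (∑-cong (schur 3 μ) (λ { (a ∷ b ∷ c ∷ []) → Alt-cong 2 1 0 λ i j k →
           cong₃ pt (rotate a x i) (rotate b y j) (rotate c z k) }))
         (schur-bialternant μ μ≤3 (translate x y z pt)) }) ⟩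
  _ ∎
  where
  eq? : ∀ t → Dec (parts lam ≡ parts (proj₂ t))
  eq? t = Listₚ.≡-dec ℕ._≟_ (parts lam) (parts (proj₂ t))
  pt : Test
  pt = point (2 ℕ.+ lam ₁) (1 ℕ.+ lam ₂) (lam ₃)
  rotate : ∀ a x i → a ℕ.+ x ℕ.+ i ≡ x ℕ.+ (a ℕ.+ i)
  rotate = ℕ-Ring.solve-∀

-- Pieri and Jacobi–Trudi in test-function form

upTo-suc : ∀ n (f : ℕ → ℤ) → ∑ (upTo (suc n)) f ≡ f 0 + ∑ (upTo n) (f ∘ suc)
upTo-suc n f = cong (_+_ (f 0)) (shift id n)
  where
  shift : ∀ (g : ℕ → ℕ) n → ∑ (applyUpTo (suc ∘ g) n) f ≡ ∑ (applyUpTo g n) (f ∘ suc)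
  shift g zero    = refl
  shift g (suc n) = cong (_+_ (f (suc (g 0)))) (shift (g ∘ suc) n)

∑-delta : ∀ R m (f : ℕ → ℤ) → ∑ (upTo R) (λ k → 𝟙 (k ℕ.≟ m) * f k) ≡ 𝟙 (m ℕ.<? R) * f m
∑-delta zero    m f = sym (ℤₚ.*-zeroˡ (f m))
∑-delta (suc R) zero f =
  trans (upTo-suc R (λ k → 𝟙 (k ℕ.≟ 0) * f k))
    (trans (cong (_+_ (1ℤ * f 0)) (∑-zero (upTo R) λ k → ℤₚ.*-zeroˡ (f (suc k)))) (+-identityʳ _))
∑-delta (suc R) (suc m) f =
  trans (upTo-suc R (λ k → 𝟙 (k ℕ.≟ suc m) * f k))
    (trans (cong₂ _+_ (ℤₚ.*-zeroˡ (f 0))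
              (∑-cong (upTo R) λ k → cong (_* f (suc k))
                 (𝟙-cong (suc k ℕ.≟ suc m) (k ℕ.≟ m) ℕₚ.suc-injective (cong suc))))
      (trans (+-identityˡ _) (trans (∑-delta R m (f ∘ suc))
        (cong (_* f (suc m)) (𝟙-cong (m ℕ.<? R) (suc m ℕ.<? suc R) s≤s ℕ.s≤s⁻¹)))))

-- Paired with the monomial x^k, `below l` gives the coefficient of x^l in x^k/(1 - x).
below : ℕ → ℕ → ℤ
below l x = 𝟙 (x ℕ.≤? l)

∑-delta-below : ∀ {R l} m (f : ℕ → ℤ) → l < R →
  ∑ (upTo R) (λ k → 𝟙 (k ℕ.≟ m) * (below l k * f k)) ≡ below l m * f m
∑-delta-below {R} {l} m f l<R =
  trans (∑-delta R m (λ k → below l k * f k))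
    (trans (sym (ℤₚ.*-assoc (𝟙 (m ℕ.<? R)) (below l m) (f m)))
      (cong (_* f m) (trans (sym (𝟙-× (m ℕ.<? R) (m ℕ.≤? l)))
        (𝟙-cong (m ℕ.<? R ×-dec m ℕ.≤? l) (m ℕ.≤? l) proj₂ (λ m≤l → ℕₚ.≤-<-trans m≤l l<R , m≤l)))))

product : (f g h : ℕ → ℤ) → Test
product f g h x y z = f x * g y * h z

-- `T` plays the role of a degree. `R` makes the sum finite and is chosen beyond the box that
-- carries the summand.
slice : ℕ → ℕ → Test → ℤ
slice R T Φ =
  ∑ (upTo R) λ x → ∑ (upTo R) λ y → ∑ (upTo R) λ z → 𝟙 (x ℕ.+ y ℕ.+ z ℕ.≟ T) * Φ x y z

slice-cong : ∀ R T {Φ Ψ : Test} → (∀ x y z → Φ x y z ≡ Ψ x y z) → slice R T Φ ≡ slice R T Ψ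
slice-cong R T eq =
  ∑-cong (upTo R) λ x → ∑-cong (upTo R) λ y → ∑-cong (upTo R) λ z →
    cong (𝟙 (x ℕ.+ y ℕ.+ z ℕ.≟ T) *_) (eq x y z)

slice-alternate : ∀ R T (a b c d e f : Test) →
  slice R T (λ x y z → alternate (a x y z) (b x y z) (c x y z) (d x y z) (e x y z) (f x y z)) ≡
  alternate (slice R T a) (slice R T b) (slice R T c) (slice R T d) (slice R T e) (slice R T f)
slice-alternate R T a b c d e f =
  trans (∑-cong (upTo R) λ x → trans (∑-cong (upTo R) λ y → trans
    (∑-cong (upTo R) λ z → distrib (𝟙 (x ℕ.+ y ℕ.+ z ℕ.≟ T)) (a x y z) (b x y z) (c x y z) (d x y z) (e x y z) (f x y z))
    (∑-alternate (upTo R) (w a x y) (w b x y) (w c x y) (w d x y) (w e x y) (w f x y)))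
    (∑-alternate (upTo R) (w₂ a x) (w₂ b x) (w₂ c x) (w₂ d x) (w₂ e x) (w₂ f x)))
    (∑-alternate (upTo R) (w₁ a) (w₁ b) (w₁ c) (w₁ d) (w₁ e) (w₁ f))
  where
  w : Test → Test
  w Φ x y z = 𝟙 (x ℕ.+ y ℕ.+ z ℕ.≟ T) * Φ x y z
  w₂ : Test → ℕ → ℕ → ℤ
  w₂ Φ x y = ∑ (upTo R) (w Φ x y)
  w₁ : Test → ℕ → ℤ
  w₁ Φ x = ∑ (upTo R) (w₂ Φ x)
  distrib : ∀ k a b c d e f →
    k * (a - b - c + d + e - f) ≡ k * a - k * b - k * c + k * d + k * e - k * f
  distrib = solve-∀

slice-swap₁₂ : ∀ R T f g h → slice R T (product f g h) ≡ slice R T (product g f h)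
slice-swap₁₂ R T f g h =
  trans (∑-swap (upTo R) (upTo R) _)
    (∑-cong (upTo R) λ y → ∑-cong (upTo R) λ x → ∑-cong (upTo R) λ z →
      cong₂ _*_ (𝟙-cong (x ℕ.+ y ℕ.+ z ℕ.≟ T) (y ℕ.+ x ℕ.+ z ℕ.≟ T)
                   (trans (cong (ℕ._+ z) (ℕₚ.+-comm y x))) (trans (cong (ℕ._+ z) (ℕₚ.+-comm x y))))
                (cong (_* h z) (ℤₚ.*-comm (f x) (g y))))

slice-swap₂₃ : ∀ R T f g h → slice R T (product f g h) ≡ slice R T (product f h g)
slice-swap₂₃ R T f g h =
  ∑-cong (upTo R) λ x → trans (∑-swap (upTo R) (upTo R) _)
    (∑-cong (upTo R) λ z → ∑-cong (upTo R) λ y →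
      cong₂ _*_ (𝟙-cong (x ℕ.+ y ℕ.+ z ℕ.≟ T) (x ℕ.+ z ℕ.+ y ℕ.≟ T)
                   (trans (exchange x z y)) (trans (exchange x y z)))
                (exchange′ (f x) (g y) (h z)))
  where
  exchange : ∀ x y z → x ℕ.+ y ℕ.+ z ≡ x ℕ.+ z ℕ.+ y
  exchange = ℕ-Ring.solve-∀
  exchange′ : ∀ x y z → x * y * z ≡ x * z * y
  exchange′ = solve-∀

-- Adding a column of a 3×3 determinant to the columns on its right, with the rows scaled by g.
det-columns : ∀ g₁ g₂ g₃ a₁ a₂ a₃ b₁ b₂ b₃ c₁ c₂ c₃ →
  g₁ * g₂ * g₃ *
    ( a₁ * (b₁ + b₂) * (c₁ + c₂ + c₃) - a₁ * (b₁ + b₂ + b₃) * (c₁ + c₂)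
    - (a₁ + a₂) * b₁ * (c₁ + c₂ + c₃) + (a₁ + a₂) * (b₁ + b₂ + b₃) * c₁
    + (a₁ + a₂ + a₃) * b₁ * (c₁ + c₂) - (a₁ + a₂ + a₃) * (b₁ + b₂) * c₁) ≡
    (g₁ * a₁) * (g₂ * b₂) * (g₃ * c₃) - (g₁ * a₁) * (g₂ * b₃) * (g₃ * c₂)
  - (g₁ * a₂) * (g₂ * b₁) * (g₃ * c₃) + (g₁ * a₂) * (g₂ * b₃) * (g₃ * c₁)
  + (g₁ * a₃) * (g₂ * b₁) * (g₃ * c₂) - (g₁ * a₃) * (g₂ * b₂) * (g₃ * c₁)
det-columns = solve-∀

infixl 7 _·_
_·_ : (f g : ℕ → ℤ) → ℕ → ℤ
(f · g) x = f x * g x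

-- In both uses the entries of a row of the determinant are nested indicators, and the column
-- operations replace them by increments with disjoint supports.
slice-det : ∀ R T (g₁ g₂ g₃ a₁ a₂ a₃ b₁ b₂ b₃ c₁ c₂ c₃ : ℕ → ℤ) (U V W : ℕ → ℕ → ℤ) k₁ k₂ k₃ →
  (∀ x → U k₁ x ≡ a₁ x) → (∀ x → U k₂ x ≡ a₁ x + a₂ x) → (∀ x → U k₃ x ≡ a₁ x + a₂ x + a₃ x) →
  (∀ x → V k₁ x ≡ b₁ x) → (∀ x → V k₂ x ≡ b₁ x + b₂ x) → (∀ x → V k₃ x ≡ b₁ x + b₂ x + b₃ x) →
  (∀ x → W k₁ x ≡ c₁ x) → (∀ x → W k₂ x ≡ c₁ x + c₂ x) → (∀ x → W k₃ x ≡ c₁ x + c₂ x + c₃ x) →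
  slice R T (λ x y z → product g₁ g₂ g₃ x y z * Alt k₁ k₂ k₃ (λ i j k → U i x * V j y * W k z)) ≡
  alternate (slice R T (product (g₁ · a₁) (g₂ · b₂) (g₃ · c₃))) (slice R T (product (g₁ · a₁) (g₂ · b₃) (g₃ · c₂)))
            (slice R T (product (g₁ · a₂) (g₂ · b₁) (g₃ · c₃))) (slice R T (product (g₁ · a₂) (g₂ · b₃) (g₃ · c₁)))
            (slice R T (product (g₁ · a₃) (g₂ · b₁) (g₃ · c₂))) (slice R T (product (g₁ · a₃) (g₂ · b₂) (g₃ · c₁)))
slice-det R T g₁ g₂ g₃ a₁ a₂ a₃ b₁ b₂ b₃ c₁ c₂ c₃ U V W k₁ k₂ k₃ u₁ u₂ u₃ v₁ v₂ v₃ w₁ w₂ w₃ =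
  trans (slice-cong R T pointwise)
        (slice-alternate R T (product (g₁ · a₁) (g₂ · b₂) (g₃ · c₃)) (product (g₁ · a₁) (g₂ · b₃) (g₃ · c₂))
            (product (g₁ · a₂) (g₂ · b₁) (g₃ · c₃)) (product (g₁ · a₂) (g₂ · b₃) (g₃ · c₁))
            (product (g₁ · a₃) (g₂ · b₁) (g₃ · c₂)) (product (g₁ · a₃) (g₂ · b₂) (g₃ · c₁)))
  where
  pointwise : ∀ x y z →
    product g₁ g₂ g₃ x y z * Alt k₁ k₂ k₃ (λ i j k → U i x * V j y * W k z) ≡
    alternate (product (g₁ · a₁) (g₂ · b₂) (g₃ · c₃) x y z) (product (g₁ · a₁) (g₂ · b₃) (g₃ · c₂) x y z)
              (product (g₁ · a₂) (g₂ · b₁) (g₃ · c₃) x y z) (product (g₁ · a₂) (g₂ · b₃) (g₃ · c₁) x y z)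
              (product (g₁ · a₃) (g₂ · b₁) (g₃ · c₂) x y z) (product (g₁ · a₃) (g₂ · b₂) (g₃ · c₁) x y z)
  pointwise x y z
    rewrite u₁ x | u₂ x | u₃ x | v₁ y | v₂ y | v₃ y | w₁ z | w₂ z | w₃ z =
    det-columns (g₁ x) (g₂ y) (g₃ z) (a₁ x) (a₂ x) (a₃ x) (b₁ y) (b₂ y) (b₃ y) (c₁ z) (c₂ z) (c₃ z)

below-step : ∀ l m → below l m ≡ below l (suc m) + 𝟙 (l ℕ.≟ m)
below-step l m with l ℕ.≟ m
... | yes refl = trans (𝟙-yes (m ℕ.≤? m) ℕₚ.≤-refl)
                       (cong (_+ 1ℤ) (sym (𝟙-no (suc m ℕ.≤? m) ℕₚ.1+n≰n)))
... | no  l≢m  = trans (𝟙-cong (m ℕ.≤? l) (suc m ℕ.≤? l) (λ m≤l → ℕₚ.≤∧≢⇒< m≤l (l≢m ∘ sym)) ℕₚ.<⇒≤)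
                       (sym (+-identityʳ _))

-- The deltas pin the second and third coordinates. The coordinate sum then pins the first at x + 2
-- + p, where its own threshold x + 2 is met.
slice-value : ∀ {R} p x y z {l₁ l₂ l₃} → l₁ < R → l₂ < R → l₃ < R →
  slice R (x ℕ.+ y ℕ.+ z ℕ.+ (3 ℕ.+ p))
    (product (below l₁ · (λ k → below k (x ℕ.+ 2))) (below l₂ · (λ k → 𝟙 (k ℕ.≟ y ℕ.+ 1))) (below l₃ · (λ k → 𝟙 (k ℕ.≟ z ℕ.+ 0)))) ≡
  below l₁ (x ℕ.+ (2 ℕ.+ p)) * below l₂ (y ℕ.+ 1) * below l₃ (z ℕ.+ 0)
slice-value {R} p x y z {l₁} {l₂} {l₃} l₁<R l₂<R l₃<R = begin
  slice R T (product (below l₁ · (λ k → below k (x ℕ.+ 2))) (below l₂ · (λ k → 𝟙 (k ℕ.≟ y′))) (below l₃ · (λ k → 𝟙 (k ℕ.≟ z′))))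
    ≡⟨ ∑-cong (upTo R) (λ a → ∑-cong (upTo R) λ b → trans
         (∑-cong (upTo R) λ c → toFront (𝟙 (a ℕ.+ b ℕ.+ c ℕ.≟ T)) (below l₁ a) (below a (x ℕ.+ 2))
                                        (below l₂ b) (𝟙 (b ℕ.≟ y′)) (below l₃ c) (𝟙 (c ℕ.≟ z′)))
         (∑-delta-below z′ (λ c → 𝟙 (a ℕ.+ b ℕ.+ c ℕ.≟ T) * F a b) l₃<R)) ⟩
  ∑ (upTo R) (λ a → ∑ (upTo R) λ b → below l₃ z′ * (𝟙 (a ℕ.+ b ℕ.+ z′ ℕ.≟ T) * F a b))
    ≡⟨ ∑-cong (upTo R) (λ a → trans
         (∑-cong (upTo R) λ b → toFront′ (𝟙 (a ℕ.+ b ℕ.+ z′ ℕ.≟ T)) (below l₁ a) (below a (x ℕ.+ 2))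
                                         (below l₂ b) (𝟙 (b ℕ.≟ y′)) (below l₃ z′))
         (∑-delta-below y′ (λ b → below l₃ z′ * (𝟙 (a ℕ.+ b ℕ.+ z′ ℕ.≟ T) * G a)) l₂<R)) ⟩
  ∑ (upTo R) (λ a → below l₂ y′ * (below l₃ z′ * (𝟙 (a ℕ.+ y′ ℕ.+ z′ ℕ.≟ T) * G a)))
    ≡⟨ ∑-cong (upTo R) (λ a → trans
         (cong (λ s → below l₂ y′ * (below l₃ z′ * (s * G a)))
            (𝟙-cong (a ℕ.+ y′ ℕ.+ z′ ℕ.≟ T) (a ℕ.≟ x ℕ.+ (2 ℕ.+ p))
               (λ eq → ℕₚ.+-cancelʳ-≡ (y ℕ.+ z ℕ.+ 1) a (x ℕ.+ (2 ℕ.+ p))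
                         (trans (sym (regroup a y z)) (trans eq (regroup′ x y z p))))
               (λ { refl → trans (regroup a y z) (sym (regroup′ x y z p)) })))
         (toFront″ (below l₂ y′) (below l₃ z′) (𝟙 (a ℕ.≟ x ℕ.+ (2 ℕ.+ p))) (below l₁ a) (below a (x ℕ.+ 2)))) ⟩
  ∑ (upTo R) (λ a → 𝟙 (a ℕ.≟ x ℕ.+ (2 ℕ.+ p)) * (below l₁ a * (below l₂ y′ * below l₃ z′ * below a (x ℕ.+ 2))))
    ≡⟨ ∑-delta-below (x ℕ.+ (2 ℕ.+ p)) (λ a → below l₂ y′ * below l₃ z′ * below a (x ℕ.+ 2)) l₁<R ⟩
  below l₁ (x ℕ.+ (2 ℕ.+ p)) * (below l₂ y′ * below l₃ z′ * below (x ℕ.+ (2 ℕ.+ p)) (x ℕ.+ 2))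
    ≡⟨ cong (λ s → below l₁ (x ℕ.+ (2 ℕ.+ p)) * (below l₂ y′ * below l₃ z′ * s))
         (𝟙-yes (x ℕ.+ 2 ℕ.≤? x ℕ.+ (2 ℕ.+ p)) (ℕₚ.+-monoʳ-≤ x (ℕₚ.m≤m+n 2 p))) ⟩
  below l₁ (x ℕ.+ (2 ℕ.+ p)) * (below l₂ y′ * below l₃ z′ * 1ℤ)
    ≡⟨ unit (below l₁ (x ℕ.+ (2 ℕ.+ p))) (below l₂ y′) (below l₃ z′) ⟩
  below l₁ (x ℕ.+ (2 ℕ.+ p)) * below l₂ y′ * below l₃ z′ ∎
  where
  T = x ℕ.+ y ℕ.+ z ℕ.+ (3 ℕ.+ p)
  y′ = y ℕ.+ 1
  z′ = z ℕ.+ 0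
  F : ℕ → ℕ → ℤ
  F a b = below l₁ a * below a (x ℕ.+ 2) * (below l₂ b * 𝟙 (b ℕ.≟ y′))
  G : ℕ → ℤ
  G a = below l₁ a * below a (x ℕ.+ 2)
  toFront : ∀ t a b c d e f → t * (a * b * (c * d) * (e * f)) ≡ f * (e * (t * (a * b * (c * d))))
  toFront = solve-∀
  toFront′ : ∀ t a b c d e → e * (t * (a * b * (c * d))) ≡ d * (c * (e * (t * (a * b))))
  toFront′ = solve-∀
  toFront″ : ∀ c e t a b → c * (e * (t * (a * b))) ≡ t * (a * (c * e * b))
  toFront″ = solve-∀
  unit : ∀ a b c → a * (b * c * 1ℤ) ≡ a * b * c
  unit = solve-∀
  regroup : ∀ a y z → a ℕ.+ (y ℕ.+ 1) ℕ.+ (z ℕ.+ 0) ≡ a ℕ.+ (y ℕ.+ z ℕ.+ 1)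
  regroup = ℕ-Ring.solve-∀
  regroup′ : ∀ x y z p → x ℕ.+ y ℕ.+ z ℕ.+ (3 ℕ.+ p) ≡ x ℕ.+ (2 ℕ.+ p) ℕ.+ (y ℕ.+ z ℕ.+ 1)
  regroup′ = ℕ-Ring.solve-∀

-- Paired with a form of degree d, it gives the coefficient of the monomial with exponent (l₁, l₂,
-- l₃) in the product of that form with h_j, where j = l₁ + l₂ + l₃ - d.
box : ℕ → ℕ → ℕ → Test
box l₁ l₂ l₃ = product (below l₁) (below l₂) (below l₃)

-- a_ρ h_p = a_{(p,0,0)+ρ}, with the monomials of h_p running over the slice.
pieri : ∀ R p x y z l₁ l₂ l₃ → l₁ < R → l₂ < R → l₃ < R →
  slice R (x ℕ.+ y ℕ.+ z ℕ.+ (3 ℕ.+ p))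
    (λ a b c → box l₁ l₂ l₃ a b c * Alt 2 1 0 (translate x y z (box a b c))) ≡
  Alt (2 ℕ.+ p) 1 0 (translate x y z (box l₁ l₂ l₃))
pieri R p x y z l₁ l₂ l₃ l₁<R l₂<R l₃<R = trans
  (slice-det R T (below l₁) (below l₂) (below l₃)
    (top x) (mid x) (bot x) (top y) (mid y) (bot y) (top z) (mid z) (bot z)
    (λ i a → below a (x ℕ.+ i)) (λ i a → below a (y ℕ.+ i)) (λ i a → below a (z ℕ.+ i)) 2 1 0
    (λ _ → refl) (column₂ x) (column₃ x) (λ _ → refl) (column₂ y) (column₃ y) (λ _ → refl) (column₂ z) (column₃ z))
  -- In each of the six terms one coordinate carries the threshold and two carry deltas. Permuting
  -- the coordinates brings the threshold to the front, where `slice-value` applies.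
  (alternate-cong
    (slice-value p x y z l₁<R l₂<R l₃<R)
    (trans (slice-swap₂₃ R T (below l₁ · top x) (below l₂ · bot y) (below l₃ · mid z))
           (value x z y l₁<R l₃<R l₂<R (e₁₃₂ x y z) (exchange₁₃₂ (below l₁ (x ℕ.+ (2 ℕ.+ p))) (below l₃ (z ℕ.+ 1)) (below l₂ (y ℕ.+ 0)))))
    (trans (slice-swap₁₂ R T (below l₁ · mid x) (below l₂ · top y) (below l₃ · bot z))
           (value y x z l₂<R l₁<R l₃<R (e₂₁₃ x y z) (exchange₂₁₃ (below l₂ (y ℕ.+ (2 ℕ.+ p))) (below l₁ (x ℕ.+ 1)) (below l₃ (z ℕ.+ 0)))))
    (trans (slice-swap₂₃ R T (below l₁ · mid x) (below l₂ · bot y) (below l₃ · top z))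
      (trans (slice-swap₁₂ R T (below l₁ · mid x) (below l₃ · top z) (below l₂ · bot y))
           (value z x y l₃<R l₁<R l₂<R (e₃₁₂ x y z) (exchange₃₁₂ (below l₃ (z ℕ.+ (2 ℕ.+ p))) (below l₁ (x ℕ.+ 1)) (below l₂ (y ℕ.+ 0))))))
    (trans (slice-swap₁₂ R T (below l₁ · bot x) (below l₂ · top y) (below l₃ · mid z))
      (trans (slice-swap₂₃ R T (below l₂ · top y) (below l₁ · bot x) (below l₃ · mid z))
           (value y z x l₂<R l₃<R l₁<R (e₂₃₁ x y z) (exchange₂₃₁ (below l₂ (y ℕ.+ (2 ℕ.+ p))) (below l₃ (z ℕ.+ 1)) (below l₁ (x ℕ.+ 0))))))
    (trans (slice-swap₁₂ R T (below l₁ · bot x) (below l₂ · mid y) (below l₃ · top z))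
      (trans (slice-swap₂₃ R T (below l₂ · mid y) (below l₁ · bot x) (below l₃ · top z))
        (trans (slice-swap₁₂ R T (below l₂ · mid y) (below l₃ · top z) (below l₁ · bot x))
           (value z y x l₃<R l₂<R l₁<R (e₃₂₁ x y z) (exchange₃₂₁ (below l₃ (z ℕ.+ (2 ℕ.+ p))) (below l₂ (y ℕ.+ 1)) (below l₁ (x ℕ.+ 0))))))))
  where
  T = x ℕ.+ y ℕ.+ z ℕ.+ (3 ℕ.+ p)
  top mid bot : ℕ → ℕ → ℤ
  top x k = below k (x ℕ.+ 2)
  mid x k = 𝟙 (k ℕ.≟ x ℕ.+ 1)
  bot x k = 𝟙 (k ℕ.≟ x ℕ.+ 0)
  column₂ : ∀ x k → below k (x ℕ.+ 1) ≡ top x k + mid x k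
  column₂ x k = trans (below-step k (x ℕ.+ 1)) (cong (λ i → below k i + mid x k) (sym (ℕₚ.+-suc x 1)))
  column₃ : ∀ x k → below k (x ℕ.+ 0) ≡ top x k + mid x k + bot x k
  column₃ x k = trans (below-step k (x ℕ.+ 0))
    (cong (_+ bot x k) (trans (cong (below k) (sym (ℕₚ.+-suc x 0))) (column₂ x k)))
  value : ∀ x y z {l₁ l₂ l₃ t} → l₁ < R → l₂ < R → l₃ < R →
    T ≡ x ℕ.+ y ℕ.+ z ℕ.+ (3 ℕ.+ p) →
    below l₁ (x ℕ.+ (2 ℕ.+ p)) * below l₂ (y ℕ.+ 1) * below l₃ (z ℕ.+ 0) ≡ t →
    slice R T (product (below l₁ · top x) (below l₂ · mid y) (below l₃ · bot z)) ≡ t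
  value x y z {l₁} {l₂} {l₃} h₁ h₂ h₃ T≡ eq =
    trans (cong (λ t → slice R t (product (below l₁ · top x) (below l₂ · mid y) (below l₃ · bot z))) T≡)
          (trans (slice-value p x y z h₁ h₂ h₃) eq)
  e₁₃₂ : ∀ x y z → x ℕ.+ y ℕ.+ z ℕ.+ (3 ℕ.+ p) ≡ x ℕ.+ z ℕ.+ y ℕ.+ (3 ℕ.+ p)
  e₁₃₂ x y z = cong (ℕ._+ (3 ℕ.+ p)) (s x y z) where
    s : ∀ x y z → x ℕ.+ y ℕ.+ z ≡ x ℕ.+ z ℕ.+ y
    s = ℕ-Ring.solve-∀
  e₂₁₃ : ∀ x y z → x ℕ.+ y ℕ.+ z ℕ.+ (3 ℕ.+ p) ≡ y ℕ.+ x ℕ.+ z ℕ.+ (3 ℕ.+ p)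
  e₂₁₃ x y z = cong (ℕ._+ (3 ℕ.+ p)) (s x y z) where
    s : ∀ x y z → x ℕ.+ y ℕ.+ z ≡ y ℕ.+ x ℕ.+ z
    s = ℕ-Ring.solve-∀
  e₃₁₂ : ∀ x y z → x ℕ.+ y ℕ.+ z ℕ.+ (3 ℕ.+ p) ≡ z ℕ.+ x ℕ.+ y ℕ.+ (3 ℕ.+ p)
  e₃₁₂ x y z = trans (e₁₃₂ x y z) (e₂₁₃ x z y)
  e₂₃₁ : ∀ x y z → x ℕ.+ y ℕ.+ z ℕ.+ (3 ℕ.+ p) ≡ y ℕ.+ z ℕ.+ x ℕ.+ (3 ℕ.+ p)
  e₂₃₁ x y z = trans (e₂₁₃ x y z) (e₁₃₂ y x z)
  e₃₂₁ : ∀ x y z → x ℕ.+ y ℕ.+ z ℕ.+ (3 ℕ.+ p) ≡ z ℕ.+ y ℕ.+ x ℕ.+ (3 ℕ.+ p)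
  e₃₂₁ x y z = trans (e₂₃₁ x y z) (e₂₁₃ y z x)
  exchange₁₃₂ : ∀ a b c → a * b * c ≡ a * c * b
  exchange₁₃₂ = solve-∀
  exchange₂₁₃ : ∀ a b c → a * b * c ≡ b * a * c
  exchange₂₁₃ = solve-∀
  exchange₃₁₂ : ∀ a b c → a * b * c ≡ b * c * a
  exchange₃₁₂ = solve-∀
  exchange₂₃₁ : ∀ a b c → a * b * c ≡ c * a * b
  exchange₂₃₁ = solve-∀
  exchange₃₂₁ : ∀ a b c → a * b * c ≡ c * b * a
  exchange₃₂₁ = solve-∀

𝟙*𝟙-cong : (d : Dec P) (e : Dec Q) {s t : ℤ} → (P → Q → s ≡ t) → 𝟙 d * 𝟙 e * s ≡ 𝟙 d * 𝟙 e * t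
𝟙*𝟙-cong (yes p) (yes q) h = cong (1ℤ * 1ℤ *_) (h p q)
𝟙*𝟙-cong (yes _) (no _)  {s} {t} h = trans (ℤₚ.*-zeroˡ s) (sym (ℤₚ.*-zeroˡ t))
𝟙*𝟙-cong (no _)  (yes _) {s} {t} h = trans (ℤₚ.*-zeroˡ s) (sym (ℤₚ.*-zeroˡ t))
𝟙*𝟙-cong (no _)  (no _)  {s} {t} h = trans (ℤₚ.*-zeroˡ s) (sym (ℤₚ.*-zeroˡ t))

-- The size condition recovers μ₂ from the other two coordinates, so that only the row lengths
-- μ₁ and μ₁ + 1 appear on the right.
jacobi-trudi : ∀ m₁ m₂ m₃ x y z l₁ l₂ l₃ → m₃ ≤ m₂ →
  x ℕ.+ y ℕ.+ z ℕ.+ (2 ℕ.+ m₁ ℕ.+ (1 ℕ.+ m₂) ℕ.+ m₃) ≡ l₁ ℕ.+ l₂ ℕ.+ l₃ →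
  Alt (2 ℕ.+ m₁) (1 ℕ.+ m₂) m₃ (translate x y z (point l₁ l₂ l₃)) ≡
  Alt (2 ℕ.+ m₁) (1 ℕ.+ m₃) m₃ (translate x y z (box l₁ l₂ l₃))
  - Alt (3 ℕ.+ m₁) (1 ℕ.+ m₃) m₃ (translate x y z (box l₁ l₂ l₃))
jacobi-trudi m₁ m₂ m₃ x y z l₁ l₂ l₃ m₃≤m₂ size = sym (begin
  Alt a c m₃ (translate x y z (box l₁ l₂ l₃)) - Alt (suc a) c m₃ (translate x y z (box l₁ l₂ l₃))
    ≡⟨ cong₂ _-_ (Alt-product (u x l₁) (u y l₂) (u z l₃) a c m₃
                              (split x l₁ a) refl (split x l₁ m₃)
                              (split y l₂ a) refl (split y l₂ m₃)
                              (split z l₃ a) refl (split z l₃ m₃))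
                 (Alt-product (u x l₁) (u y l₂) (u z l₃) (suc a) c m₃
                              refl refl (split x l₁ m₃) refl refl (split y l₂ m₃) refl refl (split z l₃ m₃)) ⟩
  -- The two determinants differ only in their first column, so their difference has the delta `v`
  -- at `a` there; subtracting the middle column from the last leaves the delta at `m₃`.
  _ ≡⟨ column-ops (u x l₁ (suc a)) (v x l₁ a) (u x l₁ c) (v x l₁ m₃)
                  (u y l₂ (suc a)) (v y l₂ a) (u y l₂ c) (v y l₂ m₃)
                  (u z l₃ (suc a)) (v z l₃ a) (u z l₃ c) (v z l₃ m₃) ⟩
  alternate (v x l₁ a * v z l₃ m₃ * u y l₂ c) (v x l₁ a * v y l₂ m₃ * u z l₃ c)
            (v y l₂ a * v z l₃ m₃ * u x l₁ c) (v z l₃ a * v y l₂ m₃ * u x l₁ c)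
            (v y l₂ a * v x l₁ m₃ * u z l₃ c) (v z l₃ a * v x l₁ m₃ * u y l₂ c)
    ≡⟨ alternate-cong
         (𝟙*𝟙-cong (x ℕ.+ a ℕ.≟ l₁) (z ℕ.+ m₃ ℕ.≟ l₃) λ e f → forced y (third (size₁ x y z a b m₃) e f))
         (𝟙*𝟙-cong (x ℕ.+ a ℕ.≟ l₁) (y ℕ.+ m₃ ℕ.≟ l₂) λ e f → forced z (third (size₂ x y z a b m₃) e f))
         (𝟙*𝟙-cong (y ℕ.+ a ℕ.≟ l₂) (z ℕ.+ m₃ ℕ.≟ l₃) λ e f → forced x (third (size₃ x y z a b m₃) e f))
         (𝟙*𝟙-cong (z ℕ.+ a ℕ.≟ l₃) (y ℕ.+ m₃ ℕ.≟ l₂) λ e f → forced x (third (size₄ x y z a b m₃) e f))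
         (𝟙*𝟙-cong (y ℕ.+ a ℕ.≟ l₂) (x ℕ.+ m₃ ℕ.≟ l₁) λ e f → forced z (third (size₅ x y z a b m₃) e f))
         (𝟙*𝟙-cong (z ℕ.+ a ℕ.≟ l₃) (x ℕ.+ m₃ ℕ.≟ l₁) λ e f → forced y (third (size₆ x y z a b m₃) e f)) ⟩
  alternate (v x l₁ a * v z l₃ m₃ * v y l₂ b) (v x l₁ a * v y l₂ m₃ * v z l₃ b)
            (v y l₂ a * v z l₃ m₃ * v x l₁ b) (v z l₃ a * v y l₂ m₃ * v x l₁ b)
            (v y l₂ a * v x l₁ m₃ * v z l₃ b) (v z l₃ a * v x l₁ m₃ * v y l₂ b)
    ≡⟨ reorder (v x l₁ a) (v x l₁ b) (v x l₁ m₃) (v y l₂ a) (v y l₂ b) (v y l₂ m₃) (v z l₃ a) (v z l₃ b) (v z l₃ m₃) ⟩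
  Alt a b m₃ (translate x y z (point l₁ l₂ l₃)) ∎)
  where
  a = 2 ℕ.+ m₁
  b = 1 ℕ.+ m₂
  c = 1 ℕ.+ m₃
  u v : ℕ → ℕ → ℕ → ℤ
  u x l k = below l (x ℕ.+ k)
  v x l k = 𝟙 (x ℕ.+ k ℕ.≟ l)
  split : ∀ x l k → u x l k ≡ u x l (suc k) + v x l k
  split x l k = trans (below-step l (x ℕ.+ k))
    (cong₂ _+_ (cong (below l) (sym (ℕₚ.+-suc x k))) (𝟙-cong (l ℕ.≟ x ℕ.+ k) (x ℕ.+ k ℕ.≟ l) sym sym))
  Alt-product : ∀ (f g h : ℕ → ℤ) i j k {f₁ f₂ f₃ g₁ g₂ g₃ h₁ h₂ h₃} →
    f i ≡ f₁ → f j ≡ f₂ → f k ≡ f₃ → g i ≡ g₁ → g j ≡ g₂ → g k ≡ g₃ → h i ≡ h₁ → h j ≡ h₂ → h k ≡ h₃ →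
    Alt i j k (product f g h) ≡
    alternate (f₁ * g₂ * h₃) (f₁ * g₃ * h₂) (f₂ * g₁ * h₃) (f₂ * g₃ * h₁) (f₃ * g₁ * h₂) (f₃ * g₂ * h₁)
  Alt-product f g h i j k refl refl refl refl refl refl refl refl refl = refl
  column-ops : ∀ U₁ a₁ u₁ v₁ U₂ a₂ u₂ v₂ U₃ a₃ u₃ v₃ →
      ( (U₁ + a₁) * u₂ * (u₃ + v₃) - (U₁ + a₁) * (u₂ + v₂) * u₃ - u₁ * (U₂ + a₂) * (u₃ + v₃)
      + u₁ * (u₂ + v₂) * (U₃ + a₃) + (u₁ + v₁) * (U₂ + a₂) * u₃ - (u₁ + v₁) * u₂ * (U₃ + a₃))
    - ( U₁ * u₂ * (u₃ + v₃) - U₁ * (u₂ + v₂) * u₃ - u₁ * U₂ * (u₃ + v₃)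
      + u₁ * (u₂ + v₂) * U₃ + (u₁ + v₁) * U₂ * u₃ - (u₁ + v₁) * u₂ * U₃) ≡
    a₁ * v₃ * u₂ - a₁ * v₂ * u₃ - a₂ * v₃ * u₁ + a₃ * v₂ * u₁ + a₂ * v₁ * u₃ - a₃ * v₁ * u₂
  column-ops = solve-∀
  reorder : ∀ a₁ b₁ c₁ a₂ b₂ c₂ a₃ b₃ c₃ →
    a₁ * c₃ * b₂ - a₁ * c₂ * b₃ - a₂ * c₃ * b₁ + a₃ * c₂ * b₁ + a₂ * c₁ * b₃ - a₃ * c₁ * b₂ ≡
    a₁ * b₂ * c₃ - a₁ * c₂ * b₃ - b₁ * a₂ * c₃ + b₁ * c₂ * a₃ + c₁ * a₂ * b₃ - c₁ * b₂ * a₃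
  reorder = solve-∀
  -- Meeting `l` exactly at `b` implies the box condition at `c`, because m₃ ≤ m₂; both indicators
  -- are then 1.
  forced : ∀ y {l} → y ℕ.+ b ≡ l → u y l c ≡ v y l b
  forced y {l} eq = trans (𝟙-yes (y ℕ.+ c ℕ.≤? l) (subst (y ℕ.+ c ≤_) eq (ℕₚ.+-monoʳ-≤ y (s≤s m₃≤m₂))))
                          (sym (𝟙-yes (y ℕ.+ b ℕ.≟ l) eq))
  third : ∀ {i j k i′ j′ k′} → l₁ ℕ.+ l₂ ℕ.+ l₃ ≡ i′ ℕ.+ j′ ℕ.+ k′ × x ℕ.+ y ℕ.+ z ℕ.+ (a ℕ.+ b ℕ.+ m₃) ≡ i ℕ.+ j ℕ.+ k →
          i ≡ i′ → j ≡ j′ → k ≡ k′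
  third {i} {j} {k} {k′ = k′} (e , f) refl refl =
    ℕₚ.+-cancelˡ-≡ (i ℕ.+ j) k k′ (trans (sym f) (trans size e))
  size₁ : ∀ x y z a b c →
    l₁ ℕ.+ l₂ ℕ.+ l₃ ≡ l₁ ℕ.+ l₃ ℕ.+ l₂ × x ℕ.+ y ℕ.+ z ℕ.+ (a ℕ.+ b ℕ.+ c) ≡ (x ℕ.+ a) ℕ.+ (z ℕ.+ c) ℕ.+ (y ℕ.+ b)
  size₁ x y z a b c = s l₁ l₂ l₃ , t x y z a b c where
    s : ∀ x y z → x ℕ.+ y ℕ.+ z ≡ x ℕ.+ z ℕ.+ y
    s = ℕ-Ring.solve-∀
    t : ∀ x y z a b c → x ℕ.+ y ℕ.+ z ℕ.+ (a ℕ.+ b ℕ.+ c) ≡ (x ℕ.+ a) ℕ.+ (z ℕ.+ c) ℕ.+ (y ℕ.+ b)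
    t = ℕ-Ring.solve-∀
  size₂ : ∀ x y z a b c →
    l₁ ℕ.+ l₂ ℕ.+ l₃ ≡ l₁ ℕ.+ l₂ ℕ.+ l₃ × x ℕ.+ y ℕ.+ z ℕ.+ (a ℕ.+ b ℕ.+ c) ≡ (x ℕ.+ a) ℕ.+ (y ℕ.+ c) ℕ.+ (z ℕ.+ b)
  size₂ x y z a b c = refl , t x y z a b c where
    t : ∀ x y z a b c → x ℕ.+ y ℕ.+ z ℕ.+ (a ℕ.+ b ℕ.+ c) ≡ (x ℕ.+ a) ℕ.+ (y ℕ.+ c) ℕ.+ (z ℕ.+ b)
    t = ℕ-Ring.solve-∀
  size₃ : ∀ x y z a b c →
    l₁ ℕ.+ l₂ ℕ.+ l₃ ≡ l₂ ℕ.+ l₃ ℕ.+ l₁ × x ℕ.+ y ℕ.+ z ℕ.+ (a ℕ.+ b ℕ.+ c) ≡ (y ℕ.+ a) ℕ.+ (z ℕ.+ c) ℕ.+ (x ℕ.+ b)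
  size₃ x y z a b c = s l₁ l₂ l₃ , t x y z a b c where
    s : ∀ x y z → x ℕ.+ y ℕ.+ z ≡ y ℕ.+ z ℕ.+ x
    s = ℕ-Ring.solve-∀
    t : ∀ x y z a b c → x ℕ.+ y ℕ.+ z ℕ.+ (a ℕ.+ b ℕ.+ c) ≡ (y ℕ.+ a) ℕ.+ (z ℕ.+ c) ℕ.+ (x ℕ.+ b)
    t = ℕ-Ring.solve-∀
  size₄ : ∀ x y z a b c →
    l₁ ℕ.+ l₂ ℕ.+ l₃ ≡ l₃ ℕ.+ l₂ ℕ.+ l₁ × x ℕ.+ y ℕ.+ z ℕ.+ (a ℕ.+ b ℕ.+ c) ≡ (z ℕ.+ a) ℕ.+ (y ℕ.+ c) ℕ.+ (x ℕ.+ b)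
  size₄ x y z a b c = s l₁ l₂ l₃ , t x y z a b c where
    s : ∀ x y z → x ℕ.+ y ℕ.+ z ≡ z ℕ.+ y ℕ.+ x
    s = ℕ-Ring.solve-∀
    t : ∀ x y z a b c → x ℕ.+ y ℕ.+ z ℕ.+ (a ℕ.+ b ℕ.+ c) ≡ (z ℕ.+ a) ℕ.+ (y ℕ.+ c) ℕ.+ (x ℕ.+ b)
    t = ℕ-Ring.solve-∀
  size₅ : ∀ x y z a b c →
    l₁ ℕ.+ l₂ ℕ.+ l₃ ≡ l₂ ℕ.+ l₁ ℕ.+ l₃ × x ℕ.+ y ℕ.+ z ℕ.+ (a ℕ.+ b ℕ.+ c) ≡ (y ℕ.+ a) ℕ.+ (x ℕ.+ c) ℕ.+ (z ℕ.+ b)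
  size₅ x y z a b c = s l₁ l₂ l₃ , t x y z a b c where
    s : ∀ x y z → x ℕ.+ y ℕ.+ z ≡ y ℕ.+ x ℕ.+ z
    s = ℕ-Ring.solve-∀
    t : ∀ x y z a b c → x ℕ.+ y ℕ.+ z ℕ.+ (a ℕ.+ b ℕ.+ c) ≡ (y ℕ.+ a) ℕ.+ (x ℕ.+ c) ℕ.+ (z ℕ.+ b)
    t = ℕ-Ring.solve-∀
  size₆ : ∀ x y z a b c →
    l₁ ℕ.+ l₂ ℕ.+ l₃ ≡ l₃ ℕ.+ l₁ ℕ.+ l₂ × x ℕ.+ y ℕ.+ z ℕ.+ (a ℕ.+ b ℕ.+ c) ≡ (z ℕ.+ a) ℕ.+ (x ℕ.+ c) ℕ.+ (y ℕ.+ b)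
  size₆ x y z a b c = s l₁ l₂ l₃ , t x y z a b c where
    s : ∀ x y z → x ℕ.+ y ℕ.+ z ≡ z ℕ.+ x ℕ.+ y
    s = ℕ-Ring.solve-∀
    t : ∀ x y z a b c → x ℕ.+ y ℕ.+ z ℕ.+ (a ℕ.+ b ℕ.+ c) ≡ (z ℕ.+ a) ℕ.+ (x ℕ.+ c) ℕ.+ (y ℕ.+ b)
    t = ℕ-Ring.solve-∀

∑-slice : ∀ (xs : List A) R T (Φ : A → Test) →
  ∑ xs (λ m → slice R T (Φ m)) ≡ slice R T (λ a b c → ∑ xs (λ m → Φ m a b c))
∑-slice xs R T Φ =
  trans (∑-swap xs (upTo R) _) (∑-cong (upTo R) λ a →
  trans (∑-swap xs (upTo R) _) (∑-cong (upTo R) λ b →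
  trans (∑-swap xs (upTo R) _) (∑-cong (upTo R) λ c →
  ∑-* xs (𝟙 (a ℕ.+ b ℕ.+ c ℕ.≟ T)) _)))

module _ (lam μ ν : Partition) (lam≤3 : ℓ lam ≤ 3) (μ≤3 : ℓ μ ≤ 3) (ν≤3 : ℓ ν ≤ 3) where
  private
    l₁ = 2 ℕ.+ lam ₁
    l₂ = 1 ℕ.+ lam ₂
    l₃ = lam ₃
    r = μ ₃
    n₁ = r ℕ.+ (2 ℕ.+ ν ₁)
    n₂ = r ℕ.+ (1 ℕ.+ ν ₂)
    n₃ = r ℕ.+ ν ₃
    p = μ ₁ ℕ.∸ μ ₃
    -- The degree of (x₁x₂x₃)^r a_(ν+ρ) h_p; the 3 is the degree of a_ρ.
    T = r ℕ.+ r ℕ.+ r ℕ.+ ∣ ν ∣₃ ℕ.+ (3 ℕ.+ p)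

    μ₁≡ : μ ₁ ≡ p ℕ.+ r
    μ₁≡ = sym (ℕₚ.m∸n+n≡m (ℕₚ.≤-trans (κ₃≤κ₂ μ) (κ₂≤κ₁ μ)))

    shifted : ℕ → ℕ → ℕ → Test
    shifted a b c i j k = box a b c (r ℕ.+ i) (r ℕ.+ j) (r ℕ.+ k)

    Alt-shift : ∀ q x y z φ →
      Alt (2 ℕ.+ (q ℕ.+ r)) (1 ℕ.+ r) r (translate x y z φ) ≡
      Alt (2 ℕ.+ q) 1 0 (translate (x ℕ.+ r) (y ℕ.+ r) (z ℕ.+ r) φ)
    Alt-shift q x y z φ = Alt-cong (2 ℕ.+ q) 1 0 {λ i j k → φ (x ℕ.+ (i ℕ.+ r)) (y ℕ.+ (j ℕ.+ r)) (z ℕ.+ (k ℕ.+ r))}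
      λ i j k → cong₃ φ (rotate x i r) (rotate y j r) (rotate z k r)
      where
      rotate : ∀ x i r → x ℕ.+ (i ℕ.+ r) ≡ x ℕ.+ r ℕ.+ i
      rotate = ℕ-Ring.solve-∀

    Φ : ℕ → ℕ → ℕ → Test
    Φ x y z a b c = box l₁ l₂ l₃ a b c * Alt 2 1 0 (translate x y z (shifted a b c))

    pieri-shifted : ∀ {R} q x y z → l₁ < R → l₂ < R → l₃ < R → x ℕ.+ y ℕ.+ z ≡ ∣ ν ∣₃ →
      Alt (2 ℕ.+ (q ℕ.+ r)) (1 ℕ.+ r) r (translate x y z (box l₁ l₂ l₃)) ≡
      slice R (r ℕ.+ r ℕ.+ r ℕ.+ ∣ ν ∣₃ ℕ.+ (3 ℕ.+ q)) (Φ x y z)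
    pieri-shifted {R} q x y z l₁<R l₂<R l₃<R size = begin
      Alt (2 ℕ.+ (q ℕ.+ r)) (1 ℕ.+ r) r (translate x y z (box l₁ l₂ l₃))
        ≡⟨ Alt-shift q x y z (box l₁ l₂ l₃) ⟩
      Alt (2 ℕ.+ q) 1 0 (translate (x ℕ.+ r) (y ℕ.+ r) (z ℕ.+ r) (box l₁ l₂ l₃))
        ≡⟨ sym (pieri R q (x ℕ.+ r) (y ℕ.+ r) (z ℕ.+ r) l₁ l₂ l₃ l₁<R l₂<R l₃<R) ⟩
      slice R _ (λ a b c → box l₁ l₂ l₃ a b c * Alt 2 1 0 (translate (x ℕ.+ r) (y ℕ.+ r) (z ℕ.+ r) (box a b c)))
        ≡⟨ cong (λ t → slice R (t ℕ.+ (3 ℕ.+ q)) (λ a b c →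
             box l₁ l₂ l₃ a b c * Alt 2 1 0 (translate (x ℕ.+ r) (y ℕ.+ r) (z ℕ.+ r) (box a b c))))
             (trans (regroup x y z r) (cong (r ℕ.+ r ℕ.+ r ℕ.+_) size)) ⟩
      slice R _ (λ a b c → box l₁ l₂ l₃ a b c * Alt 2 1 0 (translate (x ℕ.+ r) (y ℕ.+ r) (z ℕ.+ r) (box a b c)))
        ≡⟨ slice-cong R _ (λ a b c → cong (box l₁ l₂ l₃ a b c *_) (Alt-cong 2 1 0 λ i j k →
             cong₃ (box a b c) (rotate x r i) (rotate y r j) (rotate z r k))) ⟩
      slice R _ (Φ x y z) ∎
      where
      regroup : ∀ x y z r → x ℕ.+ r ℕ.+ (y ℕ.+ r) ℕ.+ (z ℕ.+ r) ≡ r ℕ.+ r ℕ.+ r ℕ.+ (x ℕ.+ y ℕ.+ z)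
      regroup = ℕ-Ring.solve-∀
      rotate : ∀ x r i → x ℕ.+ r ℕ.+ i ≡ r ℕ.+ (x ℕ.+ i)
      rotate = ℕ-Ring.solve-∀

    -- The coefficient of x^(λ+ρ) in (x₁x₂x₃)^r a_(ν+ρ) h_i h_j, where (a, b, c) is the exponent
    -- reached after the factor h_i and `T` is its degree; i and j are determined by the degrees.
    N : ℕ → ℕ → ℤ
    N R T = slice R T (λ a b c → box l₁ l₂ l₃ a b c * Alt n₁ n₂ n₃ (box a b c))

    -- `pieri-shifted` has split the alternant at each monomial of s_ν into a slice and a factor
    -- a_ρ; summed over the tableaux, these factors give a_ρ s_ν = a_(ν+ρ).
    collapse : ∀ R T → ∑ (schur 3 ν) (at λ x y z → slice R T (Φ x y z)) ≡ N R T
    collapse R T = begin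
      ∑ (schur 3 ν) (at λ x y z → slice R T (Φ x y z))
        ≡⟨ ∑-cong (schur 3 ν) (λ { (x ∷ y ∷ z ∷ []) → refl }) ⟩
      ∑ (schur 3 ν) (λ m → slice R T (λ a b c → at (λ x y z → Φ x y z a b c) m))
        ≡⟨ ∑-slice (schur 3 ν) R T _ ⟩
      slice R T (λ a b c → ∑ (schur 3 ν) (at λ x y z → Φ x y z a b c))
        ≡⟨ slice-cong R T (λ a b c → begin
             ∑ (schur 3 ν) (at λ x y z → Φ x y z a b c)
               ≡⟨ ∑-cong (schur 3 ν) (λ { (x ∷ y ∷ z ∷ []) → refl }) ⟩
             ∑ (schur 3 ν) (λ m → box l₁ l₂ l₃ a b c * at (vandermonde (shifted a b c)) m)
               ≡⟨ ∑-* (schur 3 ν) (box l₁ l₂ l₃ a b c) _ ⟩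
             box l₁ l₂ l₃ a b c * ∑ (schur 3 ν) (at (vandermonde (shifted a b c)))
               ≡⟨ cong (box l₁ l₂ l₃ a b c *_) (schur-bialternant ν ν≤3 (shifted a b c)) ⟩
             box l₁ l₂ l₃ a b c * Alt n₁ n₂ n₃ (box a b c) ∎) ⟩
      N R T ∎

  LR-difference : ∀ {c} → IsLRCoefficient lam μ ν c → ∣ lam ∣₃ ≡ ∣ μ ∣₃ ℕ.+ ∣ ν ∣₃ →
    ∀ R → l₁ < R → l₂ < R → l₃ < R → c ≡ N R T - N R (suc T)
  LR-difference {c} isLR size R l₁<R l₂<R l₃<R = begin
    c
      ≡⟨ LR-alternating lam μ ν lam≤3 μ≤3 isLR ⟩
    ∑ (schur 3 ν) (at λ x y z → Alt (2 ℕ.+ μ ₁) (1 ℕ.+ μ ₂) (μ ₃) (translate x y z (point l₁ l₂ l₃)))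
      ≡⟨ schur-cong ν ν≤3 (λ x y z size′ → trans
           (jacobi-trudi (μ ₁) (μ ₂) (μ ₃) x y z l₁ l₂ l₃ (κ₃≤κ₂ μ) (total x y z size′))
           (cong₂ _-_
             (trans (cong (λ m → Alt (2 ℕ.+ m) (1 ℕ.+ r) r (translate x y z (box l₁ l₂ l₃))) μ₁≡)
                    (pieri-shifted p x y z l₁<R l₂<R l₃<R size′))
             (trans (cong (λ m → Alt (3 ℕ.+ m) (1 ℕ.+ r) r (translate x y z (box l₁ l₂ l₃))) μ₁≡)
                    (trans (pieri-shifted (suc p) x y z l₁<R l₂<R l₃<R size′)
                           (cong (λ t → slice R t (Φ x y z)) (ℕₚ.+-suc (r ℕ.+ r ℕ.+ r ℕ.+ ∣ ν ∣₃) (3 ℕ.+ p))))))) ⟩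
    ∑ (schur 3 ν) (at λ x y z → slice R T (Φ x y z) - slice R (suc T) (Φ x y z))
      ≡⟨ ∑-cong (schur 3 ν) (λ { (x ∷ y ∷ z ∷ []) → refl }) ⟩
    ∑ (schur 3 ν) (λ m → at (λ x y z → slice R T (Φ x y z)) m - at (λ x y z → slice R (suc T) (Φ x y z)) m)
      ≡⟨ ∑-- (schur 3 ν) _ _ ⟩
    ∑ (schur 3 ν) (at λ x y z → slice R T (Φ x y z)) - ∑ (schur 3 ν) (at λ x y z → slice R (suc T) (Φ x y z))
      ≡⟨ cong₂ _-_ (collapse R T) (collapse R (suc T)) ⟩
    N R T - N R (suc T) ∎
    where
    total : ∀ x y z → x ℕ.+ y ℕ.+ z ≡ ∣ ν ∣₃ →
      x ℕ.+ y ℕ.+ z ℕ.+ (2 ℕ.+ μ ₁ ℕ.+ (1 ℕ.+ μ ₂) ℕ.+ μ ₃) ≡ l₁ ℕ.+ l₂ ℕ.+ l₃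
    total x y z size′ = begin
      x ℕ.+ y ℕ.+ z ℕ.+ (2 ℕ.+ μ ₁ ℕ.+ (1 ℕ.+ μ ₂) ℕ.+ μ ₃)
        ≡⟨ cong₂ ℕ._+_ size′ (regroup (μ ₁) (μ ₂) (μ ₃)) ⟩
      ∣ ν ∣₃ ℕ.+ (3 ℕ.+ ∣ μ ∣₃)
        ≡⟨ exchange (∣ ν ∣₃) (∣ μ ∣₃) ⟩
      3 ℕ.+ (∣ μ ∣₃ ℕ.+ ∣ ν ∣₃)
        ≡⟨ cong (3 ℕ.+_) (sym size) ⟩
      3 ℕ.+ ∣ lam ∣₃
        ≡⟨ sym (regroup (lam ₁) (lam ₂) (lam ₃)) ⟩
      l₁ ℕ.+ l₂ ℕ.+ l₃ ∎
      where
      regroup : ∀ a b c → 2 ℕ.+ a ℕ.+ (1 ℕ.+ b) ℕ.+ c ≡ 3 ℕ.+ (a ℕ.+ b ℕ.+ c)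
      regroup = ℕ-Ring.solve-∀
      exchange : ∀ a b → a ℕ.+ (3 ℕ.+ b) ≡ 3 ℕ.+ (b ℕ.+ a)
      exchange = ℕ-Ring.solve-∀

  -- All exponents of a_(μ+ρ) s_ν have size 3 + |μ| + |ν|, while λ+ρ has size 3 + |λ|.
  LR-size : ∀ {c} → IsLRCoefficient lam μ ν c → ∣ lam ∣₃ ≢ ∣ μ ∣₃ ℕ.+ ∣ ν ∣₃ → c ≡ 0ℤ
  LR-size {c} isLR size≢ = begin
    c
      ≡⟨ LR-alternating lam μ ν lam≤3 μ≤3 isLR ⟩
    ∑ (schur 3 ν) (at λ x y z → Alt m₁ m₂ m₃ (translate x y z (point l₁ l₂ l₃)))
      ≡⟨ schur-cong ν ν≤3 {ψ = λ _ _ _ → 0ℤ} (λ x y z size → vanish x y z size) ⟩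
    ∑ (schur 3 ν) (at λ _ _ _ → 0ℤ)
      ≡⟨ ∑-zero (schur 3 ν) (λ { (_ ∷ _ ∷ _ ∷ []) → refl }) ⟩
    0ℤ ∎
    where
    m₁ = 2 ℕ.+ μ ₁
    m₂ = 1 ℕ.+ μ ₂
    m₃ = μ ₃
    point-size : ∀ {x y z} i j k → x ℕ.+ y ℕ.+ z ≡ ∣ ν ∣₃ → i ℕ.+ j ℕ.+ k ≡ 3 ℕ.+ ∣ μ ∣₃ →
      translate x y z (point l₁ l₂ l₃) i j k ≡ 0ℤ
    point-size {x} {y} {z} i j k size₁ size₂ = point-zero {l₁} {l₂} {l₃} {x ℕ.+ i} {y ℕ.+ j} {z ℕ.+ k}
      λ e₁ e₂ e₃ → size≢ (ℕₚ.+-cancelˡ-≡ 3 _ _ (begin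
        3 ℕ.+ ∣ lam ∣₃                             ≡⟨ regroup₁ (lam ₁) (lam ₂) (lam ₃) ⟩
        l₁ ℕ.+ l₂ ℕ.+ l₃                           ≡⟨ cong₂ ℕ._+_ (cong₂ ℕ._+_ (sym e₁) (sym e₂)) (sym e₃) ⟩
        x ℕ.+ i ℕ.+ (y ℕ.+ j) ℕ.+ (z ℕ.+ k)        ≡⟨ regroup₂ x y z i j k ⟩
        i ℕ.+ j ℕ.+ k ℕ.+ (x ℕ.+ y ℕ.+ z)          ≡⟨ cong₂ ℕ._+_ size₂ size₁ ⟩
        3 ℕ.+ (∣ μ ∣₃ ℕ.+ ∣ ν ∣₃)                  ∎))
      where
      regroup₁ : ∀ a b c → 3 ℕ.+ (a ℕ.+ b ℕ.+ c) ≡ 2 ℕ.+ a ℕ.+ (1 ℕ.+ b) ℕ.+ c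
      regroup₁ = ℕ-Ring.solve-∀
      regroup₂ : ∀ x y z i j k → x ℕ.+ i ℕ.+ (y ℕ.+ j) ℕ.+ (z ℕ.+ k) ≡ i ℕ.+ j ℕ.+ k ℕ.+ (x ℕ.+ y ℕ.+ z)
      regroup₂ = ℕ-Ring.solve-∀
    e₁ : ∀ a b c → 2 ℕ.+ a ℕ.+ (1 ℕ.+ b) ℕ.+ c ≡ 3 ℕ.+ (a ℕ.+ b ℕ.+ c)
    e₁ = ℕ-Ring.solve-∀
    e₂ : ∀ a b c → 2 ℕ.+ a ℕ.+ c ℕ.+ (1 ℕ.+ b) ≡ 3 ℕ.+ (a ℕ.+ b ℕ.+ c)
    e₂ = ℕ-Ring.solve-∀
    e₃ : ∀ a b c → 1 ℕ.+ b ℕ.+ (2 ℕ.+ a) ℕ.+ c ≡ 3 ℕ.+ (a ℕ.+ b ℕ.+ c)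
    e₃ = ℕ-Ring.solve-∀
    e₄ : ∀ a b c → 1 ℕ.+ b ℕ.+ c ℕ.+ (2 ℕ.+ a) ≡ 3 ℕ.+ (a ℕ.+ b ℕ.+ c)
    e₄ = ℕ-Ring.solve-∀
    e₅ : ∀ a b c → c ℕ.+ (2 ℕ.+ a) ℕ.+ (1 ℕ.+ b) ≡ 3 ℕ.+ (a ℕ.+ b ℕ.+ c)
    e₅ = ℕ-Ring.solve-∀
    e₆ : ∀ a b c → c ℕ.+ (1 ℕ.+ b) ℕ.+ (2 ℕ.+ a) ≡ 3 ℕ.+ (a ℕ.+ b ℕ.+ c)
    e₆ = ℕ-Ring.solve-∀
    vanish : ∀ x y z → x ℕ.+ y ℕ.+ z ≡ ∣ ν ∣₃ → Alt m₁ m₂ m₃ (translate x y z (point l₁ l₂ l₃)) ≡ 0ℤ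
    vanish x y z size
      rewrite point-size {x} {y} {z} m₁ m₂ m₃ size (e₁ (μ ₁) (μ ₂) (μ ₃))
            | point-size {x} {y} {z} m₁ m₃ m₂ size (e₂ (μ ₁) (μ ₂) (μ ₃))
            | point-size {x} {y} {z} m₂ m₁ m₃ size (e₃ (μ ₁) (μ ₂) (μ ₃))
            | point-size {x} {y} {z} m₂ m₃ m₁ size (e₄ (μ ₁) (μ ₂) (μ ₃))
            | point-size {x} {y} {z} m₃ m₁ m₂ size (e₅ (μ ₁) (μ ₂) (μ ₃))
            | point-size {x} {y} {z} m₃ m₂ m₁ size (e₆ (μ ₁) (μ ₂) (μ ₃)) = refl

-- Interlacing

-- Half-open, so that neighbouring intervals share an endpoint; the price is a `suc` at each bound
-- coming from λ.
within : ℕ → ℕ → ℕ → ℤ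
within lo hi x = 𝟙 (lo ℕ.≤? x ×-dec x ℕ.<? hi)

threshold-split : ∀ {lo hi} x → lo ≤ hi → 𝟙 (lo ℕ.≤? x) ≡ 𝟙 (hi ℕ.≤? x) + within lo hi x
threshold-split {lo} {hi} x lo≤hi with hi ℕ.≤? x
... | yes hi≤x = trans (𝟙-yes (lo ℕ.≤? x) (ℕₚ.≤-trans lo≤hi hi≤x))
                       (cong (_+_ 1ℤ) (sym (𝟙-no (lo ℕ.≤? x ×-dec x ℕ.<? hi) λ (_ , x<hi) → ℕₚ.<⇒≱ x<hi hi≤x)))
... | no  hi≰x = trans (𝟙-cong (lo ℕ.≤? x) (lo ℕ.≤? x ×-dec x ℕ.<? hi) (_, ℕₚ.≰⇒> hi≰x) proj₁)
                       (sym (+-identityˡ _))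

below-split : ∀ {l l′} x → l ≤ l′ → below l′ x ≡ below l x + within (suc l) (suc l′) x
below-split {l} {l′} x l≤l′ with x ℕ.≤? l
... | yes x≤l = trans (𝟙-yes (x ℕ.≤? l′) (ℕₚ.≤-trans x≤l l≤l′))
                      (cong (_+_ 1ℤ) (sym (𝟙-no (suc l ℕ.≤? x ×-dec x ℕ.<? suc l′) λ (l<x , _) → ℕₚ.<⇒≱ l<x x≤l)))
... | no  x≰l = trans (𝟙-cong (x ℕ.≤? l′) (suc l ℕ.≤? x ×-dec x ℕ.<? suc l′)
                        (λ x≤l′ → ℕₚ.≰⇒> x≰l , s≤s x≤l′) (ℕ.s≤s⁻¹ ∘ proj₂))
                      (sym (+-identityˡ _))

-- Lindström–Gessel–Viennot cancellation: both determinants collapse to interlacing conditions.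
lgv : ∀ R T {n₁ n₂ n₃ l₁ l₂ l₃} → n₂ < n₁ → n₃ < n₂ → l₂ < l₁ → l₃ < l₂ →
  slice R T (λ a b c → box l₁ l₂ l₃ a b c * Alt n₁ n₂ n₃ (box a b c)) ≡
  slice R T (product (within (n₁ ℕ.⊔ suc l₂) (suc l₁)) (within (n₂ ℕ.⊔ suc l₃) (n₁ ℕ.⊓ suc l₂)) (within n₃ (n₂ ℕ.⊓ suc l₃)))
lgv R T {n₁} {n₂} {n₃} {l₁} {l₂} {l₃} n₂<n₁ n₃<n₂ l₂<l₁ l₃<l₂ = begin
  slice R T (λ a b c → box l₁ l₂ l₃ a b c * Alt n₁ n₂ n₃ (box a b c))
    ≡⟨ slice-det R T g₁ g₂ g₃ e₁ e₂ e₃ e₁ e₂ e₃ e₁ e₂ e₃ U U U n₁ n₂ n₃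
         (λ _ → refl) column₂ column₃ (λ _ → refl) column₂ column₃ (λ _ → refl) column₂ column₃ ⟩
  alternate (S (g₁ · e₁) (g₂ · e₂) (g₃ · e₃)) (S (g₁ · e₁) (g₂ · e₃) (g₃ · e₂))
            (S (g₁ · e₂) (g₂ · e₁) (g₃ · e₃)) (S (g₁ · e₂) (g₂ · e₃) (g₃ · e₁))
            (S (g₁ · e₃) (g₂ · e₁) (g₃ · e₂)) (S (g₁ · e₃) (g₂ · e₂) (g₃ · e₁))
    -- A slice is symmetric in its coordinates. Sorting the factors `e₁`, `e₂`, `e₃` moves each
    -- permutation onto `g₁`, `g₂`, `g₃`, so that a second determinant, in the thresholds of λ,
    -- appears under fixed `e`.
    ≡⟨ alternate-cong {a = S (g₁ · e₁) (g₂ · e₂) (g₃ · e₃)} refl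
         (slice-swap₂₃ R T (g₁ · e₁) (g₂ · e₃) (g₃ · e₂))
         (slice-swap₁₂ R T (g₁ · e₂) (g₂ · e₁) (g₃ · e₃))
         (trans (slice-swap₂₃ R T (g₁ · e₂) (g₂ · e₃) (g₃ · e₁)) (slice-swap₁₂ R T (g₁ · e₂) (g₃ · e₁) (g₂ · e₃)))
         (trans (slice-swap₁₂ R T (g₁ · e₃) (g₂ · e₁) (g₃ · e₂)) (slice-swap₂₃ R T (g₂ · e₁) (g₁ · e₃) (g₃ · e₂)))
         (trans (slice-swap₁₂ R T (g₁ · e₃) (g₂ · e₂) (g₃ · e₁))
           (trans (slice-swap₂₃ R T (g₂ · e₂) (g₁ · e₃) (g₃ · e₁)) (slice-swap₁₂ R T (g₂ · e₂) (g₃ · e₁) (g₁ · e₃)))) ⟩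
  alternate (S (g₁ · e₁) (g₂ · e₂) (g₃ · e₃)) (S (g₁ · e₁) (g₃ · e₂) (g₂ · e₃))
            (S (g₂ · e₁) (g₁ · e₂) (g₃ · e₃)) (S (g₃ · e₁) (g₁ · e₂) (g₂ · e₃))
            (S (g₂ · e₁) (g₃ · e₂) (g₁ · e₃)) (S (g₃ · e₁) (g₂ · e₂) (g₁ · e₃))
    ≡⟨ sym (slice-alternate R T
         (product (g₁ · e₁) (g₂ · e₂) (g₃ · e₃)) (product (g₁ · e₁) (g₃ · e₂) (g₂ · e₃))
         (product (g₂ · e₁) (g₁ · e₂) (g₃ · e₃)) (product (g₃ · e₁) (g₁ · e₂) (g₂ · e₃))
         (product (g₂ · e₁) (g₃ · e₂) (g₁ · e₃)) (product (g₃ · e₁) (g₂ · e₂) (g₁ · e₃))) ⟩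
  slice R T (λ x y z → alternate
         (product (g₁ · e₁) (g₂ · e₂) (g₃ · e₃) x y z) (product (g₁ · e₁) (g₃ · e₂) (g₂ · e₃) x y z)
         (product (g₂ · e₁) (g₁ · e₂) (g₃ · e₃) x y z) (product (g₃ · e₁) (g₁ · e₂) (g₂ · e₃) x y z)
         (product (g₂ · e₁) (g₃ · e₂) (g₁ · e₃) x y z) (product (g₃ · e₁) (g₂ · e₂) (g₁ · e₃) x y z))
    ≡⟨ slice-cong R T pointwise ⟩
  slice R T (product (within (n₁ ℕ.⊔ suc l₂) (suc l₁)) (within (n₂ ℕ.⊔ suc l₃) (n₁ ℕ.⊓ suc l₂)) (within n₃ (n₂ ℕ.⊓ suc l₃))) ∎
  where
  S : (f g h : ℕ → ℤ) → ℤ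
  S f g h = slice R T (product f g h)
  g₁ g₂ g₃ e₁ e₂ e₃ c₁ c₂ c₃ : ℕ → ℤ
  g₁ = below l₁
  g₂ = below l₂
  g₃ = below l₃
  e₁ x = 𝟙 (n₁ ℕ.≤? x)
  e₂ = within n₂ n₁
  e₃ = within n₃ n₂
  c₁ = within (suc l₂) (suc l₁)
  c₂ = within (suc l₃) (suc l₂)
  c₃ = below l₃
  U : ℕ → ℕ → ℤ
  U i x = below x i
  column₂ : ∀ x → U n₂ x ≡ e₁ x + e₂ x
  column₂ x = threshold-split x (ℕₚ.<⇒≤ n₂<n₁)
  column₃ : ∀ x → U n₃ x ≡ e₁ x + e₂ x + e₃ x
  column₃ x = trans (threshold-split x (ℕₚ.<⇒≤ n₃<n₂)) (cong (_+ e₃ x) (column₂ x))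
  row₂ : ∀ x → g₂ x ≡ c₃ x + c₂ x
  row₂ x = below-split x (ℕₚ.<⇒≤ l₃<l₂)
  row₁ : ∀ x → g₁ x ≡ c₃ x + c₂ x + c₁ x
  row₁ x = trans (below-split x (ℕₚ.<⇒≤ l₂<l₁)) (cong (_+ c₁ x) (row₂ x))
  column-ops : ∀ e f g a₁ a₂ a₃ b₁ b₂ b₃ c₁ c₂ c₃ →
      ((a₃ + a₂ + a₁) * e) * ((b₃ + b₂) * f) * (c₃ * g) - ((a₃ + a₂ + a₁) * e) * (b₃ * f) * ((c₃ + c₂) * g)
    - ((a₃ + a₂) * e) * ((b₃ + b₂ + b₁) * f) * (c₃ * g) + (a₃ * e) * ((b₃ + b₂ + b₁) * f) * ((c₃ + c₂) * g)
    + ((a₃ + a₂) * e) * (b₃ * f) * ((c₃ + c₂ + c₁) * g) - (a₃ * e) * ((b₃ + b₂) * f) * ((c₃ + c₂ + c₁) * g) ≡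
      e * f * g * (a₁ * b₂ * c₃) - e * f * g * (a₁ * b₃ * c₂) - e * f * g * (a₂ * b₁ * c₃)
    + e * f * g * (a₃ * b₁ * c₂) + e * f * g * (a₂ * b₃ * c₁) - e * f * g * (a₃ * b₂ * c₁)
  column-ops = solve-∀
  column-ops′ : ∀ e f g a₁ a₂ a₃ b₁ b₂ b₃ c₁ c₂ c₃ {A₁ A₂ B₁ B₂ C₁ C₂} →
    A₁ ≡ a₃ + a₂ + a₁ → A₂ ≡ a₃ + a₂ → B₁ ≡ b₃ + b₂ + b₁ → B₂ ≡ b₃ + b₂ → C₁ ≡ c₃ + c₂ + c₁ → C₂ ≡ c₃ + c₂ →
    alternate ((A₁ * e) * (B₂ * f) * (c₃ * g)) ((A₁ * e) * (b₃ * f) * (C₂ * g))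
              ((A₂ * e) * (B₁ * f) * (c₃ * g)) ((a₃ * e) * (B₁ * f) * (C₂ * g))
              ((A₂ * e) * (b₃ * f) * (C₁ * g)) ((a₃ * e) * (B₂ * f) * (C₁ * g)) ≡
    alternate (e * f * g * (a₁ * b₂ * c₃)) (e * f * g * (a₁ * b₃ * c₂)) (e * f * g * (a₂ * b₁ * c₃))
              (e * f * g * (a₃ * b₁ * c₂)) (e * f * g * (a₂ * b₃ * c₁)) (e * f * g * (a₃ * b₂ * c₁))
  column-ops′ e f g a₁ a₂ a₃ b₁ b₂ b₃ c₁ c₂ c₃ refl refl refl refl refl refl =
    column-ops e f g a₁ a₂ a₃ b₁ b₂ b₃ c₁ c₂ c₃
  vanish : ∀ {P₁ P₂ P₃ Q₁ Q₂ Q₃ : Set} (d₁ : Dec P₁) (d₂ : Dec P₂) (d₃ : Dec P₃)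
    (f₁ : Dec Q₁) (f₂ : Dec Q₂) (f₃ : Dec Q₃) → (P₁ → P₂ → P₃ → Q₁ → Q₂ → Q₃ → ⊥) →
    𝟙 d₁ * 𝟙 d₂ * 𝟙 d₃ * (𝟙 f₁ * 𝟙 f₂ * 𝟙 f₃) ≡ 0ℤ
  vanish d₁ d₂ d₃ f₁ f₂ f₃ h
    rewrite sym (𝟙-× d₁ d₂) | sym (𝟙-× (d₁ ×-dec d₂) d₃) | sym (𝟙-× f₁ f₂) | sym (𝟙-× (f₁ ×-dec f₂) f₃)
          | sym (𝟙-× ((d₁ ×-dec d₂) ×-dec d₃) ((f₁ ×-dec f₂) ×-dec f₃)) =
    𝟙-no (((d₁ ×-dec d₂) ×-dec d₃) ×-dec ((f₁ ×-dec f₂) ×-dec f₃))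
      λ (((p₁ , p₂) , p₃) , ((q₁ , q₂) , q₃)) → h p₁ p₂ p₃ q₁ q₂ q₃
  merge : ∀ {lo hi lo′ hi′} x → within lo hi x * within lo′ hi′ x ≡ within (lo ℕ.⊔ lo′) (hi ℕ.⊓ hi′) x
  merge {lo} {hi} {lo′} {hi′} x =
    trans (sym (𝟙-× (lo ℕ.≤? x ×-dec x ℕ.<? hi) (lo′ ℕ.≤? x ×-dec x ℕ.<? hi′)))
      (𝟙-cong ((lo ℕ.≤? x ×-dec x ℕ.<? hi) ×-dec (lo′ ℕ.≤? x ×-dec x ℕ.<? hi′))
              (lo ℕ.⊔ lo′ ℕ.≤? x ×-dec x ℕ.<? hi ℕ.⊓ hi′)
        (λ ((a , b) , (c , d)) → ℕₚ.⊔-lub a c , ℕₚ.⊓-glb b d)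
        (λ (a , b) → (ℕₚ.m⊔n≤o⇒m≤o lo lo′ a , ℕₚ.m≤n⊓o⇒m≤n hi hi′ b)
                   , (ℕₚ.m⊔n≤o⇒n≤o lo lo′ a , ℕₚ.m≤n⊓o⇒m≤o hi hi′ b)))
  merge₁ : ∀ x → e₁ x * c₁ x ≡ within (n₁ ℕ.⊔ suc l₂) (suc l₁) x
  merge₁ x = trans (sym (𝟙-× (n₁ ℕ.≤? x) (suc l₂ ℕ.≤? x ×-dec x ℕ.<? suc l₁)))
    (𝟙-cong (n₁ ℕ.≤? x ×-dec (suc l₂ ℕ.≤? x ×-dec x ℕ.<? suc l₁)) (n₁ ℕ.⊔ suc l₂ ℕ.≤? x ×-dec x ℕ.<? suc l₁)
      (λ (a , (b , c)) → ℕₚ.⊔-lub a b , c)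
      (λ (a , c) → ℕₚ.m⊔n≤o⇒m≤o n₁ (suc l₂) a , (ℕₚ.m⊔n≤o⇒n≤o n₁ (suc l₂) a , c)))
  merge₃ : ∀ x → e₃ x * c₃ x ≡ within n₃ (n₂ ℕ.⊓ suc l₃) x
  merge₃ x = trans (sym (𝟙-× (n₃ ℕ.≤? x ×-dec x ℕ.<? n₂) (x ℕ.≤? l₃)))
    (𝟙-cong ((n₃ ℕ.≤? x ×-dec x ℕ.<? n₂) ×-dec x ℕ.≤? l₃) (n₃ ℕ.≤? x ×-dec x ℕ.<? n₂ ℕ.⊓ suc l₃)
      (λ ((a , b) , c) → a , ℕₚ.⊓-glb b (s≤s c))
      (λ (a , b) → (a , ℕₚ.m≤n⊓o⇒m≤n n₂ (suc l₃) b) , ℕ.s≤s⁻¹ (ℕₚ.m≤n⊓o⇒m≤o n₂ (suc l₃) b)))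
  -- Every other permutation has an inversion, which contradicts x > y > z.
  pointwise : ∀ x y z → alternate
      (product (g₁ · e₁) (g₂ · e₂) (g₃ · e₃) x y z) (product (g₁ · e₁) (g₃ · e₂) (g₂ · e₃) x y z)
      (product (g₂ · e₁) (g₁ · e₂) (g₃ · e₃) x y z) (product (g₃ · e₁) (g₁ · e₂) (g₂ · e₃) x y z)
      (product (g₂ · e₁) (g₃ · e₂) (g₁ · e₃) x y z) (product (g₃ · e₁) (g₂ · e₂) (g₁ · e₃) x y z) ≡
    product (within (n₁ ℕ.⊔ suc l₂) (suc l₁)) (within (n₂ ℕ.⊔ suc l₃) (n₁ ℕ.⊓ suc l₂)) (within n₃ (n₂ ℕ.⊓ suc l₃)) x y z
  pointwise x y z = begin
    -- The same operation as in `slice-det`, now on the nested thresholds `g₃`, `g₂`, `g₁`: their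
    -- increments `c₃`, `c₂`, `c₁` live on disjoint intervals.
    _ ≡⟨ column-ops′ (e₁ x) (e₂ y) (e₃ z) (c₁ x) (c₂ x) (c₃ x) (c₁ y) (c₂ y) (c₃ y) (c₁ z) (c₂ z) (c₃ z)
           (row₁ x) (row₂ x) (row₁ y) (row₂ y) (row₁ z) (row₂ z) ⟩
    alternate (e₁ x * e₂ y * e₃ z * (c₁ x * c₂ y * c₃ z)) (e₁ x * e₂ y * e₃ z * (c₁ x * c₃ y * c₂ z))
              (e₁ x * e₂ y * e₃ z * (c₂ x * c₁ y * c₃ z)) (e₁ x * e₂ y * e₃ z * (c₃ x * c₁ y * c₂ z))
              (e₁ x * e₂ y * e₃ z * (c₂ x * c₃ y * c₁ z)) (e₁ x * e₂ y * e₃ z * (c₃ x * c₂ y * c₁ z))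
      ≡⟨ alternate-cong {a = e₁ x * e₂ y * e₃ z * (c₁ x * c₂ y * c₃ z)} refl
           (vanish d₁ d₂ d₃ (within₁? x) (below? y) (within₂? z)
             λ n₁≤x (n₂≤y , y<n₁) (n₃≤z , z<n₂) _ y≤l₃ (l₃<z , _) → ordered (ℕₚ.<-≤-trans z<n₂ n₂≤y) y≤l₃ l₃<z)
           (vanish d₁ d₂ d₃ (within₂? x) (within₁? y) (below? z)
             λ n₁≤x (n₂≤y , y<n₁) (n₃≤z , z<n₂) (_ , x<) (l₂<y , _) _ → ordered (ℕₚ.<-≤-trans y<n₁ n₁≤x) (ℕ.s≤s⁻¹ x<) l₂<y)
           (vanish d₁ d₂ d₃ (below? x) (within₁? y) (within₂? z)
             λ n₁≤x (n₂≤y , y<n₁) (n₃≤z , z<n₂) x≤l₃ (l₂<y , _) _ →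
               ordered (ℕₚ.<-≤-trans y<n₁ n₁≤x) x≤l₃ (ℕₚ.<-trans l₃<l₂ l₂<y))
           (vanish d₁ d₂ d₃ (within₂? x) (below? y) (within₁? z)
             λ n₁≤x (n₂≤y , y<n₁) (n₃≤z , z<n₂) _ y≤l₃ (l₂<z , _) →
               ordered (ℕₚ.<-≤-trans z<n₂ n₂≤y) y≤l₃ (ℕₚ.<-trans l₃<l₂ l₂<z))
           (vanish d₁ d₂ d₃ (below? x) (within₂? y) (within₁? z)
             λ n₁≤x (n₂≤y , y<n₁) (n₃≤z , z<n₂) x≤l₃ (l₃<y , _) _ → ordered (ℕₚ.<-≤-trans y<n₁ n₁≤x) x≤l₃ l₃<y) ⟩
    alternate (e₁ x * e₂ y * e₃ z * (c₁ x * c₂ y * c₃ z)) 0ℤ 0ℤ 0ℤ 0ℤ 0ℤ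
      ≡⟨ regroup (e₁ x) (e₂ y) (e₃ z) (c₁ x) (c₂ y) (c₃ z) ⟩
    (e₁ x * c₁ x) * (e₂ y * c₂ y) * (e₃ z * c₃ z)
      ≡⟨ cong₂ _*_ (cong₂ _*_ (merge₁ x) (merge {n₂} {n₁} {suc l₃} {suc l₂} y)) (merge₃ z) ⟩
    product (within (n₁ ℕ.⊔ suc l₂) (suc l₁)) (within (n₂ ℕ.⊔ suc l₃) (n₁ ℕ.⊓ suc l₂)) (within n₃ (n₂ ℕ.⊓ suc l₃)) x y z ∎
    where
    d₁ = n₁ ℕ.≤? x
    d₂ = n₂ ℕ.≤? y ×-dec y ℕ.<? n₁
    d₃ = n₃ ℕ.≤? z ×-dec z ℕ.<? n₂
    within₁? : ∀ x → Dec (suc l₂ ≤ x × x < suc l₁)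
    within₁? x = suc l₂ ℕ.≤? x ×-dec x ℕ.<? suc l₁
    within₂? : ∀ x → Dec (suc l₃ ≤ x × x < suc l₂)
    within₂? x = suc l₃ ℕ.≤? x ×-dec x ℕ.<? suc l₂
    below? : ∀ x → Dec (x ≤ l₃)
    below? x = x ℕ.≤? l₃
    ordered : ∀ {x y l} → y < x → x ≤ l → l < y → ⊥
    ordered y<x x≤l l<y = ℕₚ.<-asym y<x (ℕₚ.≤-<-trans x≤l l<y)
    regroup : ∀ a b c d e f → a * b * c * (d * e * f) - 0ℤ - 0ℤ + 0ℤ + 0ℤ - 0ℤ ≡ (a * d) * (b * e) * (c * f)
    regroup = solve-∀

-- Counting lattice points of a box

within-suc : ∀ lo hi x → within (suc lo) (suc hi) (suc x) ≡ within lo hi x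
within-suc lo hi x = 𝟙-cong (suc lo ℕ.≤? suc x ×-dec suc x ℕ.<? suc hi) (lo ℕ.≤? x ×-dec x ℕ.<? hi)
  (λ (p , q) → ℕ.s≤s⁻¹ p , ℕ.s≤s⁻¹ q) (λ (p , q) → s≤s p , s≤s q)

within-empty : ∀ {lo hi} x → hi ≤ lo → within lo hi x ≡ 0ℤ
within-empty {lo} {hi} x hi≤lo =
  𝟙-no (lo ℕ.≤? x ×-dec x ℕ.<? hi) λ (p , q) → ℕₚ.<⇒≱ q (ℕₚ.≤-trans hi≤lo p)

∑-within : ∀ {R lo hi} (f : ℕ → ℤ) → lo ≤ hi → hi ≤ R →
  ∑ (upTo R) (λ x → within lo hi x * (f (suc x) - f x)) ≡ f hi - f lo
∑-within {R} {zero} {zero} f _ _ =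
  trans (∑-zero (upTo R) (λ x → trans (cong (_* (f (suc x) - f x)) (within-empty x (z≤n {0})))
                                      (ℤₚ.*-zeroˡ (f (suc x) - f x))))
        (sym (ℤₚ.+-inverseʳ (f 0)))
∑-within {suc R} {zero} {suc hi} f _ (s≤s hi≤R) = begin
  ∑ (upTo (suc R)) (λ x → within 0 (suc hi) x * (f (suc x) - f x))
    ≡⟨ upTo-suc R (λ x → within 0 (suc hi) x * (f (suc x) - f x)) ⟩
  1ℤ * (f 1 - f 0) + ∑ (upTo R) (λ x → within 0 (suc hi) (suc x) * (f (suc (suc x)) - f (suc x)))
    ≡⟨ cong (_+_ (1ℤ * (f 1 - f 0))) (trans
         (∑-cong (upTo R) λ x → cong (_* (f (suc (suc x)) - f (suc x)))
           (𝟙-cong (0 ℕ.≤? suc x ×-dec suc x ℕ.<? suc hi) (0 ℕ.≤? x ×-dec x ℕ.<? hi)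
             (λ (_ , q) → z≤n , ℕ.s≤s⁻¹ q) (λ (_ , q) → z≤n , s≤s q)))
         (∑-within (f ∘ suc) z≤n hi≤R)) ⟩
  1ℤ * (f 1 - f 0) + (f (suc hi) - f 1)
    ≡⟨ cancel (f 0) (f 1) (f (suc hi)) ⟩
  f (suc hi) - f 0 ∎
  where
  cancel : ∀ a b c → 1ℤ * (b - a) + (c - b) ≡ c - a
  cancel = solve-∀
∑-within {suc R} {suc lo} {suc hi} f (s≤s lo≤hi) (s≤s hi≤R) =
  trans (upTo-suc R (λ x → within (suc lo) (suc hi) x * (f (suc x) - f x)))
    (trans (cong₂ _+_ (ℤₚ.*-zeroˡ (f 1 - f 0))
             (trans (∑-cong (upTo R) λ x → cong (_* (f (suc (suc x)) - f (suc x))) (within-suc lo hi x))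
                    (∑-within (f ∘ suc) lo≤hi hi≤R)))
           (+-identityˡ _))

∑-within-count : ∀ {R} lo hi → hi ≤ R → ∑ (upTo R) (within lo hi) ≡ + (hi ℕ.∸ lo)
∑-within-count {R} lo hi hi≤R with ℕₚ.≤-total lo hi
... | inj₂ hi≤lo = trans (∑-zero (upTo R) (λ x → within-empty x hi≤lo))
                         (cong +_ (sym (ℕₚ.m≤n⇒m∸n≡0 hi≤lo)))
... | inj₁ lo≤hi = begin
  ∑ (upTo R) (within lo hi)
    ≡⟨ ∑-cong (upTo R) (λ x → sym (trans (cong (within lo hi x *_) (step (+ x))) (ℤₚ.*-identityʳ _))) ⟩
  ∑ (upTo R) (λ x → within lo hi x * (+ suc x - + x))
    ≡⟨ ∑-within +_ lo≤hi hi≤R ⟩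
  + hi - + lo
    ≡⟨ trans (ℤₚ.[+m]-[+n]≡m⊖n hi lo) (ℤₚ.⊖-≥ lo≤hi) ⟩
  + (hi ℕ.∸ lo) ∎
  where
  step : ∀ x → 1ℤ + x - x ≡ 1ℤ
  step = solve-∀

∑-within-shifted : ∀ {R} k t lo hi → hi ≤ R →
  ∑ (upTo R) (λ z → 𝟙 (k ℕ.+ z ℕ.≟ t) * within lo hi z) ≡ 𝟙 (k ℕ.+ lo ℕ.≤? t ×-dec t ℕ.<? k ℕ.+ hi)
∑-within-shifted {R} k t lo hi hi≤R with k ℕ.≤? t
... | no k≰t = trans
  (∑-zero (upTo R) λ z → trans (cong (_* within lo hi z) (𝟙-no (k ℕ.+ z ℕ.≟ t) λ { refl → k≰t (ℕₚ.m≤m+n k z) }))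
                               (ℤₚ.*-zeroˡ (within lo hi z)))
  (sym (𝟙-no (k ℕ.+ lo ℕ.≤? t ×-dec t ℕ.<? k ℕ.+ hi) λ (p , _) → k≰t (ℕₚ.m+n≤o⇒m≤o k p)))
... | yes k≤t = begin
  ∑ (upTo R) (λ z → 𝟙 (k ℕ.+ z ℕ.≟ t) * within lo hi z)
    ≡⟨ ∑-cong (upTo R) (λ z → cong (_* within lo hi z) (𝟙-cong (k ℕ.+ z ℕ.≟ t) (z ℕ.≟ t ℕ.∸ k)
         (λ { refl → sym (ℕₚ.m+n∸m≡n k z) }) (λ { refl → ℕₚ.m+[n∸m]≡n k≤t }))) ⟩
  ∑ (upTo R) (λ z → 𝟙 (z ℕ.≟ t ℕ.∸ k) * within lo hi z)
    ≡⟨ ∑-delta R (t ℕ.∸ k) (within lo hi) ⟩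
  𝟙 (t ℕ.∸ k ℕ.<? R) * within lo hi (t ℕ.∸ k)
    ≡⟨ sym (𝟙-× (t ℕ.∸ k ℕ.<? R) (lo ℕ.≤? t ℕ.∸ k ×-dec t ℕ.∸ k ℕ.<? hi)) ⟩
  𝟙 (t ℕ.∸ k ℕ.<? R ×-dec (lo ℕ.≤? t ℕ.∸ k ×-dec t ℕ.∸ k ℕ.<? hi))
    ≡⟨ 𝟙-cong (t ℕ.∸ k ℕ.<? R ×-dec (lo ℕ.≤? t ℕ.∸ k ×-dec t ℕ.∸ k ℕ.<? hi))
              (k ℕ.+ lo ℕ.≤? t ×-dec t ℕ.<? k ℕ.+ hi)
         (λ (_ , (p , q)) → subst (k ℕ.+ lo ≤_) (ℕₚ.m+[n∸m]≡n k≤t) (ℕₚ.+-monoʳ-≤ k p)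
                          , subst (_< k ℕ.+ hi) (ℕₚ.m+[n∸m]≡n k≤t) (ℕₚ.+-monoʳ-< k q))
         (λ (p , q) → let q′ = ℕₚ.+-cancelˡ-< k _ _ (subst (_< k ℕ.+ hi) (sym (ℕₚ.m+[n∸m]≡n k≤t)) q) in
            ℕₚ.<-≤-trans q′ hi≤R , (ℕₚ.+-cancelˡ-≤ k _ _ (subst (k ℕ.+ lo ≤_) (sym (ℕₚ.m+[n∸m]≡n k≤t)) p) , q′)) ⟩
  𝟙 (k ℕ.+ lo ℕ.≤? t ×-dec t ℕ.<? k ℕ.+ hi) ∎

≤-cancel : ∀ c {a b x y} → x ≤ y → x ≡ c ℕ.+ a → y ≡ c ℕ.+ b → a ≤ b
≤-cancel c {a} {b} x≤y refl refl = ℕₚ.+-cancelˡ-≤ c a b x≤y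

-- A truncated difference with a positive lower bound is a true difference.
≤∸⇒+≤ : ∀ {k m} n → 1 ≤ k → k ≤ m ℕ.∸ n → k ℕ.+ n ≤ m
≤∸⇒+≤ {k} {m} n 1≤k k≤m∸n with ℕₚ.≤-total m n
... | inj₁ m≤n = contradiction (ℕₚ.≤-trans 1≤k (subst (k ≤_) (ℕₚ.m≤n⇒m∸n≡0 m≤n) k≤m∸n)) λ ()
... | inj₂ n≤m = subst (k ℕ.+ n ≤_) (ℕₚ.m∸n+n≡m n≤m) (ℕₚ.+-monoˡ-≤ n k≤m∸n)

-- The pair stands for the integer p - q, which may be negative; this form of k ≤ p - q avoids
-- subtraction.
Gap : ℕ → ℕ × ℕ → Set
Gap k (q , p) = k ℕ.+ q ≤ p

module Box (A₂ B₂ A₃ B₃ u : ℕ) where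

  -- The number of (y,z) ∈ [A₂,B₂) × [A₃,B₃) with s + y + z = u − 1.
  antidiagonalCount : ℕ → ℕ
  antidiagonalCount s = (B₂ ℕ.⊓ (u ℕ.∸ (s ℕ.+ A₃))) ℕ.∸ (A₂ ℕ.⊔ (u ℕ.∸ (s ℕ.+ B₃)))

  -- The smaller of two upper ends minus the larger of two lower ends is the least of four
  -- differences. In order: both ends from the range of y; the upper end from that of z; the lower
  -- end from that of z; both from that of z.
  bounds : ℕ → List (ℕ × ℕ)
  bounds s = (A₂ , B₂) ∷ (s ℕ.+ A₃ ℕ.+ A₂ , u) ∷ (u , B₂ ℕ.+ (s ℕ.+ B₃)) ∷ (A₃ , B₃) ∷ []

  -- For k = 0 a count gives no information while a bound may fail, hence the hypothesis `1 ≤ k`.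
  count⇒bounds : ∀ {k} s → 1 ≤ k → k ≤ antidiagonalCount s → All (Gap k) (bounds s)
  count⇒bounds {k} s 1≤k k≤ =
      ℕₚ.≤-trans k+A₂≤ (ℕₚ.m⊓n≤m B₂ _)
    ∷ subst (_≤ u) (rotate k A₂ s A₃) (≤∸⇒+≤ (s ℕ.+ A₃) (ℕₚ.≤-trans 1≤k (ℕₚ.m≤m+n k A₂))
        (ℕₚ.≤-trans k+A₂≤ (ℕₚ.m⊓n≤n B₂ _)))
    ∷ third (u ℕ.∸ (s ℕ.+ B₃)) (ℕₚ.≤-trans k+m≤ (ℕₚ.m⊓n≤m B₂ _)) u≤
    ∷ fourth (u ℕ.∸ (s ℕ.+ B₃)) (≤∸⇒+≤ (s ℕ.+ A₃) (ℕₚ.≤-trans 1≤k (ℕₚ.m≤m+n k _)) (ℕₚ.≤-trans k+m≤ (ℕₚ.m⊓n≤n B₂ _))) u≤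
    ∷ []
    where
    k+lo≤ : k ℕ.+ (A₂ ℕ.⊔ (u ℕ.∸ (s ℕ.+ B₃))) ≤ B₂ ℕ.⊓ (u ℕ.∸ (s ℕ.+ A₃))
    k+lo≤ = ≤∸⇒+≤ _ 1≤k k≤
    k+A₂≤ : k ℕ.+ A₂ ≤ B₂ ℕ.⊓ (u ℕ.∸ (s ℕ.+ A₃))
    k+A₂≤ = ℕₚ.≤-trans (ℕₚ.+-monoʳ-≤ k (ℕₚ.m≤m⊔n A₂ _)) k+lo≤
    k+m≤ : k ℕ.+ (u ℕ.∸ (s ℕ.+ B₃)) ≤ B₂ ℕ.⊓ (u ℕ.∸ (s ℕ.+ A₃))
    k+m≤ = ℕₚ.≤-trans (ℕₚ.+-monoʳ-≤ k (ℕₚ.m≤n⊔m A₂ _)) k+lo≤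
    rotate : ∀ k a s c → k ℕ.+ a ℕ.+ (s ℕ.+ c) ≡ k ℕ.+ (s ℕ.+ c ℕ.+ a)
    rotate = ℕ-Ring.solve-∀
    u≤ : u ≤ s ℕ.+ B₃ ℕ.+ (u ℕ.∸ (s ℕ.+ B₃))
    u≤ = ℕₚ.m≤n+m∸n u (s ℕ.+ B₃)
    third : ∀ m → k ℕ.+ m ≤ B₂ → u ≤ s ℕ.+ B₃ ℕ.+ m → k ℕ.+ u ≤ B₂ ℕ.+ (s ℕ.+ B₃)
    third m h₁ h₂ = ≤-cancel m (ℕₚ.+-mono-≤ h₁ h₂)
      (e₁ k m u) (e₂ B₂ s B₃ m)
      where
      e₁ : ∀ k m u → k ℕ.+ m ℕ.+ u ≡ m ℕ.+ (k ℕ.+ u)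
      e₁ = ℕ-Ring.solve-∀
      e₂ : ∀ b s c m → b ℕ.+ (s ℕ.+ c ℕ.+ m) ≡ m ℕ.+ (b ℕ.+ (s ℕ.+ c))
      e₂ = ℕ-Ring.solve-∀
    fourth : ∀ m → k ℕ.+ m ℕ.+ (s ℕ.+ A₃) ≤ u → u ≤ s ℕ.+ B₃ ℕ.+ m → k ℕ.+ A₃ ≤ B₃
    fourth m h₁ h₂ = ≤-cancel (s ℕ.+ m) (ℕₚ.≤-trans h₁ h₂)
      (e₁ k m s A₃) (e₂ s B₃ m)
      where
      e₁ : ∀ k m s a → k ℕ.+ m ℕ.+ (s ℕ.+ a) ≡ s ℕ.+ m ℕ.+ (k ℕ.+ a)
      e₁ = ℕ-Ring.solve-∀
      e₂ : ∀ s b m → s ℕ.+ b ℕ.+ m ≡ s ℕ.+ m ℕ.+ b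
      e₂ = ℕ-Ring.solve-∀

  bounds⇒count : ∀ {k} s → All (Gap k) (bounds s) → k ≤ antidiagonalCount s
  bounds⇒count {k} s (h₁ ∷ h₂ ∷ h₃ ∷ h₄ ∷ []) = ℕₚ.m+n≤o⇒m≤o∸n k
    (ℕₚ.⊓-glb (lub h₁ second₁)
              (lub (ℕₚ.m+n≤o⇒m≤o∸n (k ℕ.+ A₂) (subst (_≤ u) (e₁ k s A₃ A₂) h₂))
                   (ℕₚ.m+n≤o⇒m≤o∸n (k ℕ.+ m) second₂)))
    where
    m = u ℕ.∸ (s ℕ.+ B₃)
    lub : ∀ {x} → k ℕ.+ A₂ ≤ x → k ℕ.+ m ≤ x → k ℕ.+ (A₂ ℕ.⊔ m) ≤ x
    lub {x} p q = subst (_≤ x) (sym (ℕₚ.+-distribˡ-⊔ k A₂ m)) (ℕₚ.⊔-lub p q)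
    e₁ : ∀ k s a b → k ℕ.+ (s ℕ.+ a ℕ.+ b) ≡ k ℕ.+ b ℕ.+ (s ℕ.+ a)
    e₁ = ℕ-Ring.solve-∀
    e₂ : ∀ k s a b → k ℕ.+ (s ℕ.+ a ℕ.+ b) ≡ k ℕ.+ 0 ℕ.+ (s ℕ.+ a) ℕ.+ b
    e₂ = ℕ-Ring.solve-∀
    second₁ : k ℕ.+ m ≤ B₂
    second₁ with ℕₚ.≤-total u (s ℕ.+ B₃)
    ... | inj₁ u≤ rewrite ℕₚ.m≤n⇒m∸n≡0 u≤ | ℕₚ.+-identityʳ k = ℕₚ.m+n≤o⇒m≤o k h₁
    ... | inj₂ ≤u = ≤-cancel (s ℕ.+ B₃) h₃
          (trans (cong (k ℕ.+_) (sym (ℕₚ.m∸n+n≡m ≤u))) (rotate k m (s ℕ.+ B₃))) (ℕₚ.+-comm B₂ (s ℕ.+ B₃))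
      where
      rotate : ∀ k m n → k ℕ.+ (m ℕ.+ n) ≡ n ℕ.+ (k ℕ.+ m)
      rotate = ℕ-Ring.solve-∀
    second₂ : k ℕ.+ m ℕ.+ (s ℕ.+ A₃) ≤ u
    second₂ with ℕₚ.≤-total u (s ℕ.+ B₃)
    ... | inj₁ u≤ rewrite ℕₚ.m≤n⇒m∸n≡0 u≤ =
          ℕₚ.m+n≤o⇒m≤o (k ℕ.+ 0 ℕ.+ (s ℕ.+ A₃)) {A₂} (subst (_≤ u) (e₂ k s A₃ A₂) h₂)
    ... | inj₂ ≤u = subst (k ℕ.+ m ℕ.+ (s ℕ.+ A₃) ≤_) (ℕₚ.m∸n+n≡m ≤u)
          (subst (_≤ m ℕ.+ (s ℕ.+ B₃)) (rotate m s k A₃) (ℕₚ.+-monoʳ-≤ m (ℕₚ.+-monoʳ-≤ s h₄)))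
      where
      rotate : ∀ m s k a → m ℕ.+ (s ℕ.+ (k ℕ.+ a)) ≡ k ℕ.+ m ℕ.+ (s ℕ.+ a)
      rotate = ℕ-Ring.solve-∀

-- The difference of the two counts

module BoxDifference (A₁ B₁ A₂ B₂ A₃ B₃ T : ℕ) where
  private
    -- Shifting x by one reads the slice at T as a sum at level T + 1, so both slices use the same
    -- count; `u` is one more because the ranges are half-open.
    t = suc T
    u = suc (suc T)
    Z = B₂ ℕ.+ (A₁ ℕ.+ B₃)

  open Box A₂ B₂ A₃ B₃ u

  -- Lowers the difference p - q by Z - u, the third of the `bounds` at `A₁`.
  shift : ℕ × ℕ → ℕ × ℕ
  shift (q , p) = Z ℕ.+ q , p ℕ.+ u

  module _ (R : ℕ) (B₂≤R : B₂ ≤ R) (B₃≤R : B₃ ≤ R) where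
    private
      M : ℕ → ℤ
      M s = ∑ (upTo R) λ y → ∑ (upTo R) λ z → 𝟙 (s ℕ.+ y ℕ.+ z ℕ.≟ t) * (within A₂ B₂ y * within A₃ B₃ z)

      M-count : ∀ s → M s ≡ + antidiagonalCount s
      M-count s = begin
        M s
          ≡⟨ ∑-cong (upTo R) (λ y → trans
               (∑-cong (upTo R) λ z → exchange (𝟙 (s ℕ.+ y ℕ.+ z ℕ.≟ t)) (within A₂ B₂ y) (within A₃ B₃ z))
               (trans (∑-* (upTo R) (within A₂ B₂ y) _)
                      (cong (within A₂ B₂ y *_) (∑-within-shifted (s ℕ.+ y) t A₃ B₃ B₃≤R)))) ⟩
        ∑ (upTo R) (λ y → within A₂ B₂ y * 𝟙 (s ℕ.+ y ℕ.+ A₃ ℕ.≤? t ×-dec t ℕ.<? s ℕ.+ y ℕ.+ B₃))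
          ≡⟨ ∑-cong (upTo R) (λ y → trans
               (sym (𝟙-× (A₂ ℕ.≤? y ×-dec y ℕ.<? B₂) (s ℕ.+ y ℕ.+ A₃ ℕ.≤? t ×-dec t ℕ.<? s ℕ.+ y ℕ.+ B₃)))
               (𝟙-cong ((A₂ ℕ.≤? y ×-dec y ℕ.<? B₂) ×-dec (s ℕ.+ y ℕ.+ A₃ ℕ.≤? t ×-dec t ℕ.<? s ℕ.+ y ℕ.+ B₃))
                       (lo ℕ.≤? y ×-dec y ℕ.<? hi) (to y) (from y))) ⟩
        ∑ (upTo R) (within lo hi)
          ≡⟨ ∑-within-count lo hi (ℕₚ.≤-trans (ℕₚ.m⊓n≤m B₂ _) B₂≤R) ⟩
        + (hi ℕ.∸ lo) ∎
        where
        lo = A₂ ℕ.⊔ (u ℕ.∸ (s ℕ.+ B₃))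
        hi = B₂ ℕ.⊓ (u ℕ.∸ (s ℕ.+ A₃))
        exchange : ∀ a b c → a * (b * c) ≡ b * (a * c)
        exchange = solve-∀
        e₁ : ∀ s y c → suc (s ℕ.+ y ℕ.+ c) ≡ suc y ℕ.+ (s ℕ.+ c)
        e₁ = ℕ-Ring.solve-∀
        e₂ : ∀ s y c → s ℕ.+ y ℕ.+ c ≡ s ℕ.+ c ℕ.+ y
        e₂ = ℕ-Ring.solve-∀
        to : ∀ y → (A₂ ≤ y × y < B₂) × (s ℕ.+ y ℕ.+ A₃ ≤ t × t < s ℕ.+ y ℕ.+ B₃) → lo ≤ y × y < hi
        to y ((p , q) , (v , w)) =
            ℕₚ.⊔-lub p (ℕₚ.m≤n+o⇒m∸n≤o u (s ℕ.+ B₃) (subst (u ≤_) (e₂ s y B₃) w))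
          , ℕₚ.⊓-glb q (ℕₚ.m+n≤o⇒m≤o∸n (suc y) (subst (_≤ u) (e₁ s y A₃) (s≤s v)))
        from : ∀ y → lo ≤ y × y < hi → (A₂ ≤ y × y < B₂) × (s ℕ.+ y ℕ.+ A₃ ≤ t × t < s ℕ.+ y ℕ.+ B₃)
        from y (p , q) =
            (ℕₚ.m⊔n≤o⇒m≤o A₂ _ p , ℕₚ.m≤n⊓o⇒m≤n B₂ _ q)
          , ( ℕ.s≤s⁻¹ (subst (_≤ u) (sym (e₁ s y A₃)) (≤∸⇒+≤ (s ℕ.+ A₃) (s≤s z≤n) (ℕₚ.m≤n⊓o⇒m≤o B₂ _ q)))
            , subst (u ≤_) (sym (e₂ s y B₃))
                (ℕₚ.≤-trans (ℕₚ.m≤n+m∸n u (s ℕ.+ B₃)) (ℕₚ.+-monoʳ-≤ (s ℕ.+ B₃) (ℕₚ.m⊔n≤o⇒n≤o A₂ _ p))))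

      pull : ∀ k (s : ℕ → ℕ) → (∀ x y z → 𝟙 (x ℕ.+ y ℕ.+ z ℕ.≟ k) ≡ 𝟙 (s x ℕ.+ y ℕ.+ z ℕ.≟ t)) →
        slice R k (product (within A₁ B₁) (within A₂ B₂) (within A₃ B₃)) ≡
        ∑ (upTo R) (λ x → within A₁ B₁ x * M (s x))
      pull k s eq = ∑-cong (upTo R) λ x → trans
        (∑-cong (upTo R) λ y → trans
          (∑-cong (upTo R) λ z → trans (cong (_* (within A₁ B₁ x * within A₂ B₂ y * within A₃ B₃ z)) (eq x y z))
                                       (exchange (𝟙 (s x ℕ.+ y ℕ.+ z ℕ.≟ t)) (within A₁ B₁ x) (within A₂ B₂ y) (within A₃ B₃ z)))
          (∑-* (upTo R) (within A₁ B₁ x) _))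
        (∑-* (upTo R) (within A₁ B₁ x) _)
        where
        exchange : ∀ a b c d → a * (b * c * d) ≡ b * (a * (c * d))
        exchange = solve-∀

    -- For fixed x the two slices contribute the counts at x + 1 and at x, so the sum over x
    -- telescopes.
    slice-difference : A₁ ≤ B₁ → B₁ ≤ R →
      slice R T (product (within A₁ B₁) (within A₂ B₂) (within A₃ B₃))
      - slice R (suc T) (product (within A₁ B₁) (within A₂ B₂) (within A₃ B₃)) ≡
      + antidiagonalCount B₁ - + antidiagonalCount A₁
    slice-difference A₁≤B₁ B₁≤R = begin
      slice R T w - slice R (suc T) w
        ≡⟨ cong₂ _-_ (pull T suc (λ x y z → 𝟙-cong (x ℕ.+ y ℕ.+ z ℕ.≟ T) (suc x ℕ.+ y ℕ.+ z ℕ.≟ t) (cong suc) ℕₚ.suc-injective))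
                     (pull t id (λ _ _ _ → refl)) ⟩
      ∑ (upTo R) (λ x → within A₁ B₁ x * M (suc x)) - ∑ (upTo R) (λ x → within A₁ B₁ x * M x)
        ≡⟨ sym (∑-- (upTo R) (λ x → within A₁ B₁ x * M (suc x)) (λ x → within A₁ B₁ x * M x)) ⟩
      ∑ (upTo R) (λ x → within A₁ B₁ x * M (suc x) - within A₁ B₁ x * M x)
        ≡⟨ ∑-cong (upTo R) (λ x → factor (within A₁ B₁ x) (M (suc x)) (M x)) ⟩
      ∑ (upTo R) (λ x → within A₁ B₁ x * (M (suc x) - M x))
        ≡⟨ ∑-within M A₁≤B₁ B₁≤R ⟩
      M B₁ - M A₁
        ≡⟨ cong₂ _-_ (M-count B₁) (M-count A₁) ⟩
      + antidiagonalCount B₁ - + antidiagonalCount A₁ ∎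
      where
      w = product (within A₁ B₁) (within A₂ B₂) (within A₃ B₃)
      factor : ∀ a b c → a * b - a * c ≡ a * (b - c)
      factor = solve-∀

    slice-empty : B₁ ≤ A₁ → ∀ k → slice R k (product (within A₁ B₁) (within A₂ B₂) (within A₃ B₃)) ≡ 0ℤ
    slice-empty B₁≤A₁ k = ∑-zero (upTo R) λ x → ∑-zero (upTo R) λ y → ∑-zero (upTo R) λ z →
      trans (cong (λ s → 𝟙 (x ℕ.+ y ℕ.+ z ℕ.≟ k) * (s * within A₂ B₂ y * within A₃ B₃ z)) (within-empty x B₁≤A₁))
            (zeros (𝟙 (x ℕ.+ y ℕ.+ z ℕ.≟ k)) (within A₂ B₂ y) (within A₃ B₃ z))
      where
      zeros : ∀ a b c → a * (0ℤ * b * c) ≡ 0ℤ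
      zeros = solve-∀

  module _ (A₁≤B₁ : A₁ ≤ B₁) (Z+≤u+u : Z ℕ.+ (B₁ ℕ.+ A₃ ℕ.+ A₂) ≤ u ℕ.+ u) where
    private
      hA = antidiagonalCount A₁
      hB = antidiagonalCount B₁

    -- As a function of s the count is a trapezoid cut off at zero, with its rising edge in the
    -- third bound and its falling edge in the second. `Z+≤u+u` says that the rising edge at `A₁` is
    -- no higher than the falling edge at `B₁`.
    counts-monotone : hA ≤ hB
    counts-monotone with hA in eq
    ... | zero  = z≤n
    ... | suc k with count⇒bounds A₁ (s≤s z≤n) (ℕₚ.≤-reflexive (sym eq))
    ...   | i ∷ _ ∷ iii ∷ iv ∷ [] = bounds⇒count B₁
            ( i
            ∷ ≤-cancel (Z ℕ.+ u) (ℕₚ.+-mono-≤ iii Z+≤u+u) (e₁ (suc k) u Z (B₁ ℕ.+ A₃ ℕ.+ A₂)) (sym (ℕₚ.+-assoc Z u u))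
            ∷ ℕₚ.≤-trans iii (ℕₚ.+-monoʳ-≤ B₂ (ℕₚ.+-monoˡ-≤ B₃ A₁≤B₁))
            ∷ iv ∷ [])
      where
      e₁ : ∀ k u z x → k ℕ.+ u ℕ.+ (z ℕ.+ x) ≡ z ℕ.+ u ℕ.+ (k ℕ.+ x)
      e₁ = ℕ-Ring.solve-∀

    -- For k ≥ 1 the count `hA` may be replaced by the positive part of Z - u. It never exceeds
    -- that; if it falls short, another bound is active at `A₁`, and this bound is at least as
    -- strict at `B₁`, so the difference of the counts is zero.
    difference⇒bounds : ∀ {k} → 1 ≤ k → k ≤ hB ℕ.∸ hA →
      All (Gap k) (bounds B₁) × All (Gap k ∘ shift) (bounds B₁)
    difference⇒bounds {k} 1≤k k≤ = All.map weaken atSum , shifted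
      where
      k+hA≤hB : k ℕ.+ hA ≤ hB
      k+hA≤hB = ≤∸⇒+≤ hA 1≤k k≤
      atSum : All (Gap (k ℕ.+ hA)) (bounds B₁)
      atSum = count⇒bounds B₁ (ℕₚ.≤-trans 1≤k (ℕₚ.m≤m+n k hA)) k+hA≤hB
      weaken : ∀ {qp} → Gap (k ℕ.+ hA) qp → Gap k qp
      weaken {q , _} = ℕₚ.≤-trans (ℕₚ.+-monoˡ-≤ q (ℕₚ.m≤m+n k hA))
      z = Z ℕ.∸ u
      atB : All (Gap hB) (bounds B₁)
      atB = count⇒bounds B₁ (ℕₚ.≤-trans 1≤k (ℕₚ.≤-trans (ℕₚ.m≤m+n k hA) k+hA≤hB)) ℕₚ.≤-refl
      -- If hB < z then the bound by z is inactive for A₁, so that hB ≤ hA.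
      impossible : u ≤ Z → hB ≤ z → ⊥
      impossible u≤Z hB≤z with atB
      ... | i ∷ ii ∷ _ ∷ iv ∷ [] = ℕₚ.<⇒≱ (ℕₚ.<-≤-trans (ℕₚ.+-monoˡ-≤ hA 1≤k) k+hA≤hB) (bounds⇒count A₁
        ( i
        ∷ ℕₚ.≤-trans (ℕₚ.+-monoʳ-≤ hB (ℕₚ.+-monoˡ-≤ A₂ (ℕₚ.+-monoˡ-≤ A₃ A₁≤B₁))) ii
        ∷ subst (hB ℕ.+ u ≤_) (ℕₚ.m∸n+n≡m u≤Z) (ℕₚ.+-monoˡ-≤ u hB≤z)
        ∷ iv ∷ []))
      below-z : ∀ {q p} → hB ℕ.+ q ≤ p → ¬ (z ℕ.+ q ≤ p) → hB ≤ z
      below-z {q} {p} h₁ h₂ = ℕₚ.<⇒≤ (ℕₚ.≰⇒> λ z≤hB → h₂ (ℕₚ.≤-trans (ℕₚ.+-monoˡ-≤ q z≤hB) h₁))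
      z≤hA : u ≤ Z → z ≤ hA
      z≤hA u≤Z with z ℕ.+ A₂ ℕ.≤? B₂ | z ℕ.+ A₃ ℕ.≤? B₃
      ... | no h | _    = contradiction (below-z (All.head atB) h) (impossible u≤Z)
      ... | yes _ | no h with atB
      ...   | _ ∷ _ ∷ _ ∷ iv ∷ [] = contradiction (below-z iv h) (impossible u≤Z)
      z≤hA u≤Z | yes i | yes iv = bounds⇒count A₁
        ( i
        ∷ ℕₚ.≤-trans (ℕₚ.+-monoʳ-≤ z (ℕₚ.+-monoˡ-≤ A₂ (ℕₚ.+-monoˡ-≤ A₃ A₁≤B₁)))
            (≤-cancel u Z+≤u+u (trans (cong (ℕ._+ (B₁ ℕ.+ A₃ ℕ.+ A₂)) (sym (ℕₚ.m+[n∸m]≡n u≤Z))) (ℕₚ.+-assoc u z _)) refl)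
        ∷ ℕₚ.≤-reflexive (ℕₚ.m∸n+n≡m u≤Z)
        ∷ iv ∷ [])
      shifted : All (Gap k ∘ shift) (bounds B₁)
      shifted with ℕₚ.≤-total Z u
      ... | inj₁ Z≤u = All.map (λ {qp} g → subst (_≤ proj₂ qp ℕ.+ u) (e (proj₁ qp)) (ℕₚ.+-mono-≤ (weaken {qp} g) Z≤u)) atSum
        where
        rotate : ∀ k q z → k ℕ.+ q ℕ.+ z ≡ k ℕ.+ (z ℕ.+ q)
        rotate = ℕ-Ring.solve-∀
        e : ∀ q → k ℕ.+ q ℕ.+ Z ≡ k ℕ.+ (Z ℕ.+ q)
        e q = rotate k q Z
      ... | inj₂ u≤Z = All.map (λ {qp} g → subst (_≤ proj₂ qp ℕ.+ u) (e (proj₁ qp))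
            (ℕₚ.+-monoˡ-≤ u (ℕₚ.≤-trans (ℕₚ.+-monoˡ-≤ (proj₁ qp) (ℕₚ.+-monoʳ-≤ k (z≤hA u≤Z))) g))) atSum
        where
        rotate : ∀ k z q u → k ℕ.+ z ℕ.+ q ℕ.+ u ≡ k ℕ.+ (z ℕ.+ u ℕ.+ q)
        rotate = ℕ-Ring.solve-∀
        e : ∀ q → k ℕ.+ z ℕ.+ q ℕ.+ u ≡ k ℕ.+ (Z ℕ.+ q)
        e q = trans (rotate k z q u) (cong (λ s → k ℕ.+ (s ℕ.+ q)) (ℕₚ.m∸n+n≡m u≤Z))

    -- The count at `A₁` is either zero, where the unshifted bounds suffice, or at most Z - u, where
    -- the shifted ones do.
    bounds⇒difference : ∀ {k} → All (Gap k) (bounds B₁) → All (Gap k ∘ shift) (bounds B₁) → k ≤ hB ℕ.∸ hA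
    bounds⇒difference {k} unshifted shifted = ℕₚ.m+n≤o⇒m≤o∸n k k+hA≤hB
      where
      rotate : ∀ k h q u → u ℕ.+ (k ℕ.+ h ℕ.+ q) ≡ k ℕ.+ (h ℕ.+ u ℕ.+ q)
      rotate = ℕ-Ring.solve-∀
      k+hA≤hB : k ℕ.+ hA ≤ hB
      k+hA≤hB with hA in eq
      ... | zero  = bounds⇒count B₁ (subst (λ j → All (Gap j) (bounds B₁)) (sym (ℕₚ.+-identityʳ k)) unshifted)
      ... | suc h with count⇒bounds A₁ (s≤s z≤n) (ℕₚ.≤-reflexive (sym eq))
      ...   | _ ∷ _ ∷ iii ∷ _ ∷ [] = bounds⇒count B₁ (All.map (λ {qp} g →
              ≤-cancel u (ℕₚ.≤-trans (ℕₚ.+-monoʳ-≤ k (ℕₚ.+-monoˡ-≤ (proj₁ qp) iii)) g)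
                (sym (rotate k (suc h) (proj₁ qp) u)) (ℕₚ.+-comm (proj₂ qp) u)) shifted)

-- Hive differences and Horn inequalities

-- The pairs (q , p) represent the differences p − q = U − L between an upper bound U and a
-- lower bound L of the hive interval, listed in the order of the Horn inequalities.
hiveDifferences : (n₁ n₂ n₃ l₁ l₂ l₃ u : ℕ) → List (ℕ × ℕ)
hiveDifferences n₁ n₂ n₃ l₁ l₂ l₃ u =
    (u , l₂ ℕ.+ (l₁ ℕ.+ l₃))
  ∷ (n₁ ℕ.+ l₂ ℕ.+ (n₂ ℕ.+ l₃) ℕ.+ (l₁ ℕ.+ n₃) , u ℕ.+ u)
  ∷ (n₃ , n₂)
  ∷ (n₂ , n₁)
  ∷ (l₃ , l₂)
  ∷ (n₁ ℕ.+ l₂ , n₁ ℕ.+ l₁)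
  ∷ (l₁ ℕ.+ n₃ ℕ.+ n₂ , u)
  ∷ (n₁ ℕ.+ l₂ ℕ.+ n₃ , u)
  ∷ (u , n₁ ℕ.+ (l₁ ℕ.+ l₃))
  ∷ (n₁ ℕ.+ l₂ ℕ.+ (n₂ ℕ.+ l₃) , l₂ ℕ.+ u)
  ∷ (u , l₂ ℕ.+ (l₁ ℕ.+ n₂))
  ∷ (l₃ , n₁)
  ∷ (n₃ , l₃)
  ∷ (n₂ , l₂)
  ∷ (l₁ ℕ.+ n₃ ℕ.+ l₃ , u)
  ∷ (n₁ ℕ.+ l₂ , l₂ ℕ.+ l₁)
  ∷ (n₁ ℕ.+ l₂ ℕ.+ (n₂ ℕ.+ l₃) , n₁ ℕ.+ u)
  ∷ (u , n₁ ℕ.+ (l₁ ℕ.+ n₂))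
  ∷ []

private
  regroup₁ : ∀ b a c d → b ℕ.+ (a ℕ.+ c) ℕ.+ d ≡ b ℕ.+ a ℕ.+ (c ℕ.+ d)
  regroup₁ = ℕ-Ring.solve-∀
  regroup₂ : ∀ b a c d l n → b ℕ.+ (a ℕ.+ c) ℕ.+ (l ℕ.+ n ℕ.+ d) ≡ b ℕ.+ a ℕ.+ (c ℕ.+ d) ℕ.+ (l ℕ.+ n)
  regroup₂ = ℕ-Ring.solve-∀
  regroup₃ : ∀ k b a c u → k ℕ.+ (b ℕ.+ (a ℕ.+ c) ℕ.+ u) ≡ c ℕ.+ u ℕ.+ (k ℕ.+ (b ℕ.+ a))
  regroup₃ = ℕ-Ring.solve-∀
  regroup₃′ : ∀ b l c u → b ℕ.+ (l ℕ.+ c) ℕ.+ u ≡ c ℕ.+ u ℕ.+ (b ℕ.+ l)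
  regroup₃′ = ℕ-Ring.solve-∀
  regroup₄ : ∀ k b a c n → k ℕ.+ (b ℕ.+ (a ℕ.+ c) ℕ.+ n) ≡ c ℕ.+ (k ℕ.+ (b ℕ.+ a ℕ.+ n))
  regroup₄ = ℕ-Ring.solve-∀

module Hive (n₁ n₂ n₃ l₁ l₂ l₃ T : ℕ) where
  A₁ = n₁ ℕ.⊔ l₂
  B₂ = n₁ ℕ.⊓ l₂
  A₂ = n₂ ℕ.⊔ l₃
  B₃ = n₂ ℕ.⊓ l₃
  private
    u = suc (suc T)

  open Box A₂ B₂ n₃ B₃ u using (bounds) public
  open BoxDifference A₁ l₁ A₂ B₂ n₃ B₃ T using (shift) public

  private
    B₂≤n₁ = ℕₚ.m⊓n≤m n₁ l₂
    B₂≤l₂ = ℕₚ.m⊓n≤n n₁ l₂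
    n₂≤A₂ = ℕₚ.m≤m⊔n n₂ l₃
    l₃≤A₂ = ℕₚ.m≤n⊔m n₂ l₃
    B₃≤n₂ = ℕₚ.m⊓n≤m n₂ l₃
    B₃≤l₃ = ℕₚ.m⊓n≤n n₂ l₃

    ⊓+⊔ : ∀ m n → m ℕ.⊓ n ℕ.+ (m ℕ.⊔ n) ≡ m ℕ.+ n
    ⊓+⊔ m n with ℕₚ.≤-total m n
    ... | inj₁ m≤n = cong₂ ℕ._+_ (ℕₚ.m≤n⇒m⊓n≡m m≤n) (ℕₚ.m≤n⇒m⊔n≡n m≤n)
    ... | inj₂ n≤m = trans (cong₂ ℕ._+_ (ℕₚ.m≥n⇒m⊓n≡n n≤m) (ℕₚ.m≥n⇒m⊔n≡m n≤m)) (ℕₚ.+-comm n m)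

    B₂+A₁ : B₂ ℕ.+ A₁ ≡ n₁ ℕ.+ l₂
    B₂+A₁ = ⊓+⊔ n₁ l₂
    B₃+A₂ : B₃ ℕ.+ A₂ ≡ n₂ ℕ.+ l₃
    B₃+A₂ = ⊓+⊔ n₂ l₃

    sel-B₂ : ∀ (P : ℕ → Set) → P n₁ → P l₂ → P B₂
    sel-B₂ P p q with ℕₚ.⊓-sel n₁ l₂
    ... | inj₁ eq = subst P (sym eq) p
    ... | inj₂ eq = subst P (sym eq) q
    sel-A₂ : ∀ (P : ℕ → Set) → P n₂ → P l₃ → P A₂
    sel-A₂ P p q with ℕₚ.⊔-sel n₂ l₃
    ... | inj₁ eq = subst P (sym eq) p
    ... | inj₂ eq = subst P (sym eq) q
    sel-B₃ : ∀ (P : ℕ → Set) → P n₂ → P l₃ → P B₃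
    sel-B₃ P p q with ℕₚ.⊓-sel n₂ l₃
    ... | inj₁ eq = subst P (sym eq) p
    ... | inj₂ eq = subst P (sym eq) q

    lower₁ : B₂ ℕ.+ (A₁ ℕ.+ B₃) ℕ.+ A₂ ≡ n₁ ℕ.+ l₂ ℕ.+ (n₂ ℕ.+ l₃)
    lower₁ = trans (regroup₁ B₂ A₁ B₃ A₂) (cong₂ ℕ._+_ B₂+A₁ B₃+A₂)
    lower₃ : ∀ k → k ℕ.+ (B₂ ℕ.+ (A₁ ℕ.+ B₃) ℕ.+ u) ≡ B₃ ℕ.+ u ℕ.+ (k ℕ.+ (n₁ ℕ.+ l₂))
    lower₃ k = trans (regroup₃ k B₂ A₁ B₃ u) (cong (λ s → B₃ ℕ.+ u ℕ.+ (k ℕ.+ s)) B₂+A₁)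
    lower₄ : ∀ k → k ℕ.+ (B₂ ℕ.+ (A₁ ℕ.+ B₃) ℕ.+ n₃) ≡ B₃ ℕ.+ (k ℕ.+ (n₁ ℕ.+ l₂ ℕ.+ n₃))
    lower₄ k = trans (regroup₄ k B₂ A₁ B₃ n₃) (cong (λ s → B₃ ℕ.+ (k ℕ.+ (s ℕ.+ n₃))) B₂+A₁)

  lower₂ : B₂ ℕ.+ (A₁ ℕ.+ B₃) ℕ.+ (l₁ ℕ.+ n₃ ℕ.+ A₂) ≡ n₁ ℕ.+ l₂ ℕ.+ (n₂ ℕ.+ l₃) ℕ.+ (l₁ ℕ.+ n₃)
  lower₂ = trans (regroup₂ B₂ A₁ B₃ A₂ l₁ n₃) (cong (ℕ._+ (l₁ ℕ.+ n₃)) (cong₂ ℕ._+_ B₂+A₁ B₃+A₂))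

  -- Expanding min and max, the unshifted bounds give 4 + 2 + 4 + 2 differences. In the shifted ones
  -- a min and a max of the same two numbers meet and add up to their sum, or a common `B₃` cancels,
  -- which leaves 2 + 1 + 2 + 1; together eighteen.
  bounds⇒differences : ∀ {k} → All (Gap k) (bounds l₁) → All (Gap k ∘ shift) (bounds l₁) →
    All (Gap k) (hiveDifferences n₁ n₂ n₃ l₁ l₂ l₃ u)
  bounds⇒differences {k} (i ∷ ii ∷ iii ∷ iv ∷ []) (i′ ∷ ii′ ∷ iii′ ∷ iv′ ∷ []) =
      d₃ B₂≤l₂ B₃≤l₃ ∷ subst (λ s → k ℕ.+ s ≤ u ℕ.+ u) lower₂ ii′ ∷ ℕₚ.≤-trans iv B₃≤n₂
    ∷ d₁ n₂≤A₂ B₂≤n₁ ∷ d₁ l₃≤A₂ B₂≤l₂ ∷ d₆ B₂≤n₁ ∷ d₂ n₂≤A₂ ∷ d₈ ∷ d₃ B₂≤n₁ B₃≤l₃ ∷ d₅ B₂≤l₂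
    ∷ d₃ B₂≤l₂ B₃≤n₂ ∷ d₁ l₃≤A₂ B₂≤n₁ ∷ ℕₚ.≤-trans iv B₃≤l₃ ∷ d₁ n₂≤A₂ B₂≤l₂ ∷ d₂ l₃≤A₂
    ∷ d₆ B₂≤l₂ ∷ d₅ B₂≤n₁ ∷ d₃ B₂≤n₁ B₃≤n₂ ∷ []
    where
    d₁ : ∀ {q p} → q ≤ A₂ → B₂ ≤ p → k ℕ.+ q ≤ p
    d₁ q≤ ≤p = ℕₚ.≤-trans (ℕₚ.+-monoʳ-≤ k q≤) (ℕₚ.≤-trans i ≤p)
    d₂ : ∀ {q} → q ≤ A₂ → k ℕ.+ (l₁ ℕ.+ n₃ ℕ.+ q) ≤ u
    d₂ q≤ = ℕₚ.≤-trans (ℕₚ.+-monoʳ-≤ k (ℕₚ.+-monoʳ-≤ (l₁ ℕ.+ n₃) q≤)) ii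
    d₃ : ∀ {p p′} → B₂ ≤ p → B₃ ≤ p′ → k ℕ.+ u ≤ p ℕ.+ (l₁ ℕ.+ p′)
    d₃ ≤p ≤p′ = ℕₚ.≤-trans iii (ℕₚ.+-mono-≤ ≤p (ℕₚ.+-monoʳ-≤ l₁ ≤p′))
    d₅ : ∀ {p} → B₂ ≤ p → k ℕ.+ (n₁ ℕ.+ l₂ ℕ.+ (n₂ ℕ.+ l₃)) ≤ p ℕ.+ u
    d₅ {p} ≤p = subst (λ s → k ℕ.+ s ≤ p ℕ.+ u) lower₁ (ℕₚ.≤-trans i′ (ℕₚ.+-monoˡ-≤ u ≤p))
    d₆ : ∀ {p} → B₂ ≤ p → k ℕ.+ (n₁ ℕ.+ l₂) ≤ p ℕ.+ l₁
    d₆ ≤p = ℕₚ.≤-trans (≤-cancel (B₃ ℕ.+ u) iii′ (lower₃ k) (regroup₃′ B₂ l₁ B₃ u)) (ℕₚ.+-monoˡ-≤ l₁ ≤p)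
    d₈ : k ℕ.+ (n₁ ℕ.+ l₂ ℕ.+ n₃) ≤ u
    d₈ = ≤-cancel B₃ iv′ (lower₄ k) refl

  differences⇒bounds : ∀ {k} → All (Gap k) (hiveDifferences n₁ n₂ n₃ l₁ l₂ l₃ u) →
    All (Gap k) (bounds l₁) × All (Gap k ∘ shift) (bounds l₁)
  differences⇒bounds {k} (h₁ ∷ h₂ ∷ h₃ ∷ h₄ ∷ h₅ ∷ h₆ ∷ h₇ ∷ h₈ ∷ h₉ ∷ h₁₀ ∷ h₁₁ ∷ h₁₂ ∷ h₁₃ ∷ h₁₄ ∷ h₁₅ ∷ h₁₆ ∷ h₁₇ ∷ h₁₈ ∷ []) =
    ( sel-A₂ (λ a → k ℕ.+ a ≤ B₂) (sel-B₂ (k ℕ.+ n₂ ≤_) h₄ h₁₄) (sel-B₂ (k ℕ.+ l₃ ≤_) h₁₂ h₅)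
    ∷ sel-A₂ (λ a → k ℕ.+ (l₁ ℕ.+ n₃ ℕ.+ a) ≤ u) h₇ h₁₅
    ∷ sel-B₃ (λ b → k ℕ.+ u ≤ B₂ ℕ.+ (l₁ ℕ.+ b))
        (sel-B₂ (λ b → k ℕ.+ u ≤ b ℕ.+ (l₁ ℕ.+ n₂)) h₁₈ h₁₁)
        (sel-B₂ (λ b → k ℕ.+ u ≤ b ℕ.+ (l₁ ℕ.+ l₃)) h₉ h₁)
    ∷ sel-B₃ (k ℕ.+ n₃ ≤_) h₃ h₁₃
    ∷ [])
    ,
    ( subst (λ s → k ℕ.+ s ≤ B₂ ℕ.+ u) (sym lower₁)
        (sel-B₂ (λ b → k ℕ.+ (n₁ ℕ.+ l₂ ℕ.+ (n₂ ℕ.+ l₃)) ≤ b ℕ.+ u) h₁₇ h₁₀)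
    ∷ subst (λ s → k ℕ.+ s ≤ u ℕ.+ u) (sym lower₂) h₂
    ∷ subst₂ _≤_ (sym (lower₃ k)) (sym (regroup₃′ B₂ l₁ B₃ u))
        (ℕₚ.+-monoʳ-≤ (B₃ ℕ.+ u) (sel-B₂ (λ b → k ℕ.+ (n₁ ℕ.+ l₂) ≤ b ℕ.+ l₁) h₆ h₁₆))
    ∷ subst (_≤ B₃ ℕ.+ u) (sym (lower₄ k)) (ℕₚ.+-monoʳ-≤ B₃ h₈)
    ∷ [])

-- That is, p - q = (b - a) + 1. The extra 1 is why the coefficient exceeds the least slack by one.
SameDifference : ℕ × ℕ → ℕ × ℕ → Set
SameDifference (q , p) (a , b) = p ℕ.+ a ≡ q ℕ.+ suc b

gaps⇒ : ∀ {k xs ys} → Pointwise SameDifference xs ys → All (Gap k) xs → All (λ (a , b) → k ℕ.+ a ≤ suc b) ys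
gaps⇒ []         []       = []
gaps⇒ {k} {(q , p) ∷ _} {(a , b) ∷ _} (eq ∷ eqs) (g ∷ gs) =
  ≤-cancel q (subst (k ℕ.+ q ℕ.+ a ≤_) eq (ℕₚ.+-monoˡ-≤ a g)) (rotate k q a) refl ∷ gaps⇒ eqs gs
  where
  rotate : ∀ k q a → k ℕ.+ q ℕ.+ a ≡ q ℕ.+ (k ℕ.+ a)
  rotate = ℕ-Ring.solve-∀

gaps⇐ : ∀ {k xs ys} → Pointwise SameDifference xs ys → All (λ (a , b) → k ℕ.+ a ≤ suc b) ys → All (Gap k) xs
gaps⇐ []         []       = []
gaps⇐ {k} {(q , p) ∷ _} {(a , b) ∷ _} (eq ∷ eqs) (g ∷ gs) =
  ≤-cancel a (subst (k ℕ.+ a ℕ.+ q ≤_) (trans (ℕₚ.+-comm (suc b) q) (sym eq)) (ℕₚ.+-monoˡ-≤ q g))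
    (rotate k a q) (ℕₚ.+-comm p a) ∷ gaps⇐ eqs gs
  where
  rotate : ∀ k q a → k ℕ.+ q ℕ.+ a ≡ q ℕ.+ (k ℕ.+ a)
  rotate = ℕ-Ring.solve-∀

hornList : (a₁ a₂ a₃ m₁ m₂ m₃ v₁ v₂ v₃ : ℕ) → List (ℕ × ℕ)
hornList a₁ a₂ a₃ m₁ m₂ m₃ v₁ v₂ v₃ =
    (m₃ , m₂) ∷ (m₂ , m₁) ∷ (v₃ , v₂) ∷ (v₂ , v₁) ∷ (a₃ , a₂) ∷ (a₂ , a₁)
  ∷ (a₁ , m₁ ℕ.+ v₁) ∷ (a₂ , m₁ ℕ.+ v₂) ∷ (a₂ , m₂ ℕ.+ v₁)
  ∷ (a₃ , m₁ ℕ.+ v₃) ∷ (a₃ , m₂ ℕ.+ v₂) ∷ (a₃ , m₃ ℕ.+ v₁)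
  ∷ (m₃ ℕ.+ v₃ , a₃) ∷ (m₃ ℕ.+ v₂ , a₂) ∷ (m₂ ℕ.+ v₃ , a₂)
  ∷ (m₃ ℕ.+ v₁ , a₁) ∷ (m₂ ℕ.+ v₂ , a₁) ∷ (m₁ ℕ.+ v₃ , a₁) ∷ []

private
  eq₁ : ∀ a₁ a₂ a₃ p m₂ r v₁ v₂ v₃ →
    (((2 ℕ.+ a₂) ℕ.+ ((3 ℕ.+ a₁) ℕ.+ (1 ℕ.+ a₃))) ℕ.+ r) ℕ.+ (p ℕ.+ r ℕ.+ m₂ ℕ.+ r ℕ.+ (v₁ ℕ.+ v₂ ℕ.+ v₃)) ≡
    (((2 ℕ.+ (r ℕ.+ r ℕ.+ r ℕ.+ (v₁ ℕ.+ v₂ ℕ.+ v₃) ℕ.+ (3 ℕ.+ p)))) ℕ.+ suc m₂) ℕ.+ (a₁ ℕ.+ a₂ ℕ.+ a₃)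
  eq₁ = ℕ-Ring.solve-∀
  eq₂ : ∀ a₁ a₂ a₃ p m₂ r v₁ v₂ v₃ →
    (((2 ℕ.+ (r ℕ.+ r ℕ.+ r ℕ.+ (v₁ ℕ.+ v₂ ℕ.+ v₃) ℕ.+ (3 ℕ.+ p))) ℕ.+ (2 ℕ.+ (r ℕ.+ r ℕ.+ r ℕ.+ (v₁ ℕ.+ v₂ ℕ.+ v₃) ℕ.+ (3 ℕ.+ p)))) ℕ.+ m₂) ℕ.+ (a₁ ℕ.+ a₂ ℕ.+ a₃) ≡
    (((r ℕ.+ (2 ℕ.+ v₁)) ℕ.+ (2 ℕ.+ a₂) ℕ.+ ((r ℕ.+ (1 ℕ.+ v₂)) ℕ.+ (1 ℕ.+ a₃)) ℕ.+ ((3 ℕ.+ a₁) ℕ.+ (r ℕ.+ v₃))) ℕ.+ suc (p ℕ.+ r)) ℕ.+ (p ℕ.+ r ℕ.+ m₂ ℕ.+ r ℕ.+ (v₁ ℕ.+ v₂ ℕ.+ v₃))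
  eq₂ = ℕ-Ring.solve-∀
  eq₃ : ∀ r v₂ v₃ →
    ((r ℕ.+ (1 ℕ.+ v₂))) ℕ.+ v₃ ≡
    (r ℕ.+ v₃) ℕ.+ suc v₂
  eq₃ = ℕ-Ring.solve-∀
  eq₄ : ∀ r v₁ v₂ →
    ((r ℕ.+ (2 ℕ.+ v₁))) ℕ.+ v₂ ≡
    ((r ℕ.+ (1 ℕ.+ v₂))) ℕ.+ suc v₁
  eq₄ = ℕ-Ring.solve-∀
  eq₅ : ∀ a₂ a₃ →
    (2 ℕ.+ a₂) ℕ.+ a₃ ≡
    (1 ℕ.+ a₃) ℕ.+ suc a₂
  eq₅ = ℕ-Ring.solve-∀
  eq₆ : ∀ a₁ a₂ r v₁ →
    ((r ℕ.+ (2 ℕ.+ v₁)) ℕ.+ (3 ℕ.+ a₁)) ℕ.+ a₂ ≡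
    ((r ℕ.+ (2 ℕ.+ v₁)) ℕ.+ (2 ℕ.+ a₂)) ℕ.+ suc a₁
  eq₆ = ℕ-Ring.solve-∀
  eq₇ : ∀ a₁ p r v₁ v₂ v₃ →
    ((2 ℕ.+ (r ℕ.+ r ℕ.+ r ℕ.+ (v₁ ℕ.+ v₂ ℕ.+ v₃) ℕ.+ (3 ℕ.+ p)))) ℕ.+ a₁ ≡
    ((3 ℕ.+ a₁) ℕ.+ (r ℕ.+ v₃) ℕ.+ (r ℕ.+ (1 ℕ.+ v₂))) ℕ.+ suc ((p ℕ.+ r) ℕ.+ v₁)
  eq₇ = ℕ-Ring.solve-∀
  eq₈ : ∀ a₂ p r v₁ v₂ v₃ →
    ((2 ℕ.+ (r ℕ.+ r ℕ.+ r ℕ.+ (v₁ ℕ.+ v₂ ℕ.+ v₃) ℕ.+ (3 ℕ.+ p)))) ℕ.+ a₂ ≡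
    ((r ℕ.+ (2 ℕ.+ v₁)) ℕ.+ (2 ℕ.+ a₂) ℕ.+ (r ℕ.+ v₃)) ℕ.+ suc ((p ℕ.+ r) ℕ.+ v₂)
  eq₈ = ℕ-Ring.solve-∀
  eq₉ : ∀ a₁ a₂ a₃ p m₂ r v₁ v₂ v₃ →
    (((r ℕ.+ (2 ℕ.+ v₁)) ℕ.+ ((3 ℕ.+ a₁) ℕ.+ (1 ℕ.+ a₃))) ℕ.+ a₂) ℕ.+ (p ℕ.+ r ℕ.+ m₂ ℕ.+ r ℕ.+ (v₁ ℕ.+ v₂ ℕ.+ v₃)) ≡
    (((2 ℕ.+ (r ℕ.+ r ℕ.+ r ℕ.+ (v₁ ℕ.+ v₂ ℕ.+ v₃) ℕ.+ (3 ℕ.+ p)))) ℕ.+ suc (m₂ ℕ.+ v₁)) ℕ.+ (a₁ ℕ.+ a₂ ℕ.+ a₃)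
  eq₉ = ℕ-Ring.solve-∀
  eq₁₀ : ∀ a₂ a₃ p r v₁ v₂ v₃ →
    ((2 ℕ.+ a₂) ℕ.+ (2 ℕ.+ (r ℕ.+ r ℕ.+ r ℕ.+ (v₁ ℕ.+ v₂ ℕ.+ v₃) ℕ.+ (3 ℕ.+ p)))) ℕ.+ a₃ ≡
    ((r ℕ.+ (2 ℕ.+ v₁)) ℕ.+ (2 ℕ.+ a₂) ℕ.+ ((r ℕ.+ (1 ℕ.+ v₂)) ℕ.+ (1 ℕ.+ a₃))) ℕ.+ suc ((p ℕ.+ r) ℕ.+ v₃)
  eq₁₀ = ℕ-Ring.solve-∀
  eq₁₁ : ∀ a₁ a₂ a₃ p m₂ r v₁ v₂ v₃ →
    (((2 ℕ.+ a₂) ℕ.+ ((3 ℕ.+ a₁) ℕ.+ (r ℕ.+ (1 ℕ.+ v₂)))) ℕ.+ a₃) ℕ.+ (p ℕ.+ r ℕ.+ m₂ ℕ.+ r ℕ.+ (v₁ ℕ.+ v₂ ℕ.+ v₃)) ≡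
    (((2 ℕ.+ (r ℕ.+ r ℕ.+ r ℕ.+ (v₁ ℕ.+ v₂ ℕ.+ v₃) ℕ.+ (3 ℕ.+ p)))) ℕ.+ suc (m₂ ℕ.+ v₂)) ℕ.+ (a₁ ℕ.+ a₂ ℕ.+ a₃)
  eq₁₁ = ℕ-Ring.solve-∀
  eq₁₂ : ∀ a₃ r v₁ →
    ((r ℕ.+ (2 ℕ.+ v₁))) ℕ.+ a₃ ≡
    (1 ℕ.+ a₃) ℕ.+ suc (r ℕ.+ v₁)
  eq₁₂ = ℕ-Ring.solve-∀
  eq₁₃ : ∀ a₃ r v₃ →
    (1 ℕ.+ a₃) ℕ.+ (r ℕ.+ v₃) ≡
    (r ℕ.+ v₃) ℕ.+ suc a₃
  eq₁₃ = ℕ-Ring.solve-∀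
  eq₁₄ : ∀ a₂ r v₂ →
    (2 ℕ.+ a₂) ℕ.+ (r ℕ.+ v₂) ≡
    ((r ℕ.+ (1 ℕ.+ v₂))) ℕ.+ suc a₂
  eq₁₄ = ℕ-Ring.solve-∀
  eq₁₅ : ∀ a₁ a₂ a₃ p m₂ r v₁ v₂ v₃ →
    (((2 ℕ.+ (r ℕ.+ r ℕ.+ r ℕ.+ (v₁ ℕ.+ v₂ ℕ.+ v₃) ℕ.+ (3 ℕ.+ p)))) ℕ.+ (m₂ ℕ.+ v₃)) ℕ.+ (a₁ ℕ.+ a₂ ℕ.+ a₃) ≡
    (((3 ℕ.+ a₁) ℕ.+ (r ℕ.+ v₃) ℕ.+ (1 ℕ.+ a₃)) ℕ.+ suc a₂) ℕ.+ (p ℕ.+ r ℕ.+ m₂ ℕ.+ r ℕ.+ (v₁ ℕ.+ v₂ ℕ.+ v₃))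
  eq₁₅ = ℕ-Ring.solve-∀
  eq₁₆ : ∀ a₁ a₂ r v₁ →
    ((2 ℕ.+ a₂) ℕ.+ (3 ℕ.+ a₁)) ℕ.+ (r ℕ.+ v₁) ≡
    ((r ℕ.+ (2 ℕ.+ v₁)) ℕ.+ (2 ℕ.+ a₂)) ℕ.+ suc a₁
  eq₁₆ = ℕ-Ring.solve-∀
  eq₁₇ : ∀ a₁ a₂ a₃ p m₂ r v₁ v₂ v₃ →
    (((r ℕ.+ (2 ℕ.+ v₁)) ℕ.+ (2 ℕ.+ (r ℕ.+ r ℕ.+ r ℕ.+ (v₁ ℕ.+ v₂ ℕ.+ v₃) ℕ.+ (3 ℕ.+ p)))) ℕ.+ (m₂ ℕ.+ v₂)) ℕ.+ (a₁ ℕ.+ a₂ ℕ.+ a₃) ≡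
    (((r ℕ.+ (2 ℕ.+ v₁)) ℕ.+ (2 ℕ.+ a₂) ℕ.+ ((r ℕ.+ (1 ℕ.+ v₂)) ℕ.+ (1 ℕ.+ a₃))) ℕ.+ suc a₁) ℕ.+ (p ℕ.+ r ℕ.+ m₂ ℕ.+ r ℕ.+ (v₁ ℕ.+ v₂ ℕ.+ v₃))
  eq₁₇ = ℕ-Ring.solve-∀
  eq₁₈ : ∀ a₁ p r v₁ v₂ v₃ →
    ((r ℕ.+ (2 ℕ.+ v₁)) ℕ.+ ((3 ℕ.+ a₁) ℕ.+ (r ℕ.+ (1 ℕ.+ v₂)))) ℕ.+ ((p ℕ.+ r) ℕ.+ v₃) ≡
    ((2 ℕ.+ (r ℕ.+ r ℕ.+ r ℕ.+ (v₁ ℕ.+ v₂ ℕ.+ v₃) ℕ.+ (3 ℕ.+ p)))) ℕ.+ suc a₁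
  eq₁₈ = ℕ-Ring.solve-∀

-- Twelve of the equations are identities. Six hold modulo the size condition, which `plus` and
-- `minus` bring in by adding the equal numbers `S` and `S′` to the two sides and cancelling.
hive-horn : ∀ a₁ a₂ a₃ p m₂ r v₁ v₂ v₃ →
  a₁ ℕ.+ a₂ ℕ.+ a₃ ≡ p ℕ.+ r ℕ.+ m₂ ℕ.+ r ℕ.+ (v₁ ℕ.+ v₂ ℕ.+ v₃) →
  Pointwise SameDifference
    (hiveDifferences (r ℕ.+ (2 ℕ.+ v₁)) (r ℕ.+ (1 ℕ.+ v₂)) (r ℕ.+ v₃) (3 ℕ.+ a₁) (2 ℕ.+ a₂) (1 ℕ.+ a₃)
       (2 ℕ.+ (r ℕ.+ r ℕ.+ r ℕ.+ (v₁ ℕ.+ v₂ ℕ.+ v₃) ℕ.+ (3 ℕ.+ p))))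
    (hornList a₁ a₂ a₃ (p ℕ.+ r) m₂ r v₁ v₂ v₃)
hive-horn a₁ a₂ a₃ p m₂ r v₁ v₂ v₃ size =
      plus (eq₁ a₁ a₂ a₃ p m₂ r v₁ v₂ v₃)
    ∷ minus (eq₂ a₁ a₂ a₃ p m₂ r v₁ v₂ v₃)
    ∷ eq₃ r v₂ v₃
    ∷ eq₄ r v₁ v₂
    ∷ eq₅ a₂ a₃
    ∷ eq₆ a₁ a₂ r v₁
    ∷ eq₇ a₁ p r v₁ v₂ v₃
    ∷ eq₈ a₂ p r v₁ v₂ v₃
    ∷ plus (eq₉ a₁ a₂ a₃ p m₂ r v₁ v₂ v₃)
    ∷ eq₁₀ a₂ a₃ p r v₁ v₂ v₃
    ∷ plus (eq₁₁ a₁ a₂ a₃ p m₂ r v₁ v₂ v₃)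
    ∷ eq₁₂ a₃ r v₁
    ∷ eq₁₃ a₃ r v₃
    ∷ eq₁₄ a₂ r v₂
    ∷ minus (eq₁₅ a₁ a₂ a₃ p m₂ r v₁ v₂ v₃)
    ∷ eq₁₆ a₁ a₂ r v₁
    ∷ minus (eq₁₇ a₁ a₂ a₃ p m₂ r v₁ v₂ v₃)
    ∷ eq₁₈ a₁ p r v₁ v₂ v₃
    ∷ []
    where
    S S′ : ℕ
    S = a₁ ℕ.+ a₂ ℕ.+ a₃
    S′ = p ℕ.+ r ℕ.+ m₂ ℕ.+ r ℕ.+ (v₁ ℕ.+ v₂ ℕ.+ v₃)
    plus : ∀ {x y} → x ℕ.+ S′ ≡ y ℕ.+ S → x ≡ y
    plus {x} {y} eq = ℕₚ.+-cancelʳ-≡ S x y (trans (cong (x ℕ.+_) size) eq)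
    minus : ∀ {x y} → x ℕ.+ S ≡ y ℕ.+ S′ → x ≡ y
    minus {x} {y} eq = ℕₚ.+-cancelʳ-≡ S x y (trans eq (cong (y ℕ.+_) (sym size)))

HornGap : ℕ → ℕ × ℕ → Set
HornGap k (a , b) = k ℕ.+ a ≤ suc b

-- c = 1 + the least slack of the Horn inequalities, or 0 if one of them fails.
LR-count : ∀ lam μ ν → ℓ lam ≤ 3 → ℓ μ ≤ 3 → ℓ ν ≤ 3 → ∀ {c} → IsLRCoefficient lam μ ν c →
  ∣ lam ∣₃ ≡ ∣ μ ∣₃ ℕ.+ ∣ ν ∣₃ →
  ∃[ g ] c ≡ + g × (∀ k → (suc k ≤ g → All (HornGap (suc k)) (hornInequalities lam μ ν))
                         × (All (HornGap (suc k)) (hornInequalities lam μ ν) → suc k ≤ g))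
LR-count lam μ ν lam≤3 μ≤3 ν≤3 {c} isLR size = answer l₁ ℕₚ.≤-refl
  where
  r = μ ₃
  p = μ ₁ ℕ.∸ μ ₃
  n₁ = r ℕ.+ (2 ℕ.+ ν ₁)
  n₂ = r ℕ.+ (1 ℕ.+ ν ₂)
  n₃ = r ℕ.+ ν ₃
  -- These exceed the coordinates of λ+ρ by one, matching the `suc` in the half-open intervals of
  -- `lgv`.
  l₁ = 3 ℕ.+ lam ₁
  l₂ = 2 ℕ.+ lam ₂
  l₃ = 1 ℕ.+ lam ₃
  T = r ℕ.+ r ℕ.+ r ℕ.+ ∣ ν ∣₃ ℕ.+ (3 ℕ.+ p)
  u = suc (suc T)
  open Hive n₁ n₂ n₃ l₁ l₂ l₃ T
  open BoxDifference A₁ l₁ A₂ B₂ n₃ B₃ T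
  open Box A₂ B₂ n₃ B₃ u

  μ₁≡ : p ℕ.+ r ≡ μ ₁
  μ₁≡ = ℕₚ.m∸n+n≡m (ℕₚ.≤-trans (κ₃≤κ₂ μ) (κ₂≤κ₁ μ))

  sameDifferences : Pointwise SameDifference (hiveDifferences n₁ n₂ n₃ l₁ l₂ l₃ u) (hornInequalities lam μ ν)
  sameDifferences = subst
    (λ m → Pointwise SameDifference (hiveDifferences n₁ n₂ n₃ l₁ l₂ l₃ u)
             (hornList (lam ₁) (lam ₂) (lam ₃) m (μ ₂) r (ν ₁) (ν ₂) (ν ₃)))
    μ₁≡ (hive-horn (lam ₁) (lam ₂) (lam ₃) p (μ ₂) r (ν ₁) (ν ₂) (ν ₃)
           (trans size (cong (λ m → m ℕ.+ μ ₂ ℕ.+ r ℕ.+ ∣ ν ∣₃) (sym μ₁≡))))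

  l₂≤l₁ : l₂ ≤ l₁
  l₂≤l₁ = s≤s (s≤s (ℕₚ.m≤n⇒m≤1+n (κ₂≤κ₁ lam)))
  l₃≤l₂ : l₃ ≤ l₂
  l₃≤l₂ = s≤s (ℕₚ.m≤n⇒m≤1+n (κ₃≤κ₂ lam))

  w : Test
  w = product (within A₁ l₁) (within A₂ B₂) (within n₃ B₃)

  c≡ : ∀ R → l₁ ≤ R → c ≡ slice R T w - slice R (suc T) w
  c≡ R l₁≤R = trans (LR-difference lam μ ν lam≤3 μ≤3 ν≤3 isLR size R l₁≤R (ℕₚ.≤-trans l₂≤l₁ l₁≤R)
                      (ℕₚ.≤-trans l₃≤l₂ (ℕₚ.≤-trans l₂≤l₁ l₁≤R)))
             (cong₂ _-_ (interlace T) (interlace (suc T)))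
    where
    interlace : ∀ T → _ ≡ slice R T w
    interlace T = lgv R T (ℕₚ.+-monoʳ-< r (s≤s (s≤s (κ₂≤κ₁ ν)))) (ℕₚ.+-monoʳ-< r (s≤s (κ₃≤κ₂ ν)))
                           (s≤s (s≤s (κ₂≤κ₁ lam))) (s≤s (κ₃≤κ₂ lam))

  B₂≤l₁ : B₂ ≤ l₁
  B₂≤l₁ = ℕₚ.≤-trans (ℕₚ.m⊓n≤n n₁ l₂) l₂≤l₁
  B₃≤l₁ : B₃ ≤ l₁
  B₃≤l₁ = ℕₚ.≤-trans (ℕₚ.m⊓n≤n n₂ l₃) (ℕₚ.≤-trans l₃≤l₂ l₂≤l₁)

  -- The second hive difference is 1 + μ₁ - μ₂, hence not negative; this is the comparison of
  -- trapezoid edges that `BoxDifference` requires.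
  nonnegative : B₂ ℕ.+ (A₁ ℕ.+ B₃) ℕ.+ (l₁ ℕ.+ n₃ ℕ.+ A₂) ≤ u ℕ.+ u
  nonnegative with sameDifferences
  ... | _ ∷ eq ∷ _ = subst (_≤ u ℕ.+ u) (sym lower₂)
        (ℕₚ.+-cancelʳ-≤ (suc (μ ₁)) _ (u ℕ.+ u)
          (subst (_≤ u ℕ.+ u ℕ.+ suc (μ ₁)) eq (ℕₚ.+-monoʳ-≤ (u ℕ.+ u) (ℕₚ.m≤n⇒m≤1+n (κ₂≤κ₁ μ)))))

  answer : ∀ R → l₁ ≤ R → ∃[ g ] c ≡ + g × (∀ k → (suc k ≤ g → All (HornGap (suc k)) (hornInequalities lam μ ν))
                                  × (All (HornGap (suc k)) (hornInequalities lam μ ν) → suc k ≤ g))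
  answer R l₁≤R with ℕₚ.≤-<-connex A₁ l₁
  ... | inj₁ A₁≤l₁ =
      antidiagonalCount l₁ ℕ.∸ antidiagonalCount A₁
    , trans (c≡ R l₁≤R) (trans (slice-difference R (ℕₚ.≤-trans B₂≤l₁ l₁≤R) (ℕₚ.≤-trans B₃≤l₁ l₁≤R) A₁≤l₁ l₁≤R)
                 (trans (ℤₚ.[+m]-[+n]≡m⊖n (antidiagonalCount l₁) (antidiagonalCount A₁))
                        (ℤₚ.⊖-≥ (counts-monotone A₁≤l₁ nonnegative))))
    , λ k → (λ k<g → let b , b′ = difference⇒bounds A₁≤l₁ nonnegative (s≤s z≤n) k<g in
                      gaps⇒ sameDifferences (bounds⇒differences b b′))
          , (λ gaps → let b , b′ = differences⇒bounds (gaps⇐ sameDifferences gaps) in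
                      bounds⇒difference A₁≤l₁ nonnegative b b′)
  -- The range of the first coordinate is empty and the coefficient is 0. As l₂ ≤ l₁, this case
  -- means l₁ < n₁, which contradicts the sixteenth inequality μ₃ + ν₁ ≤ λ₁.
  ... | inj₂ l₁<A₁ =
      0
    , trans (c≡ R l₁≤R) (cong₂ _-_ (empty T) (empty (suc T)))
    , λ k → (λ ()) , λ gaps → contradiction (gaps⇐ sameDifferences gaps) (violated k)
    where
    empty : ∀ T → slice R T w ≡ 0ℤ
    empty = slice-empty R (ℕₚ.≤-trans B₂≤l₁ l₁≤R) (ℕₚ.≤-trans B₃≤l₁ l₁≤R) (ℕₚ.<⇒≤ l₁<A₁)
    n₁≰l₁ : ¬ (n₁ ≤ l₁)
    n₁≰l₁ n₁≤l₁ = ℕₚ.<⇒≱ l₁<A₁ (ℕₚ.⊔-lub n₁≤l₁ l₂≤l₁)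
    violated : ∀ k → ¬ All (Gap (suc k)) (hiveDifferences n₁ n₂ n₃ l₁ l₂ l₃ u)
    violated k (_ ∷ _ ∷ _ ∷ _ ∷ _ ∷ _ ∷ _ ∷ _ ∷ _ ∷ _ ∷ _ ∷ _ ∷ _ ∷ _ ∷ _ ∷ g ∷ _) =
      n₁≰l₁ (≤-cancel l₂ (ℕₚ.≤-trans (ℕₚ.m≤n+m (n₁ ℕ.+ l₂) (suc k)) g) (ℕₚ.+-comm n₁ l₂) refl)

-- The facet criterion

All-Any : ∀ {A : Set} {P Q S : A → Set} {xs} → (∀ {x} → P x → Q x → S x) → All P xs → Any Q xs → Any S xs
All-Any f (p ∷ _)  (here q)   = here (f p q)
All-Any f (_ ∷ ps) (there qs) = there (All-Any f ps qs)

theorem3p1 : (lam μ ν : Partition) → ℓ lam ≤ 3 → ℓ μ ≤ 3 → ℓ ν ≤ 3 →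
    (c : ℤ) → IsLRCoefficient lam μ ν c →
    (c ≡ + 1) ⇔ OnFacet lam μ ν
theorem3p1 lam μ ν lam≤3 μ≤3 ν≤3 c isLR = mk⇔ to from
  where
  ineqs = hornInequalities lam μ ν
  to : c ≡ + 1 → OnFacet lam μ ν
  to c≡1 with ∣ lam ∣₃ ℕ.≟ ∣ μ ∣₃ ℕ.+ ∣ ν ∣₃
  ... | no size≢ = contradiction (trans (sym c≡1) (LR-size lam μ ν lam≤3 μ≤3 ν≤3 isLR size≢)) λ ()
  ... | yes size with LR-count lam μ ν lam≤3 μ≤3 ν≤3 isLR size
  ...   | g , c≡g , gaps with ℤₚ.+-injective (trans (sym c≡g) c≡1)
  -- With g = 1, `gaps 0` gives every inequality, and `gaps 1` shows that not all of them have slack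
  -- at least one; where the slack is smaller, equality holds.
  ...     | refl = (size , hold) , All-Any tight hold (¬All⇒Any¬ (λ (a , b) → 2 ℕ.+ a ℕ.≤? suc b) ineqs
                     λ all → contradiction (proj₂ (gaps 1) all) λ { (s≤s ()) })
    where
    hold : All (uncurry _≤_) ineqs
    hold = All.map ℕ.s≤s⁻¹ (proj₁ (gaps 0) ℕₚ.≤-refl)
    tight : ∀ {ab : ℕ × ℕ} → uncurry _≤_ ab → ¬ HornGap 2 ab → uncurry _≡_ ab
    tight a≤b ¬gap = ℕₚ.≤-antisym a≤b (ℕₚ.≮⇒≥ (¬gap ∘ s≤s))
  from : OnFacet lam μ ν → c ≡ + 1
  from ((size , hold) , tight) with LR-count lam μ ν lam≤3 μ≤3 ν≤3 isLR size
  ... | g , c≡g , gaps = trans c≡g (cong +_ (ℕₚ.≤-antisym (ℕₚ.≮⇒≥ not-two) (proj₂ (gaps 0) (All.map s≤s hold))))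
    where
    not-tight : ∀ {xs : List (ℕ × ℕ)} → All (HornGap 2) xs → ¬ Any (uncurry _≡_) xs
    not-tight (g ∷ _)  (here refl) = ℕₚ.1+n≰n (ℕ.s≤s⁻¹ g)
    not-tight (_ ∷ gs) (there any) = not-tight gs any
    not-two : ¬ (2 ≤ g)
    not-two 2≤g = not-tight (proj₁ (gaps 1) 2≤g) tight
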